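{- Let $k\geq 3$ and let $H$ be a covering $k$-hypergraph. Then $H$ admits an Euler tour if and only if $H$ has at least two edges.
   Context: A hypergraph $H=(V,E)$ consists of a finite non-empty vertex set $V$ and a finite multiset $E$ of subsets of $V$, called edges (repeated edges are allowed; distinct members of the multiset are regarded as distinct edges). $H$ is $k$-uniform if every edge has exactly $k$ elements. A walk in $H$ is a sequence $v_0e_1v_1e_2\dots e_mv_m$ with $v_i\in V$, $e_i\in E$, $v_{i-1},v_i\in e_i$ and $v_{i-1}\neq v_i$ for all $i$; it is a trail if $e_1,\dots,e_m$ are pairwise distinct (as members of the multiset), and closed if $v_0=v_m$ and $m\geq 2$. An Euler tour of $H$ is a closed trail that traverses every edge of $H$ exactly once. For $k\geq 3$, a covering $k$-hypergraph is a $k$-uniform hypergraph with at least one edge in which every $(k-1)$-subset of $V$ is contained in at least one edge. -}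

module Defs where

open import Data.Nat using (ℕ; zero; suc; _≤_; _∸_)
open import Data.Fin using (Fin; inject₁; fromℕ) renaming (suc to fsuc; zero to fzero)
open import Data.Fin.Subset using (Subset; _∈_; _⊆_; ∣_∣)
open import Data.Product using (Σ; ∃; _×_)
open import Relation.Binary.PropositionalEquality using (_≡_; _≢_)
open import Function.Definitions using (Injective; Surjective)

-- A hypergraph with vertex set Fin nV (nV ≥ 1, non-empty) and a multiset of
-- nE edges, given as an indexed family Fin nE → Subset nV (distinct indices
-- are distinct edges, repeated subsets allowed).
record Hypergraph : Set where
  field
    nV       : ℕ
    nV≥1     : 1 ≤ nV
    nE       : ℕ
    edge     : Fin nE → Subset nV
open Hypergraph public

Vertex : Hypergraph → Set
Vertex H = Fin (nV H)

Edge : Hypergraph → Set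
Edge H = Fin (nE H)

Uniform : ℕ → Hypergraph → Set
Uniform k H = (e : Edge H) → ∣ edge H e ∣ ≡ k

Covering : ℕ → Hypergraph → Set
Covering k H =
  Uniform k H × (1 ≤ nE H) ×
  ((S : Subset (nV H)) → ∣ S ∣ ≡ k ∸ 1 → ∃ λ (e : Edge H) → S ⊆ edge H e)

-- A walk of length m: v₀ e₁ v₁ … e_m v_m, with vertices indexed by Fin (suc m)
-- and edges indexed by Fin m (edge i is e_{i+1}, joining v_i and v_{i+1}).
record Walk (H : Hypergraph) (m : ℕ) : Set where
  field
    vert    : Fin (suc m) → Vertex H
    edg     : Fin m → Edge H
    inEdgeˡ : (i : Fin m) → vert (inject₁ i) ∈ edge H (edg i)
    inEdgeʳ : (i : Fin m) → vert (fsuc i) ∈ edge H (edg i)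
    distinct : (i : Fin m) → vert (inject₁ i) ≢ vert (fsuc i)
open Walk public

IsTrail : {H : Hypergraph} {m : ℕ} → Walk H m → Set
IsTrail {H} {m} w = Injective _≡_ _≡_ (edg w)

IsClosed : {H : Hypergraph} {m : ℕ} → Walk H m → Set
IsClosed {H} {m} w = (2 ≤ m) × (vert w fzero ≡ vert w (fromℕ m))

IsEulerTour : {H : Hypergraph} {m : ℕ} → Walk H m → Set
IsEulerTour {H} {m} w =
  IsClosed w × IsTrail w × Surjective _≡_ _≡_ (edg w)

HasEulerTour : Hypergraph → Set
HasEulerTour H = ∃ λ (m : ℕ) → Σ (Walk H m) IsEulerTour

{-# OPTIONS --safe #-}
module Submission where

-- Fixing k − 3 vertices reduces the claim to k = 3: choose from every triple a pair of vertices so that the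
-- resulting multigraph is connected with all degrees even.  Take two vertices v, q as hubs.  First choose
-- pairs from the far triples, those avoiding both hubs, so that every component they form has a vertex of odd
-- degree; exchanging the pair of one triple in an even component achieves this.  A triple {v, x, y} or
-- {q, x, y} with a hub can repair the parity of x or y without affecting any other non-hub, and a colouring
-- argument lets every non-hub own such a triple.  A component that misses both hubs must then contain a pair xy
-- chosen from a triple with a hub; replacing it by a pair with the hub, and restoring the parity of the other end
-- through a triple with the other hub, attaches the component.  It remains to link v with q and to make their
-- degrees even.  If two triples share the pair vq, one of them can supply the link and the other the parity.
-- Otherwise two triples share at most one vertex; then a counting argument yields a vertex z of even degree in
-- the far triples, adjacent through v to one of odd degree, and the pairs vz and qz provide the link.

open import Defs
open import Algebra.Bundles using (CommutativeRing; CommutativeMonoid)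
open import Data.Bool using (Bool; true; false; not; _∧_; _∨_; _xor_; if_then_else_)
open import Data.Bool.Properties
  using (xor-comm; xor-assoc; xor-same; xor-identityʳ; ∧-distribˡ-xor; not-involutive; xor-∧-commutativeRing)
  renaming (_≟_ to _≟ᵇ_)
open import Data.Empty using (⊥; ⊥-elim)
open import Data.Fin using (Fin; zero; suc; _≟_; inject₁; fromℕ) renaming (_<_ to _<ᶠ_)
open import Data.Fin.Properties using (any?; suc-injective; injective⇒≤; _<?_; <-cmp; <-asym)
open import Data.Nat using (ℕ; zero; suc; _+_; _≤_; _<_; z≤n; s≤s)
open import Data.Nat.Induction using (<-wellFounded)
import Data.Nat.Properties as ℕₚ
open import Data.Product using (∃; ∃₂; _×_; _,_; proj₁; proj₂)
open import Data.Sum using (_⊎_; inj₁; inj₂; [_,_]′)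
open import Function using (_∘_; id; case_of_)
open import Function.Bundles using (_⇔_; mk⇔)
open import Function.Definitions using (Injective)
open import Induction.WellFounded using (Acc; acc)
open import Relation.Binary.Definitions using (tri<; tri≈; tri>)
open import Relation.Binary.PropositionalEquality
open import Relation.Nullary using (Dec; yes; no; ¬_; does)
open import Relation.Nullary.Decidable using (dec-true; dec-false; _×-dec_; _⊎-dec_; ¬?)

-- Why every far component should have an odd vertex: the repair leaves every non-hub even, so a
-- vertex that is odd in the far triples also lies on a pair chosen from a triple with a hub. At
-- such a pair a detached component can be opened. Why there are two hubs: attaching x through {x,
-- y, h} spoils the parity of y, and y must be restored through a different triple. A triple through
-- y and the other hub is never {x, y, h}. Attaching must not destroy the pairs reserved for linking
-- v and q. Their triples are therefore held fixed, and each final case has to show that no detached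
-- pair has both ends in fixed triples. Why parities are prescribed: if c owns {v, q, c}, this
-- triple carries the pair vq when c needs no repair, and a pair of c with a hub when it does. The
-- first kind links the hubs; the second can be moved from one hub to the other and so corrects
-- their degrees. The parity of c in the far triples thus decides the use of the triple. To control
-- it, the exchanges in the far triples preserve the number of odd vertices in a given set Y modulo
-- 2.

private variable n m k : ℕ

infix 7 _==_
_==_ : Fin n → Fin n → Bool
x == y = does (x ≟ y)

==-refl : (x : Fin n) → x == x ≡ true
==-refl x = dec-true (x ≟ x) refl

==-≢ : {x y : Fin n} → x ≢ y → x == y ≡ false
==-≢ {x = x} {y} = dec-false (x ≟ y)

true≢false : true ≢ false
true≢false ()

≢true⇒≡false : {b : Bool} → b ≢ true → b ≡ false
≢true⇒≡false {true} h = ⊥-elim (h refl)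
≢true⇒≡false {false} _ = refl

xor-interchange : ∀ a b c d → (a xor b) xor (c xor d) ≡ (a xor c) xor (b xor d)
xor-interchange = interchange
  where
  open CommutativeRing xor-∧-commutativeRing using (+-commutativeMonoid)
  open CommutativeMonoid +-commutativeMonoid using (commutativeSemigroup)
  open import Algebra.Properties.CommutativeSemigroup commutativeSemigroup using (interchange)

xor-cancelˡ : ∀ a b → a xor (a xor b) ≡ b
xor-cancelˡ true b = not-involutive b
xor-cancelˡ false b = refl

if-true : ∀ {b} {A : Set} {x y : A} → b ≡ true → (if b then x else y) ≡ x
if-true refl = refl

if-false : ∀ {b} {A : Set} {x y : A} → b ≡ false → (if b then x else y) ≡ y
if-false refl = refl

-- Sums modulo 2

⨁ : (Fin k → Bool) → Bool
⨁ {zero}  f = false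
⨁ {suc k} f = f zero xor ⨁ (f ∘ suc)

⨁-cong : {f g : Fin k → Bool} → (∀ i → f i ≡ g i) → ⨁ f ≡ ⨁ g
⨁-cong {zero}  eq = refl
⨁-cong {suc k} eq = cong₂ _xor_ (eq zero) (⨁-cong (eq ∘ suc))

⨁-false : {f : Fin k → Bool} → (∀ i → f i ≡ false) → ⨁ f ≡ false
⨁-false {zero}  eq = refl
⨁-false {suc k} eq = cong₂ _xor_ (eq zero) (⨁-false (eq ∘ suc))

⨁-xor : (f g : Fin k → Bool) → ⨁ (λ i → f i xor g i) ≡ ⨁ f xor ⨁ g
⨁-xor {zero}  f g = refl
⨁-xor {suc k} f g =
  trans (cong ((f zero xor g zero) xor_) (⨁-xor (f ∘ suc) (g ∘ suc)))
        (xor-interchange (f zero) (g zero) (⨁ (f ∘ suc)) (⨁ (g ∘ suc)))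

⨁-swap : (f : Fin k → Fin m → Bool) → ⨁ (λ i → ⨁ (f i)) ≡ ⨁ (λ j → ⨁ (λ i → f i j))
⨁-swap {zero} {m} f = sym (⨁-false {m} {λ _ → false} (λ _ → refl))
⨁-swap {suc k} f =
  trans (cong (⨁ (f zero) xor_) (⨁-swap (f ∘ suc)))
        (sym (⨁-xor (f zero) (λ j → ⨁ (λ i → f (suc i) j))))

⨁-single : (f : Fin k → Bool) (i : Fin k) → (∀ j → j ≢ i → f j ≡ false) → ⨁ f ≡ f i
⨁-single f zero    z =
  trans (cong (f zero xor_) (⨁-false (λ j → z (suc j) λ ()))) (xor-identityʳ (f zero))
⨁-single f (suc i) z =
  trans (cong (_xor ⨁ (f ∘ suc)) (z zero λ ()))
        (⨁-single (f ∘ suc) i (λ j ne → z (suc j) (ne ∘ suc-injective)))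

⨁-∧ : ∀ b (f : Fin k → Bool) → ⨁ (λ i → b ∧ f i) ≡ b ∧ ⨁ f
⨁-∧ true  f = refl
⨁-∧ {k} false f = ⨁-false {k} {λ _ → false} (λ _ → refl)

⨁-true : (f : Fin k → Bool) → ⨁ f ≡ true → ∃ λ i → f i ≡ true
⨁-true {suc k} f eq with f zero in eq₀
... | true  = zero , eq₀
... | false with i , p ← ⨁-true (f ∘ suc) eq = suc i , p

⨁-select : (f : Fin k → Bool) (s : Fin k) → ⨁ (λ x → f x ∧ x == s) ≡ f s
⨁-select f s = trans (⨁-single (λ x → f x ∧ x == s) s off) on
  where
  ∧-falseʳ : ∀ a → a ∧ false ≡ false
  ∧-falseʳ true = refl
  ∧-falseʳ false = refl
  ∧-trueʳ : ∀ a → a ∧ true ≡ a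
  ∧-trueʳ true = refl
  ∧-trueʳ false = refl
  off : ∀ j → j ≢ s → (f j ∧ j == s) ≡ false
  off j ne = trans (cong (f j ∧_) (==-≢ ne)) (∧-falseʳ (f j))
  on : (f s ∧ s == s) ≡ f s
  on = trans (cong (f s ∧_) (==-refl s)) (∧-trueʳ (f s))

count : (Fin k → Bool) → ℕ
count {zero}  f = 0
count {suc k} f = (if f zero then 1 else 0) + count (f ∘ suc)

indicator-mono : ∀ a b → (a ≡ true → b ≡ true) → (if a then 1 else 0) ≤ (if b then 1 else 0)
indicator-mono false b h = z≤n
indicator-mono true  b h rewrite h refl = ℕₚ.≤-refl

count-mono : {f g : Fin k → Bool} → (∀ i → f i ≡ true → g i ≡ true) → count f ≤ count g
count-mono {zero}  h = z≤n
count-mono {suc k} {f} {g} h = ℕₚ.+-mono-≤ (indicator-mono (f zero) (g zero) (h zero)) (count-mono (h ∘ suc))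

count-strict : {f g : Fin k → Bool} → (∀ i → f i ≡ true → g i ≡ true) →
               (i : Fin k) → f i ≡ false → g i ≡ true → count f < count g
count-strict {suc k} h zero    fi gi rewrite fi | gi = s≤s (count-mono (h ∘ suc))
count-strict {suc k} {f} {g} h (suc i) fi gi = ℕₚ.+-mono-≤-< (indicator-mono (f zero) (g zero) (h zero)) (count-strict (h ∘ suc) i fi gi)

-- Multigraphs

-- An edge whose two ends coincide counts as removed.
Graph : ℕ → ℕ → Set
Graph n m = Fin m → Fin n × Fin n

-- A row of the incidence matrix over the field of two elements. A pair with equal ends gives the
-- zero row, which hides removed edges from `deg`.
row : Fin n × Fin n → Fin n → Bool
row (s , t) x = x == s xor x == t

deg : Graph n m → Fin n → Bool
deg P x = ⨁ (λ e → row (P e) x)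

row-fst : {s t : Fin n} → s ≢ t → row (s , t) s ≡ true
row-fst {s = s} {t} ne rewrite ==-refl s | ==-≢ ne = refl

row-snd : {s t : Fin n} → s ≢ t → row (s , t) t ≡ true
row-snd {s = s} {t} ne rewrite ==-refl t | ==-≢ (ne ∘ sym) = refl

row-off : {s t x : Fin n} → x ≢ s → x ≢ t → row (s , t) x ≡ false
row-off a b rewrite ==-≢ a | ==-≢ b = refl

row-loop : (s x : Fin n) → row (s , s) x ≡ false
row-loop s x = xor-same (x == s)

row-true : (p : Fin n × Fin n) (x : Fin n) → row p x ≡ true → (x ≡ proj₁ p) ⊎ (x ≡ proj₂ p)
row-true (s , t) x eq with x ≟ s | x ≟ t
... | yes a | _     = inj₁ a
... | no _  | yes b = inj₂ b
... | no _  | no _  = ⊥-elim (true≢false (sym eq))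

_[_≔_] : Graph n m → Fin m → Fin n × Fin n → Graph n m
(P [ e ≔ p ]) e′ = if e′ == e then p else P e′

≔-same : (P : Graph n m) (e : Fin m) {p : Fin n × Fin n} → (P [ e ≔ p ]) e ≡ p
≔-same P e rewrite ==-refl e = refl

≔-other : (P : Graph n m) {e e′ : Fin m} {p : Fin n × Fin n} → e′ ≢ e → (P [ e ≔ p ]) e′ ≡ P e′
≔-other P ne rewrite ==-≢ ne = refl

-- In the sum of the old and the new degree every summand except that of `e` cancels.
deg-≔ : (P : Graph n m) (e : Fin m) (p : Fin n × Fin n) (x : Fin n) →
        deg (P [ e ≔ p ]) x ≡ deg P x xor (row (P e) x xor row p x)
deg-≔ P e p x =
  trans (sym (xor-cancelˡ (deg P x) (deg P′ x)))
        (cong (deg P x xor_)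
          (trans (sym (⨁-xor (λ i → row (P i) x) (λ i → row (P′ i) x)))
                 (trans (⨁-single _ e off) (cong (λ r → row (P e) x xor row r x) (≔-same P e)))))
  where
  P′ = P [ e ≔ p ]
  off : ∀ i → i ≢ e → row (P i) x xor row (P′ i) x ≡ false
  off i ne rewrite ==-≢ ne = xor-same (row (P i) x)

-- Double counting of incidences, restricted to `Y`. With `Y` constantly true it is the handshake
-- lemma; with `Y` a union of components it shows that the component has evenly many odd vertices.
deg-sum : (P : Graph n m) (Y : Fin n → Bool) →
          ⨁ (λ x → Y x ∧ deg P x) ≡ ⨁ (λ e → Y (proj₁ (P e)) xor Y (proj₂ (P e)))
deg-sum P Y =
  trans (⨁-cong (λ x → sym (⨁-∧ (Y x) (λ e → row (P e) x))))
  (trans (⨁-swap (λ x e → Y x ∧ row (P e) x))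
         (⨁-cong λ e → trans (⨁-cong (λ x → ∧-distribˡ-xor (Y x) (x == proj₁ (P e)) (x == proj₂ (P e))))
           (trans (⨁-xor (λ x → Y x ∧ x == proj₁ (P e)) (λ x → Y x ∧ x == proj₂ (P e)))
                  (cong₂ _xor_ (⨁-select Y _) (⨁-select Y _)))))

Joins : Fin n × Fin n → Fin n → Fin n → Set
Joins p x y = (p ≡ (x , y)) ⊎ (p ≡ (y , x))

Joins-sym : {p : Fin n × Fin n} {x y : Fin n} → Joins p x y → Joins p y x
Joins-sym (inj₁ e) = inj₂ e
Joins-sym (inj₂ e) = inj₁ e

Joins-end : {p : Fin n × Fin n} {x y a b : Fin n} → Joins p x y → Joins p a b → a ≡ x ⊎ a ≡ y
Joins-end (inj₁ e) (inj₁ f) = inj₁ (cong proj₁ (trans (sym f) e))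
Joins-end (inj₁ e) (inj₂ f) = inj₂ (cong proj₂ (trans (sym f) e))
Joins-end (inj₂ e) (inj₁ f) = inj₂ (cong proj₁ (trans (sym f) e))
Joins-end (inj₂ e) (inj₂ f) = inj₁ (cong proj₂ (trans (sym f) e))

data Reach (P : Graph n m) : Fin n → Fin n → Set where
  stop : ∀ {x} → Reach P x x
  step : ∀ {x y z} (e : Fin m) → Joins (P e) x y → Reach P y z → Reach P x z

module _ {P : Graph n m} where
  edge-reach : ∀ {x y} (e : Fin m) → Joins (P e) x y → Reach P x y
  edge-reach e j = step e j stop

  Reach-trans : ∀ {x y z} → Reach P x y → Reach P y z → Reach P x z
  Reach-trans stop s = s
  Reach-trans (step e j r) s = step e j (Reach-trans r s)

  Reach-sym : ∀ {x y} → Reach P x y → Reach P y x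
  Reach-sym stop = stop
  Reach-sym (step e j r) = Reach-trans (Reach-sym r) (edge-reach e (Joins-sym j))

Reach-transfer : {P : Graph n m} (Good : Fin n → Set) →
                 (∀ e x y → Joins (P e) x y → Good y → Good x) →
                 ∀ {x y} → Reach P x y → Good y → Good x
Reach-transfer G h stop g = g
Reach-transfer G h (step e j r) g = h e _ _ j (Reach-transfer G h r g)

-- The component is kept as a Boolean function so that degrees can be summed over it modulo 2;
-- `sound` and `closed` together pin it down.
record Component (P : Graph n m) (x : Fin n) : Set where
  field
    In      : Fin n → Bool
    start   : In x ≡ true
    sound   : ∀ y → In y ≡ true → Reach P x y
    closed  : ∀ e → In (proj₁ (P e)) ≡ In (proj₂ (P e))

  complete : ∀ {y z} → Reach P y z → In y ≡ true → In z ≡ true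
  complete stop i = i
  complete (step e (inj₁ eq) r) i =
    complete r (trans (sym (trans (cong (In ∘ proj₁) (sym eq)) (trans (closed e) (cong (In ∘ proj₂) eq)))) i)
  complete (step e (inj₂ eq) r) i =
    complete r (trans (trans (cong (In ∘ proj₁) (sym eq)) (trans (closed e) (cong (In ∘ proj₂) eq))) i)

component : (P : Graph n m) (x : Fin n) → Component P x
component {n = n} {m = m} P x = grow (count (λ y → not (y == x))) (_== x) ℕₚ.≤-refl (==-refl x) snd₀
  where
  snd₀ : ∀ y → y == x ≡ true → Reach P x y
  snd₀ y eq with y ≟ x
  ... | yes refl = stop
  ... | no _ = ⊥-elim (true≢false (sym eq))

  grow : (k : ℕ) (S : Fin n → Bool) → count (not ∘ S) ≤ k → S x ≡ true →
         (∀ y → S y ≡ true → Reach P x y) → Component P x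
  add : (k : ℕ) (S : Fin n → Bool) → count (not ∘ S) ≤ k → S x ≡ true →
        (∀ y → S y ≡ true → Reach P x y) → (e : Fin m) (a b : Fin n) → Joins (P e) a b →
        S a ≡ true → S b ≡ false → Component P x

  grow k S le Sx snd with any? (λ e → ¬? (S (proj₁ (P e)) ≟ᵇ S (proj₂ (P e))))
  ... | no none = record
    { In = S ; start = Sx ; sound = snd
    ; closed = λ e → case S (proj₁ (P e)) ≟ᵇ S (proj₂ (P e)) of λ
        { (yes p) → p ; (no ne) → ⊥-elim (none (e , ne)) } }
  ... | yes (e , ne) with S (proj₁ (P e)) in s₁ | S (proj₂ (P e)) in s₂
  ...   | true  | true  = ⊥-elim (ne refl)
  ...   | false | false = ⊥-elim (ne refl)
  ...   | true  | false = add k S le Sx snd e _ _ (inj₁ refl) s₁ s₂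
  ...   | false | true  = add k S le Sx snd e _ _ (inj₂ refl) s₂ s₁

  add k S le Sx snd e a b j Sa Sb = go k le
    where
    S′ : Fin n → Bool
    S′ y = S y ∨ y == b
    smaller : count (not ∘ S′) < count (not ∘ S)
    smaller = count-strict (λ y → mono (S y)) b (one (S b) (==-refl b)) (cong not Sb)
      where
      mono : ∀ s {t} → not (s ∨ t) ≡ true → not s ≡ true
      mono false _ = refl
      one : ∀ s {t} → t ≡ true → not (s ∨ t) ≡ false
      one true _ = refl
      one false refl = refl
    snd′ : ∀ y → S′ y ≡ true → Reach P x y
    snd′ y eq with S y in Sy | y ≟ b
    ... | true  | _        = snd y Sy
    ... | false | yes refl = Reach-trans (snd a Sa) (edge-reach e j)
    ... | false | no _     = ⊥-elim (true≢false (sym eq))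
    go : ∀ k → count (not ∘ S) ≤ k → Component P x
    go zero le = ⊥-elim (ℕₚ.n≮0 (ℕₚ.<-≤-trans smaller le))
    go (suc k) le = grow k S′ (ℕₚ.≤-pred (ℕₚ.<-≤-trans smaller le)) (cong (_∨ x == b) Sx) snd′

reach? : (P : Graph n m) (x y : Fin n) → Dec (Reach P x y)
reach? P x y = case In y ≟ᵇ true of λ
  { (yes i) → yes (sound y i) ; (no ¬i) → no (λ r → ¬i (complete r start)) }
  where open Component (component P x)

-- The number of odd vertices of a component is even.
odd-partner : (P : Graph n m) (x : Fin n) → deg P x ≡ true →
              ∃ λ u → u ≢ x × Reach P x u × deg P u ≡ true
odd-partner {n = n} P x odd = pick (⨁-true _ total)
  where
  open Component (component P x)
  even : ⨁ (λ y → In y ∧ deg P y) ≡ false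
  even = trans (deg-sum P In) (⨁-false (λ e → trans (cong (In (proj₁ (P e)) xor_) (sym (closed e))) (xor-same (In (proj₁ (P e))))))
  at : ⨁ (λ y → (In y ∧ deg P y) ∧ y == x) ≡ true
  at = trans (⨁-select (λ y → In y ∧ deg P y) x) (cong₂ _∧_ start odd)
  total : ⨁ (λ y → (In y ∧ deg P y) xor ((In y ∧ deg P y) ∧ y == x)) ≡ true
  total = trans (⨁-xor (λ y → In y ∧ deg P y) _) (cong₂ _xor_ even at)
  pick : ∃ (λ u → (In u ∧ deg P u) xor ((In u ∧ deg P u) ∧ u == x) ≡ true) →
         ∃ λ u → u ≢ x × Reach P x u × deg P u ≡ true
  pick (u , eq) with In u in iu | deg P u in du | u ≟ x
  ... | true  | true  | no ne = u , ne , sound u iu , du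
  ... | true  | true  | yes _ = ⊥-elim (true≢false (sym eq))
  ... | true  | false | _     = ⊥-elim (true≢false (sym eq))
  ... | false | _     | _     = ⊥-elim (true≢false (sym eq))

-- Choosing pairs from triples

does-true : {A : Set} (d : Dec A) → does d ≡ true → A
does-true (yes a) _ = a

does-false : {A : Set} (d : Dec A) → does d ≡ false → ¬ A
does-false (no ¬a) _ = ¬a

record Triple (n : ℕ) : Set where
  constructor triple
  field
    v₁ v₂ v₃ : Fin n
    ≢₁₂ : v₁ ≢ v₂
    ≢₁₃ : v₁ ≢ v₃
    ≢₂₃ : v₂ ≢ v₃

infix 4 _∈ₜ_
_∈ₜ_ : Fin n → Triple n → Set
x ∈ₜ T = x ≡ v₁ ⊎ x ≡ v₂ ⊎ x ≡ v₃
  where open Triple T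

_∈ₜ?_ : (x : Fin n) (T : Triple n) → Dec (x ∈ₜ T)
x ∈ₜ? T = (x ≟ v₁) ⊎-dec (x ≟ v₂) ⊎-dec (x ≟ v₃)
  where open Triple T

-- The unordered reading of a triple: its vertices may be named in whichever order a case needs.
record Comprises (T : Triple n) (x y z : Fin n) : Set where
  field
    ∈₁   : x ∈ₜ T
    ∈₂   : y ∈ₜ T
    ∈₃   : z ∈ₜ T
    1≢2  : x ≢ y
    1≢3  : x ≢ z
    2≢3  : y ≢ z
    only : ∀ {w} → w ∈ₜ T → w ≡ x ⊎ w ≡ y ⊎ w ≡ z

third : (T : Triple n) {x y : Fin n} → x ∈ₜ T → y ∈ₜ T → x ≢ y → ∃ (Comprises T x y)
third T@(triple a b c ab ac bc) = λ
  { (inj₁ refl) (inj₁ refl) ne → ⊥-elim (ne refl)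
  ; (inj₁ refl) (inj₂ (inj₁ refl)) ne → c , mk i₁ i₂ i₃ ab ac bc id
  ; (inj₁ refl) (inj₂ (inj₂ refl)) ne → b , mk i₁ i₃ i₂ ac ab (bc ∘ sym) λ { (inj₁ e) → inj₁ e ; (inj₂ (inj₁ e)) → inj₂ (inj₂ e) ; (inj₂ (inj₂ e)) → inj₂ (inj₁ e) }
  ; (inj₂ (inj₁ refl)) (inj₁ refl) ne → c , mk i₂ i₁ i₃ (ab ∘ sym) bc ac λ { (inj₁ e) → inj₂ (inj₁ e) ; (inj₂ (inj₁ e)) → inj₁ e ; (inj₂ (inj₂ e)) → inj₂ (inj₂ e) }
  ; (inj₂ (inj₁ refl)) (inj₂ (inj₁ refl)) ne → ⊥-elim (ne refl)
  ; (inj₂ (inj₁ refl)) (inj₂ (inj₂ refl)) ne → a , mk i₂ i₃ i₁ bc (ab ∘ sym) (ac ∘ sym) λ { (inj₁ e) → inj₂ (inj₂ e) ; (inj₂ (inj₁ e)) → inj₁ e ; (inj₂ (inj₂ e)) → inj₂ (inj₁ e) }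
  ; (inj₂ (inj₂ refl)) (inj₁ refl) ne → b , mk i₃ i₁ i₂ (ac ∘ sym) (bc ∘ sym) ab λ { (inj₁ e) → inj₂ (inj₁ e) ; (inj₂ (inj₁ e)) → inj₂ (inj₂ e) ; (inj₂ (inj₂ e)) → inj₁ e }
  ; (inj₂ (inj₂ refl)) (inj₂ (inj₁ refl)) ne → a , mk i₃ i₂ i₁ (bc ∘ sym) (ac ∘ sym) (ab ∘ sym) λ { (inj₁ e) → inj₂ (inj₂ e) ; (inj₂ (inj₁ e)) → inj₂ (inj₁ e) ; (inj₂ (inj₂ e)) → inj₁ e }
  ; (inj₂ (inj₂ refl)) (inj₂ (inj₂ refl)) ne → ⊥-elim (ne refl) }
  where
  i₁ : a ∈ₜ T
  i₁ = inj₁ refl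
  i₂ : b ∈ₜ T
  i₂ = inj₂ (inj₁ refl)
  i₃ : c ∈ₜ T
  i₃ = inj₂ (inj₂ refl)
  mk : ∀ {x y z} → x ∈ₜ T → y ∈ₜ T → z ∈ₜ T → x ≢ y → x ≢ z → y ≢ z →
       (∀ {w} → w ∈ₜ T → w ≡ x ⊎ w ≡ y ⊎ w ≡ z) → Comprises T x y z
  mk a b c d e f g = record { ∈₁ = a ; ∈₂ = b ; ∈₃ = c ; 1≢2 = d ; 1≢3 = e ; 2≢3 = f ; only = g }

module _ {T : Triple n} {x y z : Fin n} (c : Comprises T x y z) where
  open Comprises c
  Comprises-213 : Comprises T y x z
  Comprises-213 = record { ∈₁ = ∈₂ ; ∈₂ = ∈₁ ; ∈₃ = ∈₃ ; 1≢2 = 1≢2 ∘ sym ; 1≢3 = 2≢3 ; 2≢3 = 1≢3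
                         ; only = λ i → case only i of λ { (inj₁ e) → inj₂ (inj₁ e) ; (inj₂ (inj₁ e)) → inj₁ e ; (inj₂ (inj₂ e)) → inj₂ (inj₂ e) } }
  Comprises-132 : Comprises T x z y
  Comprises-132 = record { ∈₁ = ∈₁ ; ∈₂ = ∈₃ ; ∈₃ = ∈₂ ; 1≢2 = 1≢3 ; 1≢3 = 1≢2 ; 2≢3 = 2≢3 ∘ sym
                         ; only = λ i → case only i of λ { (inj₁ e) → inj₁ e ; (inj₂ (inj₁ e)) → inj₂ (inj₂ e) ; (inj₂ (inj₂ e)) → inj₂ (inj₁ e) } }

Valid : Triple n → Fin n × Fin n → Set
Valid T (s , t) = s ∈ₜ T × t ∈ₜ T × s ≢ t

Valid-Joins : {T : Triple n} {p : Fin n × Fin n} {x y : Fin n} → Valid T p → Joins p x y → Valid T (x , y)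
Valid-Joins v (inj₁ refl) = v
Valid-Joins (a , b , c) (inj₂ refl) = b , a , c ∘ sym

row-Joins : {p : Fin n × Fin n} {x y : Fin n} → Joins p x y → ∀ u → row p u ≡ row (x , y) u
row-Joins (inj₁ refl) u = refl
row-Joins {x = x} {y} (inj₂ refl) u = xor-comm (u == y) (u == x)

incident : (p : Fin n × Fin n) (x : Fin n) → row p x ≡ true → ∃ (Joins p x)
incident (s , t) x eq = case row-true (s , t) x eq of λ
  { (inj₁ refl) → t , inj₁ refl ; (inj₂ refl) → s , inj₂ refl }

-- A step along a loop goes nowhere, so the loops of `G` may become any pairs in `G′`. A walk found
-- after deleting some edges therefore survives every exchange of pairs at those edges.
Reach-map : {G G′ : Graph n m} → (∀ e → (∃ λ a → G e ≡ (a , a)) ⊎ (G e ≡ G′ e)) →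
            ∀ {x y} → Reach G x y → Reach G′ x y
Reach-map h stop = stop
Reach-map h (step e j r) = case h e of λ
  { (inj₂ eq) → step e (subst (λ p → Joins p _ _) eq j) (Reach-map h r)
  ; (inj₁ (a , eq)) → loop (trans-j eq j) (Reach-map h r) }
  where
  trans-j : ∀ {p q x y} → p ≡ q → Joins p x y → Joins q x y
  trans-j refl j = j
  loop : ∀ {P : Graph _ _} {a x y z} → Joins (a , a) x y → Reach P y z → Reach P x z
  loop (inj₁ refl) r = r
  loop (inj₂ refl) r = r

drop⇒ : {G G′ : Graph n m} (e : Fin m) {a : Fin n} → (∀ {i} → i ≢ e → G′ i ≡ G i) →
        ∀ {x y} → Reach (G [ e ≔ (a , a) ]) x y → Reach G′ x y
drop⇒ {G = G} {G′} e {a} h = Reach-map λ i → case i ≟ e of λ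
  { (yes refl) → inj₁ (a , ≔-same G e)
  ; (no ne) → inj₂ (trans (≔-other G ne) (sym (h ne))) }

drop-step : {G : Graph n m} (e : Fin m) {a : Fin n} {x y : Fin n} → Reach (G [ e ≔ (a , a) ]) x y → Reach G x y
drop-step e = drop⇒ e (λ _ → refl)

-- Without e, the ends x and y are the only odd vertices of their component.
bypass : (P : Graph n m) (e : Fin m) {x y : Fin n} → x ≢ y → Joins (P e) x y →
         (∀ u → Reach P x u → deg P u ≡ false) → Reach (P [ e ≔ (x , x) ]) x y
bypass P e {x} {y} ne j even = finish (odd-partner (P [ e ≔ (x , x) ]) x oddx)
  where
  degs : ∀ u → Reach P x u → deg (P [ e ≔ (x , x) ]) u ≡ row (x , y) u
  degs u r = trans (deg-≔ P e (x , x) u)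
    (trans (cong₂ _xor_ (even u r) (cong₂ _xor_ (row-Joins j u) (row-loop x u))) (xor-identityʳ _))
  oddx : deg (P [ e ≔ (x , x) ]) x ≡ true
  oddx = trans (degs x stop) (row-fst ne)
  finish : (∃ λ u → u ≢ x × Reach (P [ e ≔ (x , x) ]) x u × deg (P [ e ≔ (x , x) ]) u ≡ true) →
           Reach (P [ e ≔ (x , x) ]) x y
  finish (u , u≢x , r , odd) = case row-true (x , y) u (trans (sym (degs u (drop-step e r))) odd) of λ
    { (inj₁ eq) → ⊥-elim (u≢x eq) ; (inj₂ refl) → r }

-- Exchanging pairs until every component has an odd vertex

module OddRooted (tri : Fin m → Triple n) (F : Fin m → Bool) (o : Fin n) (Y : Fin n → Bool) where

  Partial : Graph n m → Set
  Partial Q = ∀ e → (F e ≡ true × Valid (tri e) (Q e)) ⊎ (F e ≡ false × Q e ≡ (o , o))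

  -- By deg-sum the total weight of a graph is the sum of its degrees over Y.
  weight : Fin n × Fin n → Bool
  weight (s , t) = Y s xor Y t

  Rooted : Graph n m → Fin n → Set
  Rooted Q u = ∃ λ w → Reach Q u w × deg Q w ≡ true

  rooted? : (Q : Graph n m) (u : Fin n) → Dec (Rooted Q u)
  rooted? Q u = any? λ w → reach? Q u w ×-dec (deg Q w ≟ᵇ true)

  -- The fields make the number of unrooted triples drop: by `changed` and `mono` no triple becomes
  -- unrooted, and `e*` ceases to be so. The field `same` preserves the parity that a caller has
  -- prescribed.
  record Improves (Q Q′ : Graph n m) : Set where
    field
      partial : Partial Q′
      same    : ⨁ (weight ∘ Q′) ≡ ⨁ (weight ∘ Q)
      changed : ∀ e → (Q′ e ≡ Q e) ⊎ Rooted Q′ (proj₁ (Q′ e))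
      mono    : ∀ u → Rooted Q u → Rooted Q′ u
      e*      : Fin m
      e*-F    : F e* ≡ true
      before  : ¬ Rooted Q (proj₁ (Q e*))
      after   : Rooted Q′ (proj₁ (Q′ e*))

  partial-≔ : {Q : Graph n m} (e : Fin m) {p : Fin n × Fin n} → Partial Q → F e ≡ true → Valid (tri e) p → Partial (Q [ e ≔ p ])
  partial-≔ {Q} e pQ Fe v i = case i ≟ e of λ
    { (yes refl) → inj₁ (Fe , subst (Valid (tri e)) (sym (≔-same Q e)) v)
    ; (no ne) → case pQ i of λ
      { (inj₁ (a , b)) → inj₁ (a , subst (Valid (tri i)) (sym (≔-other Q ne)) b)
      ; (inj₂ (a , b)) → inj₂ (a , trans (≔-other Q ne) b) } }

  weight-Joins : ∀ {p x y} → Joins p x y → weight p ≡ weight (x , y)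
  weight-Joins (inj₁ refl) = refl
  weight-Joins {x = x} {y} (inj₂ refl) = xor-comm (Y y) (Y x)

  sum-≔ : (Q : Graph n m) (e : Fin m) (p : Fin n × Fin n) → ⨁ (weight ∘ (Q [ e ≔ p ])) ≡ ⨁ (weight ∘ Q) xor (weight (Q e) xor weight p)
  sum-≔ Q e p =
    trans (sym (xor-cancelˡ (⨁ (weight ∘ Q)) _))
      (cong (⨁ (weight ∘ Q) xor_)
        (trans (sym (⨁-xor (weight ∘ Q) (weight ∘ Q′)))
          (trans (⨁-single _ e off) (cong (λ r → weight (Q e) xor weight r) (≔-same Q e)))))
    where
    Q′ = Q [ e ≔ p ]
    off : ∀ i → i ≢ e → weight (Q i) xor weight (Q′ i) ≡ false
    off i ne rewrite ==-≢ ne = xor-same (weight (Q i))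

  F-incident : {Q : Graph n m} → Partial Q → ∀ e (x : Fin n) → row (Q e) x ≡ true → F e ≡ true × Valid (tri e) (Q e)
  F-incident pQ e x eq = case pQ e of λ
    { (inj₁ p) → p
    ; (inj₂ (_ , q)) → ⊥-elim (true≢false (trans (sym eq) (trans (cong (λ p → row p x) q) (row-loop o x)))) }

  module _ {Q : Graph n m} (pQ : Partial Q) where

    even-below : ∀ {x} → ¬ Rooted Q x → ∀ u → Reach Q x u → deg Q u ≡ false
    even-below bad u r = ≢true⇒≡false λ odd → bad (u , r , odd)

    ends-bad : ∀ {e x y} → Joins (Q e) x y → ¬ Rooted Q x → ¬ Rooted Q (proj₁ (Q e))
    ends-bad (inj₁ eq) bad g = bad (subst (Rooted Q) (cong proj₁ eq) g)
    ends-bad {e} {x} {y} (inj₂ eq) bad (w , r , odd) =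
      bad (w , step e (inj₂ eq) (subst (λ u → Reach Q u w) (cong proj₁ eq) r) , odd)

    -- The exchange makes `y` odd. The component was even, so `bypass` still joins `x` to `y`
    -- without `e`, and the whole old component is rooted at `y`. The vertex `z` may lose its odd
    -- degree, but it is now joined to `x`, so whatever was rooted at `z` is rooted at `y` instead.
    move₁ : ∀ e {x y z} → F e ≡ true → Joins (Q e) x y → Comprises (tri e) x y z → Y y ≡ Y z →
            ¬ Rooted Q x → ∃ (Improves Q)
    move₁ e {x} {y} {z} Fe j c yz bad = Q′ , record
      { partial = partial-≔ e pQ Fe (∈₁ , ∈₃ , 1≢3)
      ; same = trans (sum-≔ Q e (x , z))
          (trans (cong (λ b → ⨁ (weight ∘ Q) xor (b xor weight (x , z))) (weight-Joins j))
          (trans (cong (λ b → ⨁ (weight ∘ Q) xor ((Y x xor Y y) xor (Y x xor b))) (sym yz))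
          (trans (cong (⨁ (weight ∘ Q) xor_) (xor-same (Y x xor Y y))) (xor-identityʳ _))))
      ; changed = λ i → case i ≟ e of λ { (yes refl) → inj₂ x-after ; (no ne) → inj₁ (≔-other Q ne) }
      ; mono = λ u (w , r , odd) → Reach-transfer (Rooted Q′) pass r (base w odd)
      ; e* = e ; e*-F = Fe ; before = ends-bad j bad ; after = x-after }
      where
      open Comprises c
      Q′ = Q [ e ≔ (x , z) ]
      deg′ : ∀ u → deg Q′ u ≡ deg Q u xor (row (x , y) u xor row (x , z) u)
      deg′ u = trans (deg-≔ Q e (x , z) u) (cong (λ b → deg Q u xor (b xor row (x , z) u)) (row-Joins j u))
      odd-y : deg Q′ y ≡ true
      odd-y = trans (deg′ y) (cong₂ _xor_ (even-below bad y (edge-reach e j))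
                (cong₂ _xor_ (row-snd 1≢2) (row-off (1≢2 ∘ sym) 2≢3)))
      good-y : Rooted Q′ y
      good-y = y , stop , odd-y
      good-x : Rooted Q′ x
      good-x = y , drop⇒ e (≔-other Q) (bypass Q e 1≢2 j (even-below bad)) , odd-y
      x-after : Rooted Q′ (proj₁ (Q′ e))
      x-after = subst (Rooted Q′ ∘ proj₁) (sym (≔-same Q e)) good-x
      good-z : Rooted Q′ z
      good-z = case good-x of λ (w , r , odd) → w , step e (inj₂ (≔-same Q e)) r , odd
      base : ∀ w → deg Q w ≡ true → Rooted Q′ w
      base w odd with w ≟ x | w ≟ y | w ≟ z
      ... | yes refl | _ | _ = good-x
      ... | no _ | yes refl | _ = good-y
      ... | no _ | no _ | yes refl = good-z
      ... | no wx | no wy | no wz = w , stop , trans (deg′ w)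
              (trans (cong₂ _xor_ odd (cong₂ _xor_ (row-off wx wy) (row-off wx wz))) refl)
      pass : ∀ i a b → Joins (Q i) a b → Rooted Q′ b → Rooted Q′ a
      pass i a b jab (w , r , odd) with i ≟ e
      ... | no ne = w , step i (subst (λ p → Joins p a b) (sym (≔-other Q ne)) jab) r , odd
      ... | yes refl = case Joins-end j jab of λ { (inj₁ refl) → good-x ; (inj₂ refl) → good-y }

    -- Either exchange alone would change the total weight; the two changes cancel.
    move₂ : ∀ e e₂ {x y w z z₂} → F e ≡ true → F e₂ ≡ true → e₂ ≢ e → Joins (Q e) x y → Joins (Q e₂) y w →
            Comprises (tri e) x y z → Comprises (tri e₂) y w z₂ →
            Y x ≡ Y y → Y w ≡ Y y → Y z ≢ Y y → Y z₂ ≢ Y y → ¬ Rooted Q x → ∃ (Improves Q)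
    move₂ e e₂ {x} {y} {w} {z} {z₂} Fe Fe₂ e₂≢e j j₂ c c₂ xy wy zy z₂y bad = Q′ , record
      { partial = partial-≔ e₂ (partial-≔ e pQ Fe (∈₂ , ∈₃ , 2≢3)) Fe₂ (C₂.∈₂ , C₂.∈₃ , C₂.2≢3)
      ; same = sums
      ; changed = λ i → case i ≟ e₂ of λ
          { (yes refl) → inj₂ (subst (Rooted Q′ ∘ proj₁) (sym at-e₂) good-w)
          ; (no ne₂) → case i ≟ e of λ
            { (yes refl) → inj₂ (subst (Rooted Q′ ∘ proj₁) (sym at-e) good-y)
            ; (no ne) → inj₁ (off-both ne ne₂) } }
      ; mono = λ u (v , r , odd) → Reach-transfer (Rooted Q′) pass r (base v odd)
      ; e* = e ; e*-F = Fe ; before = ends-bad j bad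
      ; after = subst (Rooted Q′ ∘ proj₁) (sym at-e) good-y }
      where
      open Comprises c
      module C₂ = Comprises c₂
      Q₁ = Q [ e ≔ (y , z) ]
      Q′ = Q₁ [ e₂ ≔ (w , z₂) ]
      at-e₂ : Q′ e₂ ≡ (w , z₂)
      at-e₂ = ≔-same Q₁ e₂
      at-e : Q′ e ≡ (y , z)
      at-e = trans (≔-other Q₁ (e₂≢e ∘ sym)) (≔-same Q e)
      off-both : ∀ {i} → i ≢ e → i ≢ e₂ → Q′ i ≡ Q i
      off-both ne ne₂ = trans (≔-other Q₁ ne₂) (≔-other Q ne)
      x≢z₂ : x ≢ z₂
      x≢z₂ refl = z₂y xy
      deg′ : ∀ u → deg Q′ u ≡ (deg Q u xor (row (x , y) u xor row (y , z) u)) xor (row (y , w) u xor row (w , z₂) u)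
      deg′ u = trans (deg-≔ Q₁ e₂ (w , z₂) u)
        (cong₂ _xor_ (trans (deg-≔ Q e (y , z) u) (cong (λ b → deg Q u xor (b xor row (y , z) u)) (row-Joins j u)))
                     (cong (_xor row (w , z₂) u) (trans (cong (λ p → row p u) (≔-other Q e₂≢e)) (row-Joins j₂ u))))
      sums : ⨁ (weight ∘ Q′) ≡ ⨁ (weight ∘ Q)
      sums = trans (sum-≔ Q₁ e₂ (w , z₂))
        (trans (cong₂ _xor_ (trans (sum-≔ Q e (y , z)) (cong (λ b → ⨁ (weight ∘ Q) xor (b xor weight (y , z))) (weight-Joins j)))
                            (cong (_xor weight (w , z₂)) (trans (cong weight (≔-other Q e₂≢e)) (weight-Joins j₂))))
          (calc (⨁ (weight ∘ Q)) (Y x) (Y y) (Y z) (Y w) (Y z₂) xy wy zy z₂y))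
        where
        calc : ∀ S a b p d q → a ≡ b → d ≡ b → p ≢ b → q ≢ b →
               (S xor ((a xor b) xor (b xor p))) xor ((b xor d) xor (d xor q)) ≡ S
        calc S _ true true _ q refl refl h h′ = ⊥-elim (h refl)
        calc S _ true false _ true refl refl h h′ = ⊥-elim (h′ refl)
        calc true _ true false _ false refl refl h h′ = refl
        calc false _ true false _ false refl refl h h′ = refl
        calc S _ false false _ q refl refl h h′ = ⊥-elim (h refl)
        calc S _ false true _ false refl refl h h′ = ⊥-elim (h′ refl)
        calc true _ false true _ true refl refl h h′ = refl
        calc false _ false true _ true refl refl h h′ = refl
      even-x : deg Q x ≡ false
      even-x = even-below bad x stop
      even-y : deg Q y ≡ false
      even-y = even-below bad y (edge-reach e j)
      odd-y : deg Q′ y ≡ true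
      odd-y = trans (deg′ y) (cong₂ _xor_ (cong₂ _xor_ even-y (cong₂ _xor_ (row-snd 1≢2) (row-fst 2≢3)))
                (cong₂ _xor_ (row-fst C₂.1≢2) (row-off C₂.1≢2 C₂.1≢3)))
      odd-x : deg Q′ x ≡ true
      odd-x = trans (deg′ x) (trans (cong₂ _xor_ (cong₂ _xor_ even-x (cong₂ _xor_ (row-fst 1≢2) (row-off 1≢2 1≢3)))
                (cong₂ _xor_ (cong (_xor (x == w)) (==-≢ 1≢2)) (cong (x == w xor_) (==-≢ x≢z₂)))) (fin (x == w)))
        where
        fin : ∀ b → true xor (b xor (b xor false)) ≡ true
        fin true = refl
        fin false = refl
      good-y : Rooted Q′ y
      good-y = y , stop , odd-y
      good-x : Rooted Q′ x
      good-x = x , stop , odd-x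
      good-z : Rooted Q′ z
      good-z = y , edge-reach e (inj₂ at-e) , odd-y
      reach-w : ∀ {u} → Reach Q w u → Reach Q x u
      reach-w r = step e j (step e₂ j₂ r)
      -- If `w` differs from `x`, deleting `e` and `e₂` from the even component leaves `x` and `w`
      -- as its only odd vertices, so they remain joined; and `x` is odd in `Q′`.
      good-w : Rooted Q′ w
      good-w with w ≟ x
      ... | yes refl = good-x
      ... | no w≢x = x , walk (odd-partner G w oddw) , odd-x
        where
        G₁ = Q [ e ≔ (y , y) ]
        G = G₁ [ e₂ ≔ (y , y) ]
        degG : ∀ u → deg G u ≡ (deg Q u xor (row (x , y) u xor false)) xor (row (y , w) u xor false)
        degG u = trans (deg-≔ G₁ e₂ (y , y) u)
          (cong₂ _xor_ (trans (deg-≔ Q e (y , y) u) (cong₂ (λ a b → deg Q u xor (a xor b)) (row-Joins j u) (row-loop y u)))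
                       (cong₂ _xor_ (trans (cong (λ p → row p u) (≔-other Q e₂≢e)) (row-Joins j₂ u)) (row-loop y u)))
        down : ∀ {a b} → Reach G a b → Reach Q a b
        down r = drop-step e (drop-step e₂ r)
        up : ∀ {a b} → Reach G a b → Reach Q′ a b
        up = Reach-map λ i → case i ≟ e₂ of λ
          { (yes refl) → inj₁ (y , ≔-same G₁ e₂)
          ; (no ne₂) → case i ≟ e of λ
            { (yes refl) → inj₁ (y , trans (≔-other G₁ ne₂) (≔-same Q e))
            ; (no ne) → inj₂ (trans (≔-other G₁ ne₂) (trans (≔-other Q ne) (sym (off-both ne ne₂)))) } }
        oddw : deg G w ≡ true
        oddw = trans (degG w) (cong₂ _xor_ (cong₂ _xor_ (even-below bad w (reach-w stop))
                 (cong (_xor false) (row-off w≢x (C₂.1≢2 ∘ sym)))) (cong (_xor false) (row-snd C₂.1≢2)))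
        walk : (∃ λ u → u ≢ w × Reach G w u × deg G u ≡ true) → Reach Q′ w x
        walk (u , u≢w , r , odd) with u ≟ x | u ≟ y
        ... | yes refl | _ = up r
        ... | no _ | yes refl = ⊥-elim (true≢false (trans (sym odd) (trans (degG y)
              (cong₂ _xor_ (cong₂ _xor_ even-y (cong (_xor false) (row-snd 1≢2))) (cong (_xor false) (row-fst C₂.1≢2))))))
        ... | no ux | no uy = ⊥-elim (true≢false (trans (sym odd) (trans (degG u)
              (cong₂ _xor_ (cong₂ _xor_ (even-below bad u (reach-w (down r))) (cong (_xor false) (row-off ux uy)))
                           (cong (_xor false) (row-off uy u≢w))))))
      good-z₂ : Rooted Q′ z₂
      good-z₂ = case good-w of λ (v , r , odd) → v , step e₂ (inj₂ at-e₂) r , odd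
      base : ∀ v → deg Q v ≡ true → Rooted Q′ v
      base v odd with v ≟ x | v ≟ y | v ≟ z | v ≟ w | v ≟ z₂
      ... | yes refl | _ | _ | _ | _ = good-x
      ... | no _ | yes refl | _ | _ | _ = good-y
      ... | no _ | no _ | yes refl | _ | _ = good-z
      ... | no _ | no _ | no _ | yes refl | _ = good-w
      ... | no _ | no _ | no _ | no _ | yes refl = good-z₂
      ... | no vx | no vy | no vz | no vw | no vz₂ = v , stop , trans (deg′ v)
              (cong₂ _xor_ (cong₂ _xor_ odd (cong₂ _xor_ (row-off vx vy) (row-off vy vz)))
                           (cong₂ _xor_ (row-off vy vw) (row-off vw vz₂)))
      pass : ∀ i a b → Joins (Q i) a b → Rooted Q′ b → Rooted Q′ a
      pass i a b jab (v , r , odd) with i ≟ e | i ≟ e₂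
      ... | yes refl | _ = case Joins-end j jab of λ { (inj₁ refl) → good-x ; (inj₂ refl) → good-y }
      ... | no _ | yes refl = case Joins-end j₂ jab of λ { (inj₁ refl) → good-y ; (inj₂ refl) → good-w }
      ... | no ne | no ne₂ = v , step i (subst (λ p → Joins p a b) (sym (off-both ne ne₂)) jab) r , odd

    -- The weight must not change. If the unchosen vertex `z` has the `Y`-value of an end of the
    -- pair, `move₁` drops that end. Otherwise both ends have the value opposite to that of `z`. As
    -- `y` has even degree, a second pair lies at `y`; either `move₁` applies to it, or `move₂`
    -- exchanges both pairs together.
    improve : ∀ e → F e ≡ true → ¬ Rooted Q (proj₁ (Q e)) → ∃ (Improves Q)
    improve e Fe bad = case pQ e of λ
      { (inj₂ (Fe′ , _)) → ⊥-elim (true≢false (trans (sym Fe) Fe′))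
      ; (inj₁ (_ , v)) → go (Q e) refl v bad }
      where
      go : ∀ p → Q e ≡ p → Valid (tri e) p → ¬ Rooted Q (proj₁ p) → ∃ (Improves Q)
      go (x , y) eq (x∈ , y∈ , x≢y) bad = sides (third (tri e) x∈ y∈ x≢y)
        where
        j : Joins (Q e) x y
        j = inj₁ eq
        bad-y : ¬ Rooted Q y
        bad-y (w , r , odd) = bad (w , step e j r , odd)
        odd′ : deg (Q [ e ≔ (x , x) ]) y ≡ true
        odd′ = trans (deg-≔ Q e (x , x) y)
          (cong₂ _xor_ (even-below bad y (edge-reach e j)) (cong₂ _xor_ (trans (row-Joins j y) (row-snd x≢y)) (row-loop x y)))
        sides : ∃ (Comprises (tri e) x y) → ∃ (Improves Q)
        sides (z , c) with Y y ≟ᵇ Y z | Y x ≟ᵇ Y z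
        ... | yes yz | _ = move₁ e Fe j c yz bad
        ... | no _ | yes xz = move₁ e Fe (Joins-sym j) (Comprises-213 c) xz bad-y
        ... | no yz | no xz = second (⨁-true _ odd′)
          where
          two : ∀ {a b c : Bool} → a ≢ c → b ≢ c → a ≡ b
          two {true} {true} _ _ = refl
          two {false} {false} _ _ = refl
          two {true} {false} {true} h _ = ⊥-elim (h refl)
          two {true} {false} {false} _ h = ⊥-elim (h refl)
          two {false} {true} {true} _ h = ⊥-elim (h refl)
          two {false} {true} {false} h _ = ⊥-elim (h refl)
          second : (∃ λ i → row ((Q [ e ≔ (x , x) ]) i) y ≡ true) → ∃ (Improves Q)
          second (e₂ , inc) = case e₂ ≟ e of λ
            { (yes refl) → ⊥-elim (true≢false (trans (sym inc) (trans (cong (λ p → row p y) (≔-same Q e)) (row-loop x y))))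
            ; (no ne) → with-e₂ ne (trans (sym (cong (λ p → row p y) (≔-other Q ne))) inc) }
            where
            with-e₂ : e₂ ≢ e → row (Q e₂) y ≡ true → ∃ (Improves Q)
            with-e₂ ne inc = case F-incident pQ e₂ y inc , incident (Q e₂) y inc of λ
              { ((Fe₂ , val) , (w , j₂)) → case Valid-Joins {T = tri e₂} val j₂ of λ (y∈ , w∈ , y≢w) →
                  fin Fe₂ j₂ (third (tri e₂) y∈ w∈ y≢w) }
              where
              fin : ∀ {w} → F e₂ ≡ true → Joins (Q e₂) y w → ∃ (Comprises (tri e₂) y w) → ∃ (Improves Q)
              fin {w} Fe₂ j₂ (z₂ , c₂) with Y w ≟ᵇ Y z₂ | Y y ≟ᵇ Y z₂
              ... | yes wz | _ = move₁ e₂ Fe₂ j₂ c₂ wz bad-y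
              ... | no _ | yes yz₂ = move₁ e₂ Fe₂ (Joins-sym j₂) (Comprises-213 c₂) yz₂
                      (λ (v , r , odd) → bad-y (v , step e₂ j₂ r , odd))
              ... | no wz₂ | no yz₂ = move₂ e e₂ Fe Fe₂ ne j j₂ c c₂ (two xz yz) (two wz₂ yz₂) (yz ∘ sym) (yz₂ ∘ sym) bad

  odd-rooted : (Q : Graph n m) → Partial Q → ∃ λ Q′ → Partial Q′ × ⨁ (weight ∘ Q′) ≡ ⨁ (weight ∘ Q) ×
               (∀ e → F e ≡ true → Rooted Q′ (proj₁ (Q′ e)))
  odd-rooted Q pQ = go Q pQ (<-wellFounded _)
    where
    bad? : (Q : Graph n m) (e : Fin m) → Dec (F e ≡ true × ¬ Rooted Q (proj₁ (Q e)))
    bad? Q e = (F e ≟ᵇ true) ×-dec ¬? (rooted? Q (proj₁ (Q e)))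
    size : Graph n m → ℕ
    size Q = count (does ∘ bad? Q)
    decr : ∀ {Q Q₁} → Improves Q Q₁ → size Q₁ < size Q
    decr {Q} {Q₁} imp = count-strict keep e* (dec-false (bad? Q₁ e*) λ (_ , ¬r) → ¬r after) (dec-true (bad? Q e*) (e*-F , before))
      where
      open Improves imp
      keep : ∀ i → does (bad? Q₁ i) ≡ true → does (bad? Q i) ≡ true
      keep i d = case does-true (bad? Q₁ i) d of λ (Fi , ¬r) → dec-true (bad? Q i) (Fi , λ r → case changed i of λ
        { (inj₁ eq) → ¬r (subst (Rooted Q₁ ∘ proj₁) (sym eq) (mono _ r)) ; (inj₂ r′) → ¬r r′ })
    go : (Q : Graph n m) → Partial Q → Acc _<_ (size Q) →
         ∃ λ Q′ → Partial Q′ × ⨁ (weight ∘ Q′) ≡ ⨁ (weight ∘ Q) × (∀ e → F e ≡ true → Rooted Q′ (proj₁ (Q′ e)))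
    go Q pQ (acc rec) with any? (bad? Q)
    ... | no none = Q , pQ , refl , λ e Fe → case rooted? Q (proj₁ (Q e)) of λ
          { (yes r) → r ; (no ¬r) → ⊥-elim (none (e , Fe , ¬r)) }
    ... | yes (e , Fe , bad) with Q₁ , imp ← improve pQ e Fe bad
      with Q₂ , p₂ , s₂ , g₂ ← go Q₁ (Improves.partial imp) (rec (decr imp)) =
        Q₂ , p₂ , trans s₂ (Improves.same imp) , g₂

-- Euler circuits of connected even multigraphs

module EulerCircuits where

  open import Data.List using (List; []; _∷_; _++_; length; lookup; foldr)
  open import Data.List.Membership.Propositional using (_∈_; _∉_)
  open import Data.List.Membership.Propositional.Properties using (∈-lookup; ∈-++⁺ˡ; ∈-++⁺ʳ; ∈-++⁻)
  open import Data.List.Relation.Unary.Any using (here; there; index)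
  open import Data.List.Relation.Unary.Any.Properties using (lookup-index)
  open import Data.List.Relation.Unary.All as All using (All)
  open import Data.List.Relation.Unary.All.Properties using (¬Any⇒All¬)
  open import Data.List.Relation.Unary.AllPairs using ([]; _∷_)
  open import Data.List.Relation.Unary.Unique.Propositional using (Unique)
  import Data.List.Relation.Binary.Permutation.Setoid.Properties as Permutation

  -- Induction on the list: clearing the value of `f` at the first entry leaves a function supported
  -- on the remaining entries.
  ⨁-unique : (f : Fin k → Bool) (es : List (Fin k)) → Unique es → (∀ e → e ∉ es → f e ≡ false) →
             ⨁ f ≡ foldr (λ e b → f e xor b) false es
  ⨁-unique f [] u off = ⨁-false (λ e → off e λ ())
  ⨁-unique f (e ∷ es) (e∉ ∷ u) off =
    trans (trans (sym (xor-cancelˡ (⨁ g) (⨁ f))) (trans (xor-comm (⨁ g) (⨁ g xor ⨁ f)) (cong (_xor ⨁ g) only-e)))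
          (cong (f e xor_) (trans (⨁-unique g es u off′) (same es e∉)))
    where
    g : Fin _ → Bool
    g i = if i == e then false else f i
    only-e : ⨁ g xor ⨁ f ≡ f e
    only-e = trans (sym (⨁-xor g f)) (trans (⨁-single _ e z) at)
      where
      z : ∀ j → j ≢ e → g j xor f j ≡ false
      z j ne rewrite ==-≢ ne = xor-same (f j)
      at : g e xor f e ≡ f e
      at rewrite ==-refl e = refl
    off′ : ∀ i → i ∉ es → g i ≡ false
    off′ i i∉ with i ≟ e
    ... | yes _ = refl
    ... | no ne = off i λ { (here eq) → ne eq ; (there h) → i∉ h }
    same : ∀ es → All (e ≢_) es → foldr (λ i b → g i xor b) false es ≡ foldr (λ i b → f i xor b) false es
    same [] _ = refl
    same (i ∷ es) (ne All.∷ nes) rewrite ==-≢ (ne ∘ sym) = cong (f i xor_) (same es nes)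

  record EulerCircuit {n m} (P : Graph n m) : Set where
    field
      len        : ℕ
      vert       : Fin (suc len) → Fin n
      edg        : Fin len → Fin m
      joins      : ∀ i → Joins (P (edg i)) (vert (inject₁ i)) (vert (suc i))
      closed     : vert zero ≡ vert (fromℕ len)
      injective  : Injective _≡_ _≡_ edg
      surjective : ∀ e → ∃ λ i → edg i ≡ e

  module _ {n m : ℕ} (P : Graph n m) where

    open import Data.List.Membership.DecPropositional (_≟_ {m}) using (_∈?_)

    data Trail (x : Fin n) : Fin n → List (Fin m) → Set where
      nil  : Trail x x []
      cons : ∀ {y z es} (e : Fin m) → Joins (P e) x z → Trail z y es → Trail x y (e ∷ es)

    Trail-++ : ∀ {x y z es fs} → Trail x y es → Trail y z fs → Trail x z (es ++ fs)
    Trail-++ nil t = t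
    Trail-++ (cons e j s) t = cons e j (Trail-++ s t)

    -- The rows telescope: modulo 2 every inner vertex of the trail is entered and left.
    Trail-parity : ∀ {x y es} → Trail x y es → ∀ u → foldr (λ e b → row (P e) u xor b) false es ≡ row (x , y) u
    Trail-parity {x} nil u = sym (row-loop x u)
    Trail-parity {x} {y} (cons {z = z} e j t) u =
      trans (cong₂ _xor_ (row-Joins j u) (Trail-parity t u)) (calc (u == x) (u == z) (u == y))
      where
      calc : ∀ a b c → (a xor b) xor (b xor c) ≡ a xor c
      calc true true c = refl
      calc true false c = refl
      calc false true true = refl
      calc false true false = refl
      calc false false c = refl

    -- Splitting a closed trail at a vertex u and swapping the two parts makes it start at u.
    record Visits (x : Fin n) (es : List (Fin m)) (u : Fin n) : Set where
      field
        {fst snd} : List (Fin m)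
        split     : es ≡ fst ++ snd
        to        : Trail x u fst
        from      : Trail u x snd

    visits-ends : ∀ {x y es e a b} → Trail x y es → e ∈ es → Joins (P e) a b →
                  ∃₂ λ fs gs → es ≡ fs ++ gs × Trail x a fs × Trail a y gs
    visits-ends (cons e j t) (here refl) j′ = case Joins-end j j′ of λ
      { (inj₁ refl) → [] , _ , refl , nil , cons e j t
      ; (inj₂ refl) → e ∷ [] , _ , refl , cons e j nil , t }
    visits-ends (cons e j t) (there e∈) j′ with fs , gs , refl , s₁ , s₂ ← visits-ends t e∈ j′ =
      e ∷ fs , gs , refl , cons e j s₁ , s₂

    rotate : ∀ {x u es} → Unique es → Visits x es u →
             ∃ λ fs → Trail u u fs × Unique fs × (∀ {e} → e ∈ es → e ∈ fs)
    rotate {es = es} uq v = snd ++ fst , Trail-++ from to ,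
      Perm.Unique-resp-↭ (Perm.++-comm fst snd) (subst Unique split uq) ,
      λ e∈ → [ ∈-++⁺ʳ snd , ∈-++⁺ˡ ]′ (∈-++⁻ fst (subst (_ ∈_) split e∈))
      where
      open Visits v
      module Perm = Permutation (setoid (Fin m))

    unused : List (Fin m) → Fin m → Bool
    unused es e = not (does (e ∈? es))

    unused-∉ : ∀ es e → unused es e ≡ true → e ∉ es
    unused-∉ es e eq with no e∉ ← e ∈? es = e∉

    module _ (even : ∀ x → deg P x ≡ false) (proper : ∀ e → proj₁ (P e) ≢ proj₂ (P e))
             (connected : ∀ e e′ → Reach P (proj₁ (P e)) (proj₁ (P e′))) where

      -- An open trail uses an odd number of the edges at its start; a stuck one uses all of them,
      -- and their number is even.
      closed-if-stuck : ∀ {x y es} → Trail x y es → Unique es → (∀ e → e ∉ es → row (P e) x ≡ false) → x ≡ y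
      closed-if-stuck {x} {y} {es} t uq stuck = case x ≟ y of λ
        { (yes eq) → eq
        ; (no ne) → ⊥-elim (true≢false (trans (sym (trans (Trail-parity t x) (row-fst ne)))
                      (trans (sym (⨁-unique (λ e → row (P e) x) es uq stuck)) (even x)))) }

      -- Followed backwards from `x`, the walk stays on visited vertices until it meets an edge
      -- outside the trail; that edge then starts at a visited vertex.
      touch : ∀ {x es u} → Trail x x es → Reach P u x →
              Visits x es u ⊎ (∃₂ λ e v → e ∉ es × (∃ (Joins (P e) v)) × Visits x es v)
      touch t stop = inj₁ (record { split = refl ; to = nil ; from = t })
      touch {es = es} t (step e j r) = case touch t r of λ
        { (inj₂ found) → inj₂ found
        ; (inj₁ v) → case e ∈? es of λ
          { (yes e∈) → case visits-ends t e∈ j of λ (_ , _ , eq , a , b) → inj₁ (record { split = eq ; to = a ; from = b })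
          ; (no e∉) → inj₂ (e , _ , e∉ , (_ , Joins-sym j) , v) } }

      first : ∀ {x y es} → Trail x y es → es ≢ [] → ∃ λ e → Reach P (proj₁ (P e)) x
      first nil ne = ⊥-elim (ne refl)
      first (cons e j t) _ = e , at j
        where
        at : ∀ {x z} → Joins (P e) x z → Reach P (proj₁ (P e)) x
        at (inj₁ eq) = subst (λ a → Reach P a _) (sym (cong proj₁ eq)) stop
        at (inj₂ eq) = subst (λ a → Reach P a _) (sym (cong proj₁ eq)) (edge-reach e (inj₁ eq))

      extend : ∀ {x y es b} → Trail x y es → Unique es → es ≢ [] → count (unused es) ≤ b → Acc _<_ b →
               ∃₂ λ z fs → Trail z z fs × Unique fs × (∀ e → e ∈ fs)
      grow : ∀ {x y z e es} → Trail x y es → Unique es → e ∉ es → Joins (P e) z x →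
             ∀ {b} → count (unused es) ≤ b → Acc _<_ b → ∃₂ λ z fs → Trail z z fs × Unique fs × (∀ e → e ∈ fs)
      extend {x} {y} {es} t uq ne le ac with any? (λ e → ¬? (e ∈? es) ×-dec (row (P e) x ≟ᵇ true))
      ... | yes (e , e∉ , inc) = grow t uq e∉ (Joins-sym (proj₂ (incident (P e) x inc))) le ac
      ... | no stuck with refl ← closed-if-stuck t uq (λ e e∉ → ≢true⇒≡false λ inc → stuck (e , e∉ , inc))
        with any? (λ e → ¬? (e ∈? es))
      ...   | no full = x , es , t , uq , λ e → case e ∈? es of λ { (yes p) → p ; (no ¬p) → ⊥-elim (full (e , ¬p)) }
      ...   | yes (e , e∉) = resume (touch t (Reach-trans (connected e (proj₁ f)) (proj₂ f)))
        where
        f = first t ne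
        go : ∀ {e v} → e ∉ es → ∃ (Joins (P e) v) → Visits x es v → _
        go e∉ (_ , j) v with fs , t′ , uq′ , sub ← rotate uq v in eq =
          case _ ∈? fs of λ
            { (yes e∈) → ⊥-elim (e∉ (back v (subst (λ r → _ ∈ proj₁ r) (sym eq) e∈)))
            ; (no e∉′) → grow t′ uq′ e∉′ (Joins-sym j) (ℕₚ.≤-trans (same sub) le) ac }
          where
          back : ∀ {v e} (w : Visits x es v) → e ∈ proj₁ (rotate uq w) → e ∈ es
          back w e∈ = subst (_ ∈_) (sym (Visits.split w)) ([ ∈-++⁺ʳ (Visits.fst w) , ∈-++⁺ˡ ]′ (∈-++⁻ (Visits.snd w) e∈))
          same : ∀ {fs} → (∀ {e} → e ∈ es → e ∈ fs) → count (unused fs) ≤ count (unused es)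
          same sub = count-mono λ i d → cong not (dec-false (i ∈? _) λ i∈ → unused-∉ _ i d (sub i∈))
        resume : Visits x es (proj₁ (P e)) ⊎ (∃₂ λ e v → e ∉ es × (∃ (Joins (P e) v)) × Visits x es v) → _
        resume (inj₁ v) = go e∉ (proj₂ (P e) , inj₁ refl) v
        resume (inj₂ (e′ , v , e∉′ , j , vis)) = go e∉′ j vis
      grow {e = e} {es} t uq e∉ j le (acc rec) =
        extend (cons e j t) (¬Any⇒All¬ es e∉ ∷ uq) (λ ()) ℕₚ.≤-refl
          (rec (ℕₚ.<-≤-trans (count-strict keep e (cong not (dec-true (e ∈? (e ∷ es)) (here refl))) (cong not (dec-false (e ∈? es) e∉))) le))
        where
        keep : ∀ i → unused (e ∷ es) i ≡ true → unused es i ≡ true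
        keep i d = cong not (dec-false (i ∈? es) λ i∈ → unused-∉ (e ∷ es) i d (there i∈))

      vertices : ∀ {x y es} → Trail x y es → Fin (suc (length es)) → Fin n
      vertices {x} nil _ = x
      vertices {x} (cons e j t) zero = x
      vertices (cons e j t) (suc i) = vertices t i

      vertices-zero : ∀ {x y es} (t : Trail x y es) → vertices t zero ≡ x
      vertices-zero nil = refl
      vertices-zero (cons e j t) = refl

      vertices-last : ∀ {x y es} (t : Trail x y es) → vertices t (fromℕ (length es)) ≡ y
      vertices-last nil = refl
      vertices-last (cons e j t) = vertices-last t

      vertices-joins : ∀ {x y es} (t : Trail x y es) (i : Fin (length es)) →
                       Joins (P (lookup es i)) (vertices t (inject₁ i)) (vertices t (suc i))
      vertices-joins (cons e j t) zero = subst (Joins (P e) _) (sym (vertices-zero t)) j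
      vertices-joins (cons e j t) (suc i) = vertices-joins t i

      lookup-injective : ∀ {es : List (Fin m)} → Unique es → Injective _≡_ _≡_ (lookup es)
      lookup-injective (_ ∷ _) {zero} {zero} eq = refl
      lookup-injective {e ∷ es} (e∉ ∷ _) {zero} {suc j} eq = ⊥-elim (All.lookup e∉ (∈-lookup j) eq)
      lookup-injective {e ∷ es} (e∉ ∷ _) {suc i} {zero} eq = ⊥-elim (All.lookup e∉ (∈-lookup i) (sym eq))
      lookup-injective (_ ∷ u) {suc i} {suc j} eq = cong suc (lookup-injective u eq)

      eulerCircuit : Fin m → EulerCircuit P
      eulerCircuit e₀ with z , fs , t , uq , all ←
        extend (cons e₀ (inj₁ refl) nil) (All.[] ∷ []) (λ ()) ℕₚ.≤-refl (<-wellFounded _) = record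
        { len = length fs ; vert = vertices t ; edg = lookup fs ; joins = vertices-joins t
        ; closed = trans (vertices-zero t) (sym (vertices-last t))
        ; injective = lookup-injective uq
        ; surjective = λ e → index (all e) , sym (lookup-index (all e)) }

≢false⇒≡true : {b : Bool} → b ≢ false → b ≡ true
≢false⇒≡true {true} _ = refl
≢false⇒≡true {false} h = ⊥-elim (h refl)

pair-of : {T : Triple n} {x y z : Fin n} {p : Fin n × Fin n} → Comprises T x y z → Valid T p →
          Joins p x y ⊎ Joins p x z ⊎ Joins p y z
pair-of c (s∈ , t∈ , s≢t) = case Comprises.only c s∈ , Comprises.only c t∈ of λ
  { (inj₁ refl , inj₁ refl) → ⊥-elim (s≢t refl)
  ; (inj₁ refl , inj₂ (inj₁ refl)) → inj₁ (inj₁ refl)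
  ; (inj₁ refl , inj₂ (inj₂ refl)) → inj₂ (inj₁ (inj₁ refl))
  ; (inj₂ (inj₁ refl) , inj₁ refl) → inj₁ (inj₂ refl)
  ; (inj₂ (inj₁ refl) , inj₂ (inj₁ refl)) → ⊥-elim (s≢t refl)
  ; (inj₂ (inj₁ refl) , inj₂ (inj₂ refl)) → inj₂ (inj₂ (inj₁ refl))
  ; (inj₂ (inj₂ refl) , inj₁ refl) → inj₂ (inj₁ (inj₂ refl))
  ; (inj₂ (inj₂ refl) , inj₂ (inj₁ refl)) → inj₂ (inj₂ (inj₂ refl))
  ; (inj₂ (inj₂ refl) , inj₂ (inj₂ refl)) → ⊥-elim (s≢t refl) }

Occurs : (Fin m → Triple n) → Fin n → Set
Occurs tri x = ∃ λ e → x ∈ₜ tri e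

-- Restricted to occurring vertices because the vertices fixed in the reduction remain elements of
-- `Fin n` without lying in any triple.
PairCovering : (Fin m → Triple n) → Set
PairCovering tri = ∀ {x y} → Occurs tri x → Occurs tri y → x ≢ y → ∃ λ e → x ∈ₜ tri e × y ∈ₜ tri e

AllValid : (Fin m → Triple n) → Graph n m → Set
AllValid tri P = ∀ e → Valid (tri e) (P e)

valid-≔ : (tri : Fin m → Triple n) {P : Graph n m} (e : Fin m) {p : Fin n × Fin n} →
          AllValid tri P → Valid (tri e) p → AllValid tri (P [ e ≔ p ])
valid-≔ tri {P} e val v i = case i ≟ e of λ
  { (yes refl) → subst (Valid (tri e)) (sym (≔-same P e)) v
  ; (no ne) → subst (Valid (tri i)) (sym (≔-other P ne)) (val i) }

-- Attaching components to two hubs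

module Hubs (tri : Fin m → Triple n) (v q : Fin n) where

  Hub : Fin n → Set
  Hub h = h ≡ v ⊎ h ≡ q

  hub? : ∀ h → Dec (Hub h)
  hub? h = (h ≟ v) ⊎-dec (h ≟ q)

  far? : ∀ e → Dec (¬ (v ∈ₜ tri e) × ¬ (q ∈ₜ tri e))
  far? e = ¬? (v ∈ₜ? tri e) ×-dec ¬? (q ∈ₜ? tri e)

  far : Fin m → Bool
  far e = does (far? e)

  near⇒hub : ∀ e → far e ≡ false → ∃ λ h → Hub h × h ∈ₜ tri e
  near⇒hub e eq = case v ∈ₜ? tri e of λ
    { (yes v∈) → v , inj₁ refl , v∈
    ; (no v∉) → case q ∈ₜ? tri e of λ
      { (yes q∈) → q , inj₂ refl , q∈
      ; (no q∉) → ⊥-elim (does-false (far? e) eq (v∉ , q∉)) } }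

  hub⇒near : ∀ e {h} → Hub h → h ∈ₜ tri e → far e ≡ false
  hub⇒near e (inj₁ refl) h∈ = dec-false (far? e) λ (a , _) → a h∈
  hub⇒near e (inj₂ refl) h∈ = dec-false (far? e) λ (_ , b) → b h∈

  Attached : Graph n m → Fin n → Set
  Attached P u = ∃ λ h → Hub h × Reach P u h

  attached? : ∀ P u → Dec (Attached P u)
  attached? P u = any? λ h → hub? h ×-dec reach? P u h

  module _ (v≢q : v ≢ q) where

    other-hub : ∀ {h} → Hub h → ∃ λ h′ → Hub h′ × h′ ≢ h × (∀ {u} → Hub u → u ≡ h ⊎ u ≡ h′)
    other-hub (inj₁ refl) = q , inj₂ refl , v≢q ∘ sym , id
    other-hub (inj₂ refl) = v , inj₁ refl , v≢q , λ { (inj₁ e) → inj₂ e ; (inj₂ e) → inj₁ e }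

    -- The `fixed` triples carry pairs that the later linking relies on. Each such pair contains a
    -- hub, hence is attached and never opened; and restoring the parity of a `Free` vertex uses a
    -- triple through that vertex, which is not fixed.
    module Attach (cover : PairCovering tri) (occurs : ∀ {h} → Hub h → Occurs tri h)
                  (Q : Graph n m) (Q-near : ∀ e → far e ≡ false → Q e ≡ (v , v))
                  (Q-rooted : ∀ e → far e ≡ true → ∃ λ u → Reach Q (proj₁ (Q e)) u × deg Q u ≡ true)
                  (P₀ : Graph n m) (fixed : Fin m → Bool)
                  (fixed-hub : ∀ e → fixed e ≡ true → Hub (proj₁ (P₀ e)) ⊎ Hub (proj₂ (P₀ e)))
                  (Free : Fin n → Set)
                  (free-fixed : ∀ {y g} → Free y → y ∈ₜ tri g → fixed g ≡ false) where

      record State (P : Graph n m) : Set where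
        field
          valid : AllValid tri P
          agree : ∀ e → far e ≡ true → P e ≡ Q e
          keeps : ∀ e → fixed e ≡ true → P e ≡ P₀ e
          even  : ∀ u → ¬ Hub u → deg P u ≡ false

      Q⇒P : ∀ {P} → State P → ∀ {x y} → Reach Q x y → Reach P x y
      Q⇒P st = Reach-map λ e → case far e ≟ᵇ true of λ
        { (yes f) → inj₂ (sym (State.agree st e f))
        ; (no ¬f) → inj₁ (v , Q-near e (≢true⇒≡false ¬f)) }

      Bad : Graph n m → Fin m → Set
      Bad P e = ¬ Attached P (proj₁ (P e))

      record Handle (P : Graph n m) : Set where
        field
          f        : Fin m
          {x y}    : Fin n
          near     : far f ≡ false
          joins    : Joins (P f) x y
          detached : ¬ Attached P x

      -- The component has a vertex that is odd in the far triples but even in P, hence on a pair from a near triple.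
      handle : ∀ {P} → State P → ∀ e → Bad P e → Handle P
      handle {P} st e bad with far e ≟ᵇ true
      ... | no ¬f = record { f = e ; near = ≢true⇒≡false ¬f ; joins = inj₁ refl ; detached = bad }
      ... | yes fe = found (Q-rooted e fe)
        where
        open State st
        found : (∃ λ u → Reach Q (proj₁ (Q e)) u × deg Q u ≡ true) → Handle P
        found (u , r , odd) = edge-at (⨁-true _ differ)
          where
          r′ : Reach P (proj₁ (P e)) u
          r′ = subst (λ p → Reach P (proj₁ p) u) (sym (agree e fe)) (Q⇒P st r)
          detached-u : ¬ Attached P u
          detached-u (h , hub , s) = bad (h , hub , Reach-trans r′ s)
          differ : ⨁ (λ i → row (P i) u xor row (Q i) u) ≡ true
          differ = trans (⨁-xor (λ i → row (P i) u) (λ i → row (Q i) u))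
                     (cong₂ _xor_ (even u λ hub → detached-u (u , hub , stop)) odd)
          edge-at : (∃ λ i → row (P i) u xor row (Q i) u ≡ true) → Handle P
          edge-at (i , eq) with far i ≟ᵇ true
          ... | yes fi = ⊥-elim (true≢false (trans (sym eq) (trans (cong (λ p → row p u xor row (Q i) u) (agree i fi)) (xor-same (row (Q i) u)))))
          ... | no ¬fi = record { f = i ; near = ni ; joins = proj₂ (incident (P i) u inc) ; detached = detached-u }
            where
            ni : far i ≡ false
            ni = ≢true⇒≡false ¬fi
            inc : row (P i) u ≡ true
            inc = trans (sym (xor-identityʳ _)) (trans (cong (row (P i) u xor_) (sym (trans (cong (λ p → row p u) (Q-near i ni)) (row-loop v u)))) eq)

      record Progress (P : Graph n m) : Set where
        field
          {P′}    : Graph n m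
          state   : State P′
          mono    : ∀ e → Attached P (proj₁ (P e)) → Attached P′ (proj₁ (P′ e))
          f       : Fin m
          before  : Bad P f
          after   : Attached P′ (proj₁ (P′ f))

      detached-end : ∀ {P e x y} → Joins (P e) x y → ¬ Attached P x → ¬ Attached P (proj₁ (P e))
      detached-end (inj₁ eq) d a = d (subst (Attached _) (cong proj₁ eq) a)
      detached-end {e = e} (inj₂ eq) d (h , hub , r) =
        d (h , hub , step e (inj₂ eq) (subst (λ u → Reach _ u h) (cong proj₁ eq) r))

      attached-end : ∀ {P e x y} → P e ≡ (x , y) → Attached P x → Attached P (proj₁ (P e))
      attached-end eq a = subst (Attached _) (sym (cong proj₁ eq)) a

      -- Both ends of the pair are detached, so the third vertex of `f` is its hub `h`, and the pair
      -- xh attaches `x`. This spoils only `y` among the non-hubs. A triple `g` through `y` and the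
      -- other hub `h′` differs from `f`, and exchanging its pair restores `y`. Its pair is not yh′,
      -- since `y` is detached; two cases remain.
      progress : ∀ {P} → State P → ∀ {f x y} → far f ≡ false → Joins (P f) x y → ¬ Attached P x → Free y → Progress P
      progress {P} st {f} {x} {y} nf j dx free-y = main
        where
        open State st
        dy : ¬ Attached P y
        dy (h , hub , r) = dx (h , hub , step f j r)
        ¬hub-x : ¬ Hub x
        ¬hub-x hub = dx (x , hub , stop)
        ¬hub-y : ¬ Hub y
        ¬hub-y hub = dy (y , hub , stop)
        val-f : Valid (tri f) (x , y)
        val-f = Valid-Joins {T = tri f} (valid f) j
        fixed-f : fixed f ≡ false
        fixed-f = ≢true⇒≡false λ fx → case fixed-hub f fx of λ
          { (inj₁ hub) → bad-f (_ , subst Hub (cong proj₁ (sym (keeps f fx))) hub , stop)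
          ; (inj₂ hub) → bad-f (_ , subst Hub (cong proj₂ (sym (keeps f fx))) hub , edge-reach f (inj₁ refl)) }
          where
          bad-f : ¬ Attached P (proj₁ (P f))
          bad-f = detached-end j dx
        main : Progress P
        main with z , c ← third (tri f) (proj₁ val-f) (proj₁ (proj₂ val-f)) (proj₂ (proj₂ val-f))
             with h , hub , h∈ ← near⇒hub f nf
             with Comprises.only c h∈
        ... | inj₁ refl = ⊥-elim (¬hub-x hub)
        ... | inj₂ (inj₁ refl) = ⊥-elim (¬hub-y hub)
        ... | inj₂ (inj₂ refl)
             with h′ , hub′ , h′≢h , hubs ← other-hub hub
             with g , y∈g , h′∈g ← cover (f , Comprises.∈₂ c) (occurs hub′) (λ { refl → ¬hub-y hub′ })
             with r , d ← third (tri g) y∈g h′∈g (λ { refl → ¬hub-y hub′ })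
             = by-pair (pair-of d (valid g))
          where
          open Comprises c
          module D = Comprises d
          ng : far g ≡ false
          ng = hub⇒near g hub′ h′∈g
          g≢f : g ≢ f
          g≢f refl = case only h′∈g of λ { (inj₁ refl) → ¬hub-x hub′ ; (inj₂ (inj₁ refl)) → ¬hub-y hub′ ; (inj₂ (inj₂ e)) → h′≢h e }
          fixed-g : fixed g ≡ false
          fixed-g = free-fixed free-y y∈g
          P₁ : Graph n m
          P₁ = P [ f ≔ (x , h) ]
          module Update (p : Fin n × Fin n) (val-p : Valid (tri g) p) where
            P′ : Graph n m
            P′ = P₁ [ g ≔ p ]
            at-g : P′ g ≡ p
            at-g = ≔-same P₁ g
            at-f : P′ f ≡ (x , h)
            at-f = trans (≔-other P₁ (g≢f ∘ sym)) (≔-same P f)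
            off : ∀ {i} → i ≢ f → i ≢ g → P′ i ≡ P i
            off nf ng = trans (≔-other P₁ ng) (≔-other P nf)
            good-x : Attached P′ x
            good-x = h , hub , edge-reach f (inj₁ at-f)
            deg′ : ∀ u → deg P′ u ≡ (deg P u xor (row (x , y) u xor row (x , h) u)) xor (row (P g) u xor row p u)
            deg′ u = trans (deg-≔ P₁ g p u)
              (cong₂ _xor_ (trans (deg-≔ P f (x , h) u) (cong (λ b → deg P u xor (b xor row (x , h) u)) (row-Joins j u)))
                           (cong (λ p′ → row p′ u xor row p u) (≔-other P g≢f)))
            state : (∀ u → ¬ Hub u → (row (x , y) u xor row (x , h) u) xor (row (P g) u xor row p u) ≡ false) → State P′
            state toggles = record
              { valid = valid-≔ tri g (valid-≔ tri f valid (∈₁ , ∈₃ , 1≢3)) val-p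
              ; agree = λ i fi → trans (off (λ { refl → true≢false (trans (sym fi) nf) }) (λ { refl → true≢false (trans (sym fi) ng) })) (agree i fi)
              ; keeps = λ i fi → trans (off (λ { refl → true≢false (trans (sym fi) fixed-f) }) (λ { refl → true≢false (trans (sym fi) fixed-g) })) (keeps i fi)
              ; even = λ u ¬hub → trans (deg′ u) (trans (xor-assoc (deg P u) _ _) (cong₂ _xor_ (even u ¬hub) (toggles u ¬hub))) }
            finish : (st′ : State P′) → Attached P′ (proj₁ p) →
                     (∀ a b → Joins (P g) a b → Attached P b → Attached P′ b → Attached P′ a) → Progress P
            finish st′ good-p pass-g = record
              { state = st′ ; f = f ; before = detached-end j dx ; after = attached-end {e = f} at-f good-x
              ; mono = λ e a → case e ≟ f of λ
                  { (yes refl) → ⊥-elim (detached-end j dx a)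
                  ; (no nf) → case e ≟ g of λ
                    { (yes refl) → attached-end {e = g} at-g good-p
                    ; (no ng) → subst (Attached P′) (sym (cong proj₁ (off nf ng))) (transfer a) } } }
              where
              Both : Fin n → Set
              Both u = Attached P u × Attached P′ u
              pass : ∀ i a b → Joins (P i) a b → Both b → Both a
              pass i a b jab ((w , hubw , r) , good) = att , go
                where
                att : Attached P a
                att = w , hubw , step i jab r
                go : Attached P′ a
                go with i ≟ f | i ≟ g
                ... | yes refl | _ = case Joins-end j jab of λ { (inj₁ refl) → ⊥-elim (dx att) ; (inj₂ refl) → ⊥-elim (dy att) }
                ... | no _ | yes refl = pass-g a b jab (w , hubw , r) good
                ... | no nf | no ng = case good of λ (w′ , hubw′ , r′) → w′ , hubw′ , step i (subst (λ p → Joins p a b) (sym (off nf ng)) jab) r′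
              transfer : ∀ {u} → Attached P u → Attached P′ u
              transfer (w , hubw , r) = proj₂ (Reach-transfer Both pass r ((w , hubw , stop) , (w , hubw , stop)))
          ==h : ∀ {u} → ¬ Hub u → u == h ≡ false
          ==h {u} ¬hub = ==-≢ {x = u} {h} λ { refl → ¬hub hub }
          ==h′ : ∀ {u} → ¬ Hub u → u == h′ ≡ false
          ==h′ {u} ¬hub = ==-≢ {x = u} {h′} λ { refl → ¬hub hub′ }
          by-pair : Joins (P g) y h′ ⊎ Joins (P g) y r ⊎ Joins (P g) h′ r → Progress P
          by-pair (inj₁ jg) = ⊥-elim (dy (h′ , hub′ , edge-reach g jg))
          -- The pair yr is detached as well, so no attached vertex depended on it, and it can give
          -- way to h′r.
          by-pair (inj₂ (inj₁ jg)) = finish (state toggles) (h′ , hub′ , stop)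
              λ a b jab att _ → ⊥-elim (case Joins-end jg jab of λ
                { (inj₁ refl) → dy (along jab att) ; (inj₂ refl) → dy (along jg (along jab att)) })
            where
            open Update (h′ , r) (D.∈₂ , D.∈₃ , D.2≢3)
            along : ∀ {a b} → Joins (P g) a b → Attached P b → Attached P a
            along jj (w , hubw , rr) = w , hubw , step g jj rr
            toggles : ∀ u → ¬ Hub u → (row (x , y) u xor row (x , h) u) xor (row (P g) u xor row (h′ , r) u) ≡ false
            toggles u ¬hub rewrite row-Joins jg u | ==h ¬hub | ==h′ ¬hub = calc (u == x) (u == y) (u == r)
              where
              calc : ∀ a b c → ((a xor b) xor (a xor false)) xor ((b xor c) xor (false xor c)) ≡ false
              calc true true true = refl
              calc true true false = refl
              calc true false true = refl
              calc true false false = refl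
              calc false true true = refl
              calc false true false = refl
              calc false false true = refl
              calc false false false = refl
          -- The pair h′r gives way to yr. Since `r` may have been attached only through this pair,
          -- it must now reach a hub by way of `y` and `x`.
          by-pair (inj₂ (inj₂ jg)) = finish (state toggles) good-y
              λ a b jab _ _ → case Joins-end jg jab of λ { (inj₁ refl) → h′ , hub′ , stop ; (inj₂ refl) → good-r }
            where
            open Update (y , r) (D.∈₁ , D.∈₃ , D.1≢3)
            toggles : ∀ u → ¬ Hub u → (row (x , y) u xor row (x , h) u) xor (row (P g) u xor row (y , r) u) ≡ false
            toggles u ¬hub rewrite row-Joins jg u | ==h ¬hub | ==h′ ¬hub = calc (u == x) (u == y) (u == r)
              where
              calc : ∀ a b c → ((a xor b) xor (a xor false)) xor ((false xor c) xor (b xor c)) ≡ false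
              calc true true true = refl
              calc true true false = refl
              calc true false true = refl
              calc true false false = refl
              calc false true true = refl
              calc false true false = refl
              calc false false true = refl
              calc false false false = refl
            -- The detached component is even, so it stays connected without `f`. The walk also
            -- avoids `g`, whose old pair contains a hub, so `lift` can carry it over to `P′`.
            back : Reach (P [ f ≔ (y , y) ]) y x
            back = bypass P f (1≢2 ∘ sym) (Joins-sym j) λ u r → even u λ hubu → dy (u , hubu , r)
            lift : ∀ {a} → Reach (P [ f ≔ (y , y) ]) a x → Reach P y a → Reach P′ a x
            lift stop _ = stop
            lift (step {x = a} {b} i jab s) ya = case i ≟ f of λ
              { (yes refl) → case Joins-end (inj₁ (≔-same P f)) (Joins-sym jab) , Joins-end (inj₁ (≔-same P f)) jab of λ
                { (inj₁ refl , inj₁ refl) → lift s stop ; (inj₁ refl , inj₂ refl) → lift s stop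
                ; (inj₂ refl , inj₁ refl) → lift s stop ; (inj₂ refl , inj₂ refl) → lift s stop }
              ; (no nf) → case subst (λ p → Joins p a b) (≔-other P nf) jab of λ jab′ → case i ≟ g of λ
                { (yes refl) → ⊥-elim (case Joins-end jab′ jg of λ
                    { (inj₁ refl) → dy (h′ , hub′ , ya) ; (inj₂ refl) → dy (h′ , hub′ , Reach-trans ya (edge-reach g jab′)) })
                ; (no ng) → step i (subst (λ p → Joins p a b) (sym (off nf ng)) jab′) (lift s (Reach-trans ya (edge-reach i jab′))) } }
            good-y : Attached P′ y
            good-y = case good-x of λ (w , hubw , r) → w , hubw , Reach-trans (lift back stop) r
            good-r : Attached P′ r
            good-r = case good-y of λ (w , hubw , s) → w , hubw , step g (inj₂ at-g) s

      -- The ends of a handle play symmetric roles: either one may be the end whose parity is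
      -- restored, so a single free end suffices.
      attach : (∀ {P} → State P → ∀ {f x y} → far f ≡ false → Joins (P f) x y → ¬ Attached P x → Free x ⊎ Free y) →
               ∀ {P} → State P → ∃ λ P′ → State P′ × ∀ e → Attached P′ (proj₁ (P′ e))
      attach guard {P} st = go st (<-wellFounded _)
        where
        bad? : ∀ P e → Dec (Bad P e)
        bad? P e = ¬? (attached? P (proj₁ (P e)))
        size : Graph n m → ℕ
        size P = count (does ∘ bad? P)
        advance : ∀ {P} → State P → Handle P → Progress P
        advance st hd = case guard st near joins detached of λ
          { (inj₂ fy) → progress st near joins detached fy
          ; (inj₁ fx) → progress st near (Joins-sym joins) (λ (h , hub , r) → detached (h , hub , step f joins r)) fx }
          where open Handle hd
        decr : ∀ {P} (pr : Progress P) → size (Progress.P′ pr) < size P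
        decr {P} pr = count-strict keep f (dec-false (bad? P′ f) λ b → b after) (dec-true (bad? P f) before)
          where
          open Progress pr
          keep : ∀ e → does (bad? P′ e) ≡ true → does (bad? P e) ≡ true
          keep e d = dec-true (bad? P e) λ a → does-true (bad? P′ e) d (mono e a)
        go : ∀ {P} → State P → Acc _<_ (size P) → ∃ λ P′ → State P′ × ∀ e → Attached P′ (proj₁ (P′ e))
        go {P} st (acc rec) with any? (bad? P)
        ... | no none = P , st , λ e → case attached? P (proj₁ (P e)) of λ { (yes a) → a ; (no ¬a) → ⊥-elim (none (e , ¬a)) }
        ... | yes (e , bad) = go (Progress.state pr) (rec (decr pr))
          where
          pr : Progress P
          pr = advance st (handle st e bad)

-- Two-colouring the union of two matchings

record Matching (n : ℕ) : Set₁ where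
  field
    Rel        : Fin n → Fin n → Set
    rel?       : ∀ x y → Dec (Rel x y)
    rel-sym    : ∀ {x y} → Rel x y → Rel y x
    irrefl     : ∀ {x} → ¬ Rel x x
    functional : ∀ {x y z} → Rel x y → Rel x z → y ≡ z

≢⇒not : {a b : Bool} → a ≢ b → a ≡ not b
≢⇒not {true} {true} h = ⊥-elim (h refl)
≢⇒not {true} {false} h = refl
≢⇒not {false} {true} h = refl
≢⇒not {false} {false} h = ⊥-elim (h refl)

not≢ : {a : Bool} → not a ≢ a
not≢ {true} ()
not≢ {false} ()

-- The union of two matchings consists of paths and even cycles: removing an A-matched pair x, y
-- and matching their B-partners with each other leaves a smaller instance.
two-colouring : (A B : Matching n) → ∃ λ (col : Fin n → Bool) →
                (∀ {x y} → Matching.Rel A x y → col x ≢ col y) × (∀ {x y} → Matching.Rel B x y → col x ≢ col y)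
two-colouring {n = n} A B = go A B (<-wellFounded _)
  where
  matched? : (M : Matching n) (x : Fin n) → Dec (∃ (Matching.Rel M x))
  matched? M x = any? (Matching.rel? M x)

  size : Matching n → ℕ
  size M = count (does ∘ matched? M)

  module Remove (A B : Matching n) {x y : Fin n} (xy : Matching.Rel A x y) where
    module A = Matching A
    module B = Matching B

    x≢y : x ≢ y
    x≢y refl = A.irrefl xy

    Old : Fin n → Set
    Old z = z ≢ x × z ≢ y

    old? : ∀ z → Dec (Old z)
    old? z = ¬? (z ≟ x) ×-dec ¬? (z ≟ y)

    classify : ∀ z → z ≡ x ⊎ z ≡ y ⊎ Old z
    classify z = case z ≟ x of λ
      { (yes p) → inj₁ p
      ; (no zx) → case z ≟ y of λ { (yes p) → inj₂ (inj₁ p) ; (no zy) → inj₂ (inj₂ (zx , zy)) } }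

    A′ : Matching n
    A′ = record
      { Rel = λ z w → Old z × Old w × A.Rel z w
      ; rel? = λ z w → old? z ×-dec old? w ×-dec A.rel? z w
      ; rel-sym = λ (a , b , c) → b , a , A.rel-sym c
      ; irrefl = λ (_ , _ , c) → A.irrefl c
      ; functional = λ (_ , _ , c) (_ , _ , d) → A.functional c d }

    Via : Fin n → Fin n → Set
    Via z w = B.Rel z w ⊎ (B.Rel z x × B.Rel y w) ⊎ (B.Rel z y × B.Rel x w)

    B′ : Matching n
    B′ = record
      { Rel = λ z w → Old z × Old w × Via z w
      ; rel? = λ z w → old? z ×-dec old? w ×-dec
                 (B.rel? z w ⊎-dec (B.rel? z x ×-dec B.rel? y w) ⊎-dec (B.rel? z y ×-dec B.rel? x w))
      ; rel-sym = λ (a , b , c) → b , a , (case c of λ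
          { (inj₁ r) → inj₁ (B.rel-sym r)
          ; (inj₂ (inj₁ (r , s))) → inj₂ (inj₂ (B.rel-sym s , B.rel-sym r))
          ; (inj₂ (inj₂ (r , s))) → inj₂ (inj₁ (B.rel-sym s , B.rel-sym r)) })
      ; irrefl = λ (_ , _ , c) → case c of λ
          { (inj₁ r) → B.irrefl r
          ; (inj₂ (inj₁ (r , s))) → x≢y (B.functional r (B.rel-sym s))
          ; (inj₂ (inj₂ (r , s))) → x≢y (B.functional (B.rel-sym s) r) }
      ; functional = λ (_ , (wx , wy) , c) (_ , (ux , uy) , d) → fun c d wx wy ux uy }
      where
      fun : ∀ {z w u} → Via z w → Via z u → w ≢ x → w ≢ y → u ≢ x → u ≢ y → w ≡ u
      fun (inj₁ r) (inj₁ s) _ _ _ _ = B.functional r s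
      fun (inj₁ r) (inj₂ (inj₁ (s , _))) wx _ _ _ = ⊥-elim (wx (B.functional r s))
      fun (inj₁ r) (inj₂ (inj₂ (s , _))) _ wy _ _ = ⊥-elim (wy (B.functional r s))
      fun (inj₂ (inj₁ (r , _))) (inj₁ s) _ _ ux _ = ⊥-elim (ux (B.functional s r))
      fun (inj₂ (inj₁ (_ , r))) (inj₂ (inj₁ (_ , s))) _ _ _ _ = B.functional r s
      fun (inj₂ (inj₁ (r , _))) (inj₂ (inj₂ (s , _))) _ _ _ _ = ⊥-elim (x≢y (B.functional r s))
      fun (inj₂ (inj₂ (r , _))) (inj₁ s) _ _ _ uy = ⊥-elim (uy (B.functional s r))
      fun (inj₂ (inj₂ (r , _))) (inj₂ (inj₁ (s , _))) _ _ _ _ = ⊥-elim (x≢y (B.functional s r))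
      fun (inj₂ (inj₂ (_ , r))) (inj₂ (inj₂ (_ , s))) _ _ _ _ = B.functional r s

    smaller : size A′ < size A
    smaller = count-strict (λ z d → dec-true (matched? A z) (case does-true (matched? A′ z) d of λ (w , _ , _ , r) → w , r)) x
      (dec-false (matched? A′ x) λ (_ , (xx , _) , _) → xx refl) (dec-true (matched? A x) (y , xy))

    module Extend (col : Fin n → Bool) (okA : ∀ {z w} → Matching.Rel A′ z w → col z ≢ col w)
                  (okB : ∀ {z w} → Matching.Rel B′ z w → col z ≢ col w) where

      record Choice : Set where
        field
          cx   : Bool
          fitx : ∀ {w} → B.Rel x w → w ≢ y → cx ≢ col w
          fity : ∀ {w} → B.Rel y w → w ≢ x → not cx ≢ col w

      choice : Choice
      -- If `x` has a `B`-partner `p`, then `x` takes the colour opposite to `p` and `y` takes that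
      -- of `p`. This suits the `B`-partner of `y`, because `B′` matches it with `p` and so its
      -- colour differs from that of `p`.
      choice with matched? B x | matched? B y
      ... | yes (p , xp) | _ = record
          { cx = not (col p)
          ; fitx = λ r _ → subst (λ u → not (col p) ≢ col u) (B.functional xp r) not≢
          ; fity = λ {w} r w≢x → λ eq → okB
              (((λ { refl → B.irrefl xp }) , λ { refl → w≢x (B.functional r (B.rel-sym xp)) }) ,
               (w≢x , (λ { refl → B.irrefl r })) , inj₂ (inj₁ (B.rel-sym xp , r)))
              (trans (sym (notnot (col p))) eq) }
        where
        notnot : ∀ a → not (not a) ≡ a
        notnot true = refl
        notnot false = refl
      ... | no ¬x | yes (r , yr) = record
          { cx = col r
          ; fitx = λ s _ → ⊥-elim (¬x (_ , s))
          ; fity = λ s _ → subst (λ u → not (col r) ≢ col u) (B.functional yr s) not≢ }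
      ... | no ¬x | no ¬y = record
          { cx = true ; fitx = λ s _ → ⊥-elim (¬x (_ , s)) ; fity = λ s _ → ⊥-elim (¬y (_ , s)) }
      open Choice choice

      col′ : Fin n → Bool
      col′ z = if z == x then cx else if z == y then not cx else col z

      at-x : col′ x ≡ cx
      at-x rewrite ==-refl x = refl
      at-y : col′ y ≡ not cx
      at-y rewrite ==-≢ (x≢y ∘ sym) | ==-refl y = refl
      at-old : ∀ {z} → Old z → col′ z ≡ col z
      at-old (zx , zy) rewrite ==-≢ zx | ==-≢ zy = refl

      x-y : col′ x ≢ col′ y
      x-y eq = not≢ (sym (trans (sym at-x) (trans eq at-y)))

      B-x : ∀ {w} → B.Rel x w → col′ x ≢ col′ w
      B-x {w} r = case w ≟ y of λ
        { (yes refl) → x-y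
        ; (no wy) → λ eq → fitx r wy (trans (sym at-x) (trans eq (at-old ((λ { refl → B.irrefl r }) , wy)))) }
      B-y : ∀ {w} → B.Rel y w → col′ y ≢ col′ w
      B-y {w} r = case w ≟ x of λ
        { (yes refl) → x-y ∘ sym
        ; (no wx) → λ eq → fity r wx (trans (sym at-y) (trans eq (at-old (wx , (λ { refl → B.irrefl r }))))) }

      okA′ : ∀ {z w} → A.Rel z w → col′ z ≢ col′ w
      okA′ {z} {w} r = case classify z of λ
        { (inj₁ refl) → subst (λ u → col′ x ≢ col′ u) (A.functional xy r) x-y
        ; (inj₂ (inj₁ refl)) → subst (λ u → col′ y ≢ col′ u) (A.functional (A.rel-sym xy) r) (x-y ∘ sym)
        ; (inj₂ (inj₂ oz)) → case classify w of λ
          { (inj₁ refl) → ⊥-elim (proj₂ oz (A.functional (A.rel-sym r) xy))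
          ; (inj₂ (inj₁ refl)) → ⊥-elim (proj₁ oz (A.functional (A.rel-sym r) (A.rel-sym xy)))
          ; (inj₂ (inj₂ ow)) → λ eq → okA (oz , ow , r) (trans (sym (at-old oz)) (trans eq (at-old ow))) } }

      okB′ : ∀ {z w} → B.Rel z w → col′ z ≢ col′ w
      okB′ {z} {w} r = case classify z of λ
        { (inj₁ refl) → B-x r
        ; (inj₂ (inj₁ refl)) → B-y r
        ; (inj₂ (inj₂ oz)) → case classify w of λ
          { (inj₁ refl) → B-x (B.rel-sym r) ∘ sym
          ; (inj₂ (inj₁ refl)) → B-y (B.rel-sym r) ∘ sym
          ; (inj₂ (inj₂ ow)) → λ eq → okB (oz , ow , inj₁ r) (trans (sym (at-old oz)) (trans eq (at-old ow))) } }

  go : (A B : Matching n) → Acc _<_ (size A) → ∃ λ (col : Fin n → Bool) →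
       (∀ {x y} → Matching.Rel A x y → col x ≢ col y) × (∀ {x y} → Matching.Rel B x y → col x ≢ col y)
  go A B (acc rec) with any? (matched? A)
  ... | yes (x , y , xy) with col , okA , okB ← go (Remove.A′ A B xy) (Remove.B′ A B xy) (rec (Remove.smaller A B xy)) =
    Remove.Extend.col′ A B xy col okA okB , Remove.Extend.okA′ A B xy col okA okB , Remove.Extend.okB′ A B xy col okA okB
  -- Only pairs of `B` are left, and the order of `Fin` tells their two ends apart.
  ... | no none = does ∘ below? , (λ r → ⊥-elim (none (_ , _ , r))) , ok
    where
    open Matching B
    below? : ∀ z → Dec (∃ λ w → Rel z w × z <ᶠ w)
    below? z = any? λ w → rel? z w ×-dec (z <? w)
    above : ∀ {z w} → Rel z w → z <ᶠ w → does (below? z) ≢ does (below? w)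
    above {z} {w} r lt eq = true≢false (trans (sym (dec-true (below? z) (w , r , lt))) (trans eq
      (dec-false (below? w) λ (u , s , lt′) → <-asym lt (subst (w <ᶠ_) (functional s (rel-sym r)) lt′))))
    ok : ∀ {z w} → Rel z w → does (below? z) ≢ does (below? w)
    ok {z} {w} r with <-cmp z w
    ... | tri< lt _ _ = above r lt
    ... | tri≈ _ refl _ = ⊥-elim (irrefl r)
    ... | tri> _ _ gt = above (rel-sym r) gt ∘ sym

-- Ownership of triples and repair of parities

module Owners (tri : Fin m → Triple n) (v q : Fin n) where
  open Hubs tri v q

  In : Fin n → Set
  In x = Occurs tri x × ¬ Hub x

  in? : ∀ x → Dec (In x)
  in? x = any? (λ e → x ∈ₜ? tri e) ×-dec ¬? (hub? x)

  -- Every vertex x chooses a triple A x through v and a triple B x through q; a colouring separating the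
  -- vertices that compete for the same triple decides which of the two x owns.
  module _ (v≢q : v ≢ q) (A B : Fin n → Fin m) (A-∈ : ∀ {x} → In x → x ∈ₜ tri (A x)) (A-v : ∀ {x} → In x → v ∈ₜ tri (A x))
           (B-∈ : ∀ {x} → In x → x ∈ₜ tri (B x)) where

    at-most-three : ∀ {e a b c d} → a ∈ₜ tri e → b ∈ₜ tri e → c ∈ₜ tri e → d ∈ₜ tri e →
            a ≢ b → a ≢ c → a ≢ d → b ≢ c → b ≢ d → c ≡ d
    at-most-three {e} a b c d ab ac ad bc bd with z , t ← third (tri e) a b ab =
      case Comprises.only t c , Comprises.only t d of λ
        { (inj₁ p , _) → ⊥-elim (ac (sym p)) ; (inj₂ (inj₁ p) , _) → ⊥-elim (bc (sym p))
        ; (inj₂ (inj₂ _) , inj₁ p) → ⊥-elim (ad (sym p)) ; (inj₂ (inj₂ _) , inj₂ (inj₁ p)) → ⊥-elim (bd (sym p))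
        ; (inj₂ (inj₂ p) , inj₂ (inj₂ p′)) → trans p (sym p′) }

    -- Besides the hub a triple has only two vertices, so a vertex has at most one competitor.
    compete : (C : Fin n → Fin m) (h : Fin n) → Hub h → (∀ {x} → In x → x ∈ₜ tri (C x)) → (∀ {x} → In x → h ∈ₜ tri (C x)) → Matching n
    compete C h hub C-∈ C-h = record
      { Rel = λ x y → In x × In y × x ≢ y × C x ≡ C y
      ; rel? = λ x y → in? x ×-dec in? y ×-dec ¬? (x ≟ y) ×-dec (C x ≟ C y)
      ; rel-sym = λ (a , b , c , d) → b , a , c ∘ sym , sym d
      ; irrefl = λ (_ , _ , c , _) → c refl
      ; functional = λ (ix , iy , x≢y , xy) (_ , iz , x≢z , xz) →
          at-most-three (C-h ix) (C-∈ ix) (subst (λ e → _ ∈ₜ tri e) (sym xy) (C-∈ iy)) (subst (λ e → _ ∈ₜ tri e) (sym xz) (C-∈ iz))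
                (λ { refl → proj₂ ix hub }) (λ { refl → proj₂ iy hub }) (λ { refl → proj₂ iz hub }) x≢y x≢z }

    record Colouring : Set where
      field
        col       : Fin n → Bool
        separateᴬ : ∀ {x y} → In x → In y → x ≢ y → A x ≡ A y → col x ≢ col y
        separateᴮ : ∀ {x y} → In x → In y → x ≢ y → B x ≡ B y → col x ≢ col y

      own : Fin n → Fin m
      own x = if col x then A x else B x

      own-∈ : ∀ {x} → In x → x ∈ₜ tri (own x)
      own-∈ {x} i with col x
      ... | true = A-∈ i
      ... | false = B-∈ i

    -- Complementing a colouring preserves its properties, so the colour of one vertex can be
    -- prescribed; with `true` that vertex owns its triple through `v`.
    colouring : (∀ {x} → In x → q ∈ₜ tri (B x)) → (x₀ : Fin n) → ∃ λ (c : Colouring) → Colouring.col c x₀ ≡ true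
    colouring B-q x₀ with col , okA , okB ← two-colouring (compete A v (inj₁ refl) A-∈ A-v) (compete B q (inj₂ refl) B-∈ B-q)
                     with col x₀ in eq
    ... | true = record { col = col ; separateᴬ = λ a b c d → okA (a , b , c , d) ; separateᴮ = λ a b c d → okB (a , b , c , d) } , eq
    ... | false = record { col = not ∘ col ; separateᴬ = λ a b c d → okA (a , b , c , d) ∘ not-injective
                         ; separateᴮ = λ a b c d → okB (a , b , c , d) ∘ not-injective } , cong not eq
      where
      not-injective : ∀ {a b} → not a ≡ not b → a ≡ b
      not-injective {true} {true} _ = refl
      not-injective {false} {false} _ = refl

    -- Two owners of the same colour are separated by the colouring. Owners of different colours
    -- would share a triple containing both hubs, which has room for only one more vertex.
    own-injective : (c : Colouring) → (∀ {x} → In x → q ∈ₜ tri (B x)) →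
                    let open Colouring c in ∀ {x y} → In x → In y → own x ≡ own y → x ≡ y
    own-injective c B-q {x} {y} ix iy eq with x ≟ y
    ... | yes p = p
    ... | no ne with Colouring.col c x in cx | Colouring.col c y in cy
    ...   | true | true = ⊥-elim (Colouring.separateᴬ c ix iy ne eq (trans cx (sym cy)))
    ...   | false | false = ⊥-elim (Colouring.separateᴮ c ix iy ne eq (trans cx (sym cy)))
    ...   | true | false = at-most-three (A-v ix) (subst (λ e → q ∈ₜ tri e) (sym eq) (B-q iy)) (A-∈ ix) (subst (λ e → y ∈ₜ tri e) (sym eq) (B-∈ iy))
                             v≢q (λ { refl → proj₂ ix (inj₁ refl) }) (λ { refl → proj₂ iy (inj₁ refl) }) (λ { refl → proj₂ ix (inj₂ refl) }) (λ { refl → proj₂ iy (inj₂ refl) })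
    ...   | false | true = at-most-three (A-v iy) (subst (λ e → q ∈ₜ tri e) eq (B-q ix)) (subst (λ e → x ∈ₜ tri e) eq (B-∈ ix)) (A-∈ iy)
                             v≢q (λ { refl → proj₂ ix (inj₁ refl) }) (λ { refl → proj₂ iy (inj₁ refl) }) (λ { refl → proj₂ ix (inj₂ refl) }) (λ { refl → proj₂ iy (inj₂ refl) })

  -- An owned triple {x, h, r} has base pair (h, r), exchanged for (x, r) to repair the parity at x.
  module Repair {D : Fin n → Set} (D? : ∀ x → Dec (D x)) (¬hub : ∀ {x} → D x → ¬ Hub x)
                (own : Fin n → Fin m) (h r : Fin n → Fin n) (hub : ∀ {x} → D x → Hub (h x))
                (shape : ∀ {x} → D x → Comprises (tri (own x)) x (h x) (r x))
                (injective : ∀ {x y} → D x → D y → own x ≡ own y → x ≡ y) where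

    Owned : Fin m → Set
    Owned e = ∃ λ x → D x × own x ≡ e

    owned? : ∀ e → Dec (Owned e)
    owned? e = any? λ x → D? x ×-dec (own x ≟ e)

    assign : (Fin n → Fin n × Fin n) → Graph n m → Graph n m
    assign p P e with owned? e
    ... | yes (x , _) = p x
    ... | no _ = P e

    assign-own : ∀ p P {x} → D x → assign p P (own x) ≡ p x
    assign-own p P {x} d with owned? (own x)
    ... | yes (y , d′ , eq) = cong p (injective d′ d eq)
    ... | no ¬o = ⊥-elim (¬o (x , d , refl))

    assign-free : ∀ p P {e} → ¬ Owned e → assign p P e ≡ P e
    assign-free p P {e} ¬o with owned? e
    ... | yes o = ⊥-elim (¬o o)
    ... | no _ = refl

    assign-valid : ∀ p P → (∀ {x} → D x → Valid (tri (own x)) (p x)) → AllValid tri P → AllValid tri (assign p P)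
    assign-valid p P vp vP e with owned? e
    ... | yes (x , d , refl) = vp d
    ... | no _ = vP e

    base : Fin n → Fin n × Fin n
    base x = h x , r x

    repaired : Graph n m → Fin n → Fin n × Fin n
    repaired P x = if deg P x then (x , r x) else base x

    base-valid : ∀ {x} → D x → Valid (tri (own x)) (base x)
    base-valid d = let open Comprises (shape d) in ∈₂ , ∈₃ , 2≢3

    repaired-valid : ∀ P {x} → D x → Valid (tri (own x)) (repaired P x)
    repaired-valid P {x} d with deg P x
    ... | true = let open Comprises (shape d) in ∈₁ , ∈₃ , 1≢3
    ... | false = base-valid d

    module _ (P : Graph n m) (P-base : ∀ {x} → D x → P (own x) ≡ base x) where
      R : Graph n m
      R = assign (repaired P) P

      change : Fin n → Fin m → Bool
      change u e = row (P e) u xor row (R e) u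

      deg-R : ∀ u → deg R u ≡ deg P u xor ⨁ (change u)
      deg-R u = trans (sym (xor-cancelˡ (deg P u) (deg R u))) (cong (deg P u xor_) (sym (⨁-xor (λ e → row (P e) u) (λ e → row (R e) u))))

      -- The vertex `r x` lies in both pairs and `h x` is a hub, so among the non-hubs only `x`
      -- changes parity. Hence all repairs can be made simultaneously from the degrees in `P`.
      change-own : ∀ {u x} → ¬ Hub u → D x → change u (own x) ≡ deg P x ∧ u == x
      change-own {u} {x} ¬hu d rewrite P-base d | assign-own (repaired P) P d | ==-≢ {x = u} {h x} (λ { refl → ¬hu (hub d) }) with deg P x
      ... | true = calc (u == r x) (u == x)
        where
        calc : ∀ a b → a xor (b xor a) ≡ b
        calc true true = refl
        calc true false = refl
        calc false true = refl
        calc false false = refl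
      ... | false rewrite ==-≢ {x = u} {h x} (λ { refl → ¬hu (hub d) }) = xor-same (u == r x)

      change-off : ∀ {u e} → ¬ Hub u → (∀ {x} → D x → own x ≡ e → u ≢ x) → change u e ≡ false
      change-off {u} {e} ¬hu off with owned? e in eq
      ... | yes (x , d , refl) = trans (cong (λ p → row (P (own x)) u xor row p u) (sym (lem eq))) (trans (change-own ¬hu d)
              (trans (cong (deg P x ∧_) (==-≢ (off d refl))) (∧-zero (deg P x))))
        where
        ∧-zero : ∀ a → a ∧ false ≡ false
        ∧-zero true = refl
        ∧-zero false = refl
        lem : owned? (own x) ≡ yes (x , d , refl) → R (own x) ≡ repaired P x
        lem _ = assign-own (repaired P) P d
      ... | no ¬o = xor-same (row (P e) u)

      even-D : ∀ {u} → D u → deg R u ≡ false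
      even-D {u} d = trans (deg-R u) (trans (cong (deg P u xor_)
        (trans (⨁-single (change u) (own u) λ e ne → change-off (¬hub d) λ { d′ refl refl → ne refl })
          (trans (change-own (¬hub d) d) (trans (cong (deg P u ∧_) (==-refl u)) (∧-one (deg P u))))))
        (xor-same (deg P u)))
        where
        ∧-one : ∀ a → a ∧ true ≡ a
        ∧-one true = refl
        ∧-one false = refl

      same-off-D : ∀ {u} → ¬ D u → ¬ Hub u → deg R u ≡ deg P u
      same-off-D {u} ¬d ¬hu = trans (deg-R u) (trans (cong (deg P u xor_)
        (⨁-false {f = change u} λ e → change-off ¬hu λ { d _ refl → ¬d d })) (xor-identityʳ (deg P u)))

-- Linking the hubs and correcting their degrees

record Eulerian {n m} (tri : Fin m → Triple n) : Set where
  field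
    graph     : Graph n m
    valid     : AllValid tri graph
    even      : ∀ u → deg graph u ≡ false
    connected : ∀ e e′ → Reach graph (proj₁ (graph e)) (proj₁ (graph e′))

module Finish (tri : Fin m → Triple n) (v q : Fin n) (v≢q : v ≢ q) where
  open Hubs tri v q

  record Nearly (P : Graph n m) : Set where
    field
      valid    : AllValid tri P
      even     : ∀ u → ¬ Hub u → deg P u ≡ false
      attached : ∀ e → Attached P (proj₁ (P e))

  hubs-linked : {P : Graph n m} → Reach P v q → ∀ {h h′} → Hub h → Hub h′ → Reach P h h′
  hubs-linked r (inj₁ refl) (inj₁ refl) = stop
  hubs-linked r (inj₁ refl) (inj₂ refl) = r
  hubs-linked r (inj₂ refl) (inj₁ refl) = Reach-sym r
  hubs-linked r (inj₂ refl) (inj₂ refl) = stop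

  -- The parity of `q` comes for free: it would otherwise be the only odd vertex of its component.
  complete : {P : Graph n m} → Nearly P → Reach P v q → deg P v ≡ false → Eulerian tri
  complete {P} st link even-v = record
    { graph = P ; valid = valid ; even = all-even
    ; connected = λ e e′ → case attached e , attached e′ of λ
        ((h , hub , r) , (h′ , hub′ , r′)) → Reach-trans r (Reach-trans (hubs-linked link hub hub′) (Reach-sym r′)) }
    where
    open Nearly st
    even-q : deg P q ≡ false
    even-q = ≢true⇒≡false λ odd → case odd-partner P q odd of λ (u , u≢q , _ , odd-u) → case hub? u of λ
      { (yes (inj₁ refl)) → true≢false (trans (sym odd-u) even-v)
      ; (yes (inj₂ refl)) → u≢q refl
      ; (no ¬hub) → true≢false (trans (sym odd-u) (even u ¬hub)) }
    all-even : ∀ u → deg P u ≡ false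
    all-even u = case hub? u of λ
      { (yes (inj₁ refl)) → even-v ; (yes (inj₂ refl)) → even-q ; (no ¬hub) → even u ¬hub }

  attached-transfer : ∀ {P P′ : Graph n m} → (∀ i a b → Joins (P i) a b → Attached P′ b → Attached P′ a) →
                      ∀ {u} → Attached P u → Attached P′ u
  attached-transfer pass (h , hub , r) = Reach-transfer (Attached _) pass r (h , hub , stop)

  pass-same : ∀ {P P′ : Graph n m} {i a b} → P′ i ≡ P i → Joins (P i) a b → Attached P′ b → Attached P′ a
  pass-same {i = i} eq j (h , hub , r) = h , hub , step i (subst (λ p → Joins p _ _) (sym eq) j) r

  -- Moving the chosen pair of a triple {v, q, c} from one hub to the other exchanges the parities of v and q.
  finish-swap : {P : Graph n m} → Nearly P → ∀ e {h c} → Comprises (tri e) v q c → Hub h → Joins (P e) h c →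
                (∀ P′ → (∀ {i} → i ≢ e → P′ i ≡ P i) → Reach P′ v q) → Eulerian tri
  finish-swap {P} st e {h} {c} t hub j link with deg P v ≟ᵇ false
  ... | yes even-v = complete st (link P (λ _ → refl)) even-v
  ... | no odd-v with h′ , hub′ , h′≢h , hubs ← other-hub v≢q hub = complete st′ (link P′ (≔-other P)) even-v
    where
    open Comprises t
    open Nearly st
    P′ : Graph n m
    P′ = P [ e ≔ (h′ , c) ]
    hub∈ : ∀ {h} → Hub h → h ∈ₜ tri e × h ≢ c
    hub∈ (inj₁ refl) = ∈₁ , 1≢3
    hub∈ (inj₂ refl) = ∈₂ , 2≢3
    c-att : Attached P′ c
    c-att = h′ , hub′ , edge-reach e (inj₂ (≔-same P e))
    deg′ : ∀ u → deg P′ u ≡ deg P u xor (row (h , c) u xor row (h′ , c) u)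
    deg′ u = trans (deg-≔ P e (h′ , c) u) (cong (λ b → deg P u xor (b xor row (h′ , c) u)) (row-Joins j u))
    pass : ∀ i a b → Joins (P i) a b → Attached P′ b → Attached P′ a
    pass i a b jab att = case i ≟ e of λ
      { (no ne) → pass-same {P} {P′} {i} (≔-other P ne) jab att
      ; (yes refl) → case Joins-end j jab of λ { (inj₁ refl) → h , hub , stop ; (inj₂ refl) → c-att } }
    st′ : Nearly P′
    st′ = record
      { valid = valid-≔ tri e valid (proj₁ (hub∈ hub′) , ∈₃ , proj₂ (hub∈ hub′))
      ; even = λ u ¬hub → trans (deg′ u) (cong₂ _xor_ (even u ¬hub)
          (trans (cong₂ (λ a b → (a xor u == c) xor (b xor u == c)) (==-≢ {x = u} {h} λ { refl → ¬hub hub }) (==-≢ {x = u} {h′} λ { refl → ¬hub hub′ })) (xor-same (u == c))))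
      ; attached = λ i → case i ≟ e of λ
          { (yes refl) → subst (Attached P′) (sym (cong proj₁ (≔-same P e))) (h′ , hub′ , stop)
          ; (no ne) → subst (Attached P′) (sym (cong proj₁ (≔-other P ne))) (attached-transfer pass (attached i)) } }
    even-v : deg P′ v ≡ false
    even-v = trans (deg′ v) (cong₂ _xor_ (≢false⇒≡true odd-v) toggled)
      where
      toggled : row (h , c) v xor row (h′ , c) v ≡ true
      toggled = case hubs (inj₁ refl) of λ
        { (inj₁ v≡h) → cong₂ _xor_ (trans (cong (λ z → row (h , c) z) v≡h) (row-fst (proj₂ (hub∈ hub))))
                         (row-off (λ eq → h′≢h (trans (sym eq) v≡h)) 1≢3)
        ; (inj₂ v≡h′) → cong₂ _xor_ (row-off (λ eq → h′≢h (trans (sym v≡h′) eq)) 1≢3)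
                         (trans (cong (λ z → row (h′ , c) z) v≡h′) (row-fst (proj₂ (hub∈ hub′)))) }

  -- Two copies of {v, q, c}: the pairs vq, vq may be exchanged for vc, qc.
  finish-double : {P : Graph n m} → Nearly P → ∀ e₀ e₁ {c} → e₀ ≢ e₁ → Comprises (tri e₀) v q c → Comprises (tri e₁) v q c →
                  Joins (P e₀) v q → Joins (P e₁) v q → Eulerian tri
  finish-double {P} st e₀ e₁ {c} ne t₀ t₁ p₀ p₁ with deg P v ≟ᵇ false
  ... | yes even-v = complete st (edge-reach e₀ p₀) even-v
  ... | no odd-v = complete st′ link even-v
    where
    module T₀ = Comprises t₀
    module T₁ = Comprises t₁
    open Nearly st
    P₁ P′ : Graph n m
    P₁ = P [ e₀ ≔ (v , c) ]
    P′ = P₁ [ e₁ ≔ (q , c) ]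
    at₁ : P′ e₁ ≡ (q , c)
    at₁ = ≔-same P₁ e₁
    at₀ : P′ e₀ ≡ (v , c)
    at₀ = trans (≔-other P₁ ne) (≔-same P e₀)
    off : ∀ {i} → i ≢ e₀ → i ≢ e₁ → P′ i ≡ P i
    off n₀ n₁ = trans (≔-other P₁ n₁) (≔-other P n₀)
    link : Reach P′ v q
    link = step e₀ (inj₁ at₀) (edge-reach e₁ (inj₂ at₁))
    deg′ : ∀ u → deg P′ u ≡ (deg P u xor (row (v , q) u xor row (v , c) u)) xor (row (v , q) u xor row (q , c) u)
    deg′ u = trans (deg-≔ P₁ e₁ (q , c) u)
      (cong₂ _xor_ (trans (deg-≔ P e₀ (v , c) u) (cong (λ b → deg P u xor (b xor row (v , c) u)) (row-Joins p₀ u)))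
                   (cong (_xor row (q , c) u) (trans (cong (λ p → row p u) (≔-other P (ne ∘ sym))) (row-Joins p₁ u))))
    pass : ∀ i a b → Joins (P i) a b → Attached P′ b → Attached P′ a
    pass i a b jab att = case i ≟ e₀ of λ
      { (yes refl) → case Joins-end p₀ jab of λ { (inj₁ refl) → v , inj₁ refl , stop ; (inj₂ refl) → q , inj₂ refl , stop }
      ; (no n₀) → case i ≟ e₁ of λ
        { (yes refl) → case Joins-end p₁ jab of λ { (inj₁ refl) → v , inj₁ refl , stop ; (inj₂ refl) → q , inj₂ refl , stop }
        ; (no n₁) → pass-same {P} {P′} {i} (off n₀ n₁) jab att } }
    st′ : Nearly P′
    st′ = record
      { valid = valid-≔ tri e₁ (valid-≔ tri e₀ valid (T₀.∈₁ , T₀.∈₃ , T₀.1≢3)) (T₁.∈₂ , T₁.∈₃ , T₁.2≢3)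
      ; even = λ u ¬hub → trans (deg′ u) (trans (cong₂ (λ a b → (deg P u xor ((a xor b) xor (a xor u == c))) xor ((a xor b) xor (b xor u == c)))
          (==-≢ {x = u} {v} λ { refl → ¬hub (inj₁ refl) }) (==-≢ {x = u} {q} λ { refl → ¬hub (inj₂ refl) }))
          (trans (cong (λ d → (d xor (u == c)) xor (u == c)) (even u ¬hub)) (xor-same (u == c))))
      ; attached = λ i → case i ≟ e₁ of λ
          { (yes refl) → subst (Attached P′) (sym (cong proj₁ at₁)) (q , inj₂ refl , stop)
          ; (no n₁) → case i ≟ e₀ of λ
            { (yes refl) → subst (Attached P′) (sym (cong proj₁ at₀)) (v , inj₁ refl , stop)
            ; (no n₀) → subst (Attached P′) (sym (cong proj₁ (off n₀ n₁))) (attached-transfer pass (attached i)) } } }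
    even-v : deg P′ v ≡ false
    even-v = trans (deg′ v) (cong₂ _xor_ (cong₂ _xor_ (≢false⇒≡true odd-v) (cong₂ _xor_ (row-fst v≢q) (row-fst T₀.1≢3)))
                              (cong₂ _xor_ (row-fst v≢q) (row-off v≢q T₁.1≢3)))

-- Building a choice of pairs around two hubs

valid-row : {T : Triple n} {p : Fin n × Fin n} {u : Fin n} → Valid T p → row p u ≡ true → u ∈ₜ T
valid-row {p = p} {u} (s∈ , t∈ , _) eq = case row-true p u eq of λ { (inj₁ refl) → s∈ ; (inj₂ refl) → t∈ }

Comprises-unique : {T : Triple n} {x y z w : Fin n} → Comprises T x y z → Comprises T x y w → z ≡ w
Comprises-unique c d = case Comprises.only d (Comprises.∈₃ c) of λ
  { (inj₁ e) → ⊥-elim (Comprises.1≢3 c (sym e)) ; (inj₂ (inj₁ e)) → ⊥-elim (Comprises.2≢3 c (sym e)) ; (inj₂ (inj₂ e)) → e }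

some-pair : Triple n → Fin n × Fin n
some-pair T = Triple.v₁ T , Triple.v₂ T

some-valid : (T : Triple n) → Valid T (some-pair T)
some-valid T = inj₁ refl , inj₂ (inj₁ refl) , Triple.≢₁₂ T

module TwoHubs {n m} (tri : Fin m → Triple n) (cover : PairCovering tri) (v q : Fin n) (v≢q : v ≢ q)
               (occurs-v : Occurs tri v) (occurs-q : Occurs tri q) where

  open Hubs tri v q public
  open Owners tri v q public
  open Finish tri v q v≢q public

  occurs : ∀ {h} → Hub h → Occurs tri h
  occurs (inj₁ refl) = occurs-v
  occurs (inj₂ refl) = occurs-q

  near-∈ : ∀ {e} → v ∈ₜ tri e ⊎ q ∈ₜ tri e → far e ≡ false
  near-∈ {e} (inj₁ i) = hub⇒near e (inj₁ refl) i
  near-∈ {e} (inj₂ i) = hub⇒near e (inj₂ refl) i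

  near-cases : ∀ {e} → far e ≡ false → v ∈ₜ tri e ⊎ q ∈ₜ tri e
  near-cases {e} eq = case near⇒hub e eq of λ { (_ , inj₁ refl , i) → inj₁ i ; (_ , inj₂ refl , i) → inj₂ i }

  record FarGraph : Set where
    field
      Q      : Graph n m
      valid  : ∀ e → far e ≡ true → Valid (tri e) (Q e)
      loop   : ∀ e → far e ≡ false → Q e ≡ (v , v)
      rooted : ∀ e → far e ≡ true → ∃ λ u → Reach Q (proj₁ (Q e)) u × deg Q u ≡ true

    total : Graph n m
    total e = if far e then Q e else some-pair (tri e)

    total-far : ∀ e → far e ≡ true → total e ≡ Q e
    total-far e eq rewrite eq = refl

    total-valid : AllValid tri total
    total-valid e with far e in eq
    ... | true = valid e eq
    ... | false = some-valid (tri e)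

    deg-far : ∀ {P} → (∀ e → far e ≡ true → P e ≡ Q e) → ∀ c →
              deg P c ≡ deg Q c xor ⨁ (λ e → not (far e) ∧ row (P e) c)
    deg-far {P} agree c = trans (⨁-cong pointwise) (⨁-xor (λ e → row (Q e) c) (λ e → not (far e) ∧ row (P e) c))
      where
      pointwise : ∀ e → row (P e) c ≡ row (Q e) c xor (not (far e) ∧ row (P e) c)
      pointwise e with far e in eq
      ... | true = trans (cong (λ p → row p c) (agree e eq)) (sym (xor-identityʳ _))
      ... | false = sym (cong (_xor row (P e) c) (trans (cong (λ p → row p c) (loop e eq)) (row-loop v c)))

  module Weighted (Y : Fin n → Bool) where
    open OddRooted tri far v Y

    start : Graph n m
    start e = if far e then some-pair (tri e) else (v , v)

    start-partial : Partial start
    start-partial e with far e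
    ... | true = inj₁ (refl , some-valid (tri e))
    ... | false = inj₂ (refl , refl)

    from : (Q₀ : Graph n m) → Partial Q₀ → ∃ λ (G : FarGraph) → ⨁ (weight ∘ FarGraph.Q G) ≡ ⨁ (weight ∘ Q₀)
    from Q₀ p₀ with Q , pQ , same , rooted ← odd-rooted Q₀ p₀ = record
      { Q = Q
      ; valid = λ e eq → case pQ e of λ { (inj₁ (_ , val)) → val ; (inj₂ (eq′ , _)) → ⊥-elim (true≢false (trans (sym eq) eq′)) }
      ; loop = λ e eq → case pQ e of λ { (inj₁ (eq′ , _)) → ⊥-elim (true≢false (trans (sym eq′) eq)) ; (inj₂ (_ , l)) → l }
      ; rooted = rooted } , same

    far-graph : FarGraph
    far-graph = proj₁ (from start start-partial)

    -- Since `odd-rooted` preserves the total weight, its parity can be set beforehand at the single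
    -- triple `g`, which offers pairs of both weights. By `deg-sum` this sets the degree sum over
    -- `Y`.
    odd-far-graph : ∀ g {p p′} → far g ≡ true → Valid (tri g) p → Valid (tri g) p′ → weight p ≡ true → weight p′ ≡ false →
                    ∃ λ (G : FarGraph) → ⨁ (λ x → Y x ∧ deg (FarGraph.Q G) x) ≡ true
    odd-far-graph g {p} {p′} fg val val′ w w′ = choose (⨁ (weight ∘ start) xor weight (start g)) refl
      where
      with-pair : ∀ r → Valid (tri g) r → (⨁ (weight ∘ start) xor weight (start g)) xor weight r ≡ true →
                  ∃ λ (G : FarGraph) → ⨁ (λ x → Y x ∧ deg (FarGraph.Q G) x) ≡ true
      with-pair r vr odd with G , same ← from (start [ g ≔ r ]) (partial-≔ g start-partial fg vr) =
        G , trans (deg-sum (FarGraph.Q G) Y) (trans same (trans (sum-≔ start g r)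
              (trans (sym (xor-assoc (⨁ (weight ∘ start)) (weight (start g)) (weight r))) odd)))
      choose : ∀ b → ⨁ (weight ∘ start) xor weight (start g) ≡ b →
               ∃ λ (G : FarGraph) → ⨁ (λ x → Y x ∧ deg (FarGraph.Q G) x) ≡ true
      choose true  eq = with-pair p′ val′ (cong₂ _xor_ eq w′)
      choose false eq = with-pair p val (cong₂ _xor_ eq w)

  -- Candidates for ownership are prescribed at two vertices and taken from `cover` elsewhere, with
  -- `e₀` as a dummy for hubs and vertices in no triple. As `a₁` contains both hubs, it serves as
  -- both candidates of `c₁`, which then owns it whatever its colour. If `c₀` and `c₁` coincide, the
  -- candidates of `c₀` prevail.
  module Choose (e₀ : Fin m) {c₀ c₁ : Fin n} (in₀ : In c₀) (in₁ : In c₁) (a₀ b₀ a₁ : Fin m)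
                (c₀∈a₀ : c₀ ∈ₜ tri a₀) (v∈a₀ : v ∈ₜ tri a₀) (c₀∈b₀ : c₀ ∈ₜ tri b₀) (q∈b₀ : q ∈ₜ tri b₀)
                (c₁∈a₁ : c₁ ∈ₜ tri a₁) (v∈a₁ : v ∈ₜ tri a₁) (q∈a₁ : q ∈ₜ tri a₁) where

    candidate : (h : Fin n) → Hub h → (x : Fin n) → Fin m
    candidate h hub x with in? x
    ... | yes (o , ¬hub) = proj₁ (cover o (occurs hub) λ { refl → ¬hub hub })
    ... | no _ = e₀

    candidate-∈ : ∀ {h} (hub : Hub h) {x} → In x → x ∈ₜ tri (candidate h hub x) × h ∈ₜ tri (candidate h hub x)
    candidate-∈ hub {x} i with in? x
    ... | yes (o , ¬hub) = proj₂ (cover o (occurs hub) λ { refl → ¬hub hub })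
    ... | no ¬i = ⊥-elim (¬i i)

    override : Fin m → (Fin n → Fin m) → Fin n → Fin m
    override a C x with x ≟ c₀ | x ≟ c₁
    ... | yes _ | _ = a
    ... | no _ | yes _ = a₁
    ... | no _ | no _ = C x

    override-prop : (R : Fin n → Fin m → Set) → ∀ a C → R c₀ a → R c₁ a₁ → (∀ {x} → In x → R x (C x)) → ∀ {x} → In x → R x (override a C x)
    override-prop R a C r₀ r₁ r {x} i with x ≟ c₀ | x ≟ c₁
    ... | yes refl | _ = r₀
    ... | no _ | yes refl = r₁
    ... | no _ | no _ = r i

    override-c₀ : ∀ a C → override a C c₀ ≡ a
    override-c₀ a C with c₀ ≟ c₀ | c₀ ≟ c₁
    ... | yes _ | _ = refl
    ... | no ne | _ = ⊥-elim (ne refl)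

    override-c₁ : ∀ a C → c₁ ≢ c₀ → override a C c₁ ≡ a₁
    override-c₁ a C ne with c₁ ≟ c₀ | c₁ ≟ c₁
    ... | yes eq | _ = ⊥-elim (ne eq)
    ... | no _ | yes _ = refl
    ... | no _ | no ne′ = ⊥-elim (ne′ refl)

    A B : Fin n → Fin m
    A = override a₀ (candidate v (inj₁ refl))
    B = override b₀ (candidate q (inj₂ refl))

    A-∈ : ∀ {x} → In x → x ∈ₜ tri (A x)
    A-∈ = override-prop (λ x e → x ∈ₜ tri e) a₀ _ c₀∈a₀ c₁∈a₁ (λ i → proj₁ (candidate-∈ (inj₁ refl) i))
    A-v : ∀ {x} → In x → v ∈ₜ tri (A x)
    A-v = override-prop (λ _ e → v ∈ₜ tri e) a₀ _ v∈a₀ v∈a₁ (λ i → proj₂ (candidate-∈ (inj₁ refl) i))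
    B-∈ : ∀ {x} → In x → x ∈ₜ tri (B x)
    B-∈ = override-prop (λ x e → x ∈ₜ tri e) b₀ _ c₀∈b₀ c₁∈a₁ (λ i → proj₁ (candidate-∈ (inj₂ refl) i))
    B-q : ∀ {x} → In x → q ∈ₜ tri (B x)
    B-q = override-prop (λ _ e → q ∈ₜ tri e) b₀ _ q∈b₀ q∈a₁ (λ i → proj₂ (candidate-∈ (inj₂ refl) i))

    colours : (x₀ : Fin n) → ∃ λ (c : Colouring v≢q A B A-∈ A-v B-∈) → Colouring.col c x₀ ≡ true
    colours = colouring v≢q A B A-∈ A-v B-∈ B-q

    module Coloured (c : Colouring v≢q A B A-∈ A-v B-∈) where
      open Colouring c public

      hub-of : Fin n → Fin n
      hub-of x = if col x then v else q

      hub-of-hub : ∀ x → Hub (hub-of x)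
      hub-of-hub x with col x
      ... | true = inj₁ refl
      ... | false = inj₂ refl

      hub-of-in : ∀ {x} → In x → Hub (hub-of x)
      hub-of-in {x} _ = hub-of-hub x

      hub-of-∈ : ∀ {x} → In x → hub-of x ∈ₜ tri (own x)
      hub-of-∈ {x} i with col x
      ... | true = A-v i
      ... | false = B-q i

      rest : Fin n → Fin n
      rest x with in? x
      ... | yes i = proj₁ (third (tri (own x)) (own-∈ i) (hub-of-∈ i) (λ eq → proj₂ i (subst Hub (sym eq) (hub-of-hub x))))
      ... | no _ = x

      shape : ∀ {x} → In x → Comprises (tri (own x)) x (hub-of x) (rest x)
      shape {x} i with in? x
      ... | yes j = proj₂ (third (tri (own x)) (own-∈ j) (hub-of-∈ j) (λ eq → proj₂ j (subst Hub (sym eq) (hub-of-hub x))))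
      ... | no ¬i = ⊥-elim (¬i i)

      injective : ∀ {x y} → In x → In y → own x ≡ own y → x ≡ y
      injective = own-injective v≢q A B A-∈ A-v B-∈ c B-q

      own-c₀ : own c₀ ≡ (if col c₀ then a₀ else b₀)
      own-c₀ rewrite override-c₀ a₀ (candidate v (inj₁ refl)) | override-c₀ b₀ (candidate q (inj₂ refl)) = refl

      own-c₁ : c₁ ≢ c₀ → own c₁ ≡ a₁
      own-c₁ ne rewrite override-c₁ a₀ (candidate v (inj₁ refl)) ne | override-c₁ b₀ (candidate q (inj₂ refl)) ne with col c₁
      ... | true = refl
      ... | false = refl

  not-occurring-even : ∀ {P u} → AllValid tri P → ¬ Occurs tri u → deg P u ≡ false
  not-occurring-even {P} {u} val ¬o = ⨁-false λ e → ≢true⇒≡false λ eq → ¬o (e , valid-row {T = tri e} (val e) eq)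

  -- If `c` owns {v, q, c}, its base pair consists of the two hubs and links them, while its
  -- repaired pair joins `c` to a hub, by `rest-hub`. The parity of `c` selects one of the two uses.
  base-link : ∀ {e c h r} → Comprises (tri e) v q c → Comprises (tri e) c h r → Hub h → Joins (h , r) v q
  base-link t s (inj₁ refl) = case Comprises.only t (Comprises.∈₃ s) of λ
    { (inj₁ refl) → ⊥-elim (Comprises.2≢3 s refl) ; (inj₂ (inj₁ refl)) → inj₁ refl ; (inj₂ (inj₂ refl)) → ⊥-elim (Comprises.1≢3 s refl) }
  base-link t s (inj₂ refl) = case Comprises.only t (Comprises.∈₃ s) of λ
    { (inj₁ refl) → inj₂ refl ; (inj₂ (inj₁ refl)) → ⊥-elim (Comprises.2≢3 s refl) ; (inj₂ (inj₂ refl)) → ⊥-elim (Comprises.1≢3 s refl) }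

  rest-hub : ∀ {e c h r} → Comprises (tri e) v q c → Comprises (tri e) c h r → Hub r
  rest-hub t s = case Comprises.only t (Comprises.∈₃ s) of λ
    { (inj₁ p) → inj₁ p ; (inj₂ (inj₁ p)) → inj₂ p ; (inj₂ (inj₂ p)) → ⊥-elim (Comprises.1≢3 s (sym p)) }

  record Prepared (G : FarGraph) (P : Graph n m) : Set where
    field
      valid : AllValid tri P
      agree : ∀ e → far e ≡ true → P e ≡ FarGraph.Q G e
      even  : ∀ u → ¬ Hub u → deg P u ≡ false

  module Attaching (G : FarGraph) {P : Graph n m} (prep : Prepared G P) (fixed : Fin m → Bool)
                   (fixed-hub : ∀ e → fixed e ≡ true → Hub (proj₁ (P e)) ⊎ Hub (proj₂ (P e)))
                   (Blocked : Fin n → Set) (blocked? : ∀ x → Dec (Blocked x))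
                   (unblocked : ∀ {y g} → ¬ Hub y → ¬ Blocked y → y ∈ₜ tri g → fixed g ≡ false) where

    open Attach v≢q cover occurs (FarGraph.Q G) (FarGraph.loop G) (FarGraph.rooted G) P fixed fixed-hub
      (λ y → ¬ Hub y × ¬ Blocked y) (λ (h , b) i → unblocked h b i) public

    -- Every non-hub in a fixed triple is blocked. The attaching can halt only at a detached pair
    -- with two blocked ends, which the hypothesis excludes.
    attached-choice : (∀ {P′} → State P′ → ∀ {f x y} → far f ≡ false → Joins (P′ f) x y → x ≢ y → x ∈ₜ tri f → y ∈ₜ tri f →
                        ¬ Attached P′ x → ¬ Attached P′ y → Blocked x → ¬ Blocked y) →
                      ∃ λ P′ → Nearly P′ × (∀ e → fixed e ≡ true → P′ e ≡ P e)
    attached-choice guard =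
      case attach guard′ (record { valid = valid ; agree = agree ; keeps = λ _ _ → refl ; even = even }) of λ
        (P′ , st , att) → P′ , record { valid = State.valid st ; even = State.even st ; attached = att } , State.keeps st
      where
      open Prepared prep
      guard′ : ∀ {P′} → State P′ → ∀ {f x y} → far f ≡ false → Joins (P′ f) x y → ¬ Attached P′ x →
               (¬ Hub x × ¬ Blocked x) ⊎ (¬ Hub y × ¬ Blocked y)
      guard′ st {f} {x} {y} nf j dx = case blocked? x of λ
        { (no ¬b) → inj₁ ((λ hub → dx (x , hub , stop)) , ¬b)
        ; (yes b) → inj₂ ((λ hub → dy (y , hub , stop)) , guard st nf j (proj₂ (proj₂ val)) (proj₁ val) (proj₁ (proj₂ val)) dx dy b) }
        where
        val : Valid (tri f) (x , y)
        val = Valid-Joins {T = tri f} (State.valid st f) j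
        dy : ¬ Attached _ y
        dy (h , hub , r) = dx (h , hub , step f j r)

  joins-hub : ∀ {p h c} → Hub h → Joins p h c → Hub (proj₁ p) ⊎ Hub (proj₂ p)
  joins-hub hub (inj₁ refl) = inj₁ hub
  joins-hub hub (inj₂ refl) = inj₂ hub

  two : Fin m → Fin m → Fin m → Bool
  two a b e = e == a ∨ e == b

  two-true : ∀ {a b e} → two a b e ≡ true → e ≡ a ⊎ e ≡ b
  two-true {a} {b} {e} eq with e ≟ a | e ≟ b
  ... | yes p | _ = inj₁ p
  ... | no _ | yes p = inj₂ p
  two-true () | no _ | no _

  two-false : ∀ {a b e} → e ≢ a → e ≢ b → two a b e ≡ false
  two-false na nb rewrite ==-≢ na | ==-≢ nb = refl

  two-fst : ∀ a b → two a b a ≡ true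
  two-fst a b rewrite ==-refl a = refl

  two-snd : ∀ a b → two a b b ≡ true
  two-snd a b with b ≟ a
  ... | yes _ = refl
  ... | no _ = dec-true (b ≟ b) refl

  module _ (G : FarGraph) {P : Graph n m} (prep : Prepared G P) {e₀ e₁ : Fin m} (ne : e₀ ≢ e₁) {c₀ c₁ : Fin n}
           (t₀ : Comprises (tri e₀) v q c₀) (t₁ : Comprises (tri e₁) v q c₁) where

    private
      Third : Fin n → Set
      Third y = y ≡ c₀ ⊎ y ≡ c₁

      third? : ∀ y → Dec (Third y)
      third? y = (y ≟ c₀) ⊎-dec (y ≟ c₁)

      unblocked : ∀ {y g} → ¬ Hub y → ¬ Third y → y ∈ₜ tri g → two e₀ e₁ g ≡ false
      unblocked {y} {g} ¬hub ¬b y∈ = two-false {e₀} {e₁} {g}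
        (λ { refl → case Comprises.only t₀ y∈ of λ { (inj₁ p) → ¬hub (inj₁ p) ; (inj₂ (inj₁ p)) → ¬hub (inj₂ p) ; (inj₂ (inj₂ p)) → ¬b (inj₁ p) } })
        (λ { refl → case Comprises.only t₁ y∈ of λ { (inj₁ p) → ¬hub (inj₁ p) ; (inj₂ (inj₁ p)) → ¬hub (inj₂ p) ; (inj₂ (inj₂ p)) → ¬b (inj₂ p) } })

    -- The pair at `e₀` is the link, and the pair at `e₁` is moved between the hubs when their
    -- degrees are odd. While both are fixed, `c₁` is attached by its own pair, so `c₀` is the only
    -- blocked vertex that can be detached.
    link-and-pick : Joins (P e₀) v q → ∀ {h} → Hub h → Joins (P e₁) h c₁ → Eulerian tri
    link-and-pick j₀ {h} hub j₁ = case attached-choice guard of λ (P′ , near , keeps) →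
        finish-swap near e₁ t₁ hub (subst (λ p → Joins p h c₁) (sym (keeps e₁ (two-snd e₀ e₁))) j₁)
          λ P″ same → edge-reach e₀ (subst (λ p → Joins p v q) (sym (trans (same ne) (keeps e₀ (two-fst e₀ e₁)))) j₀)
      where
      fixed-hub : ∀ e → two e₀ e₁ e ≡ true → Hub (proj₁ (P e)) ⊎ Hub (proj₂ (P e))
      fixed-hub e eq = case two-true {e₀} {e₁} {e} eq of λ { (inj₁ refl) → joins-hub (inj₁ refl) j₀ ; (inj₂ refl) → joins-hub hub j₁ }
      open Attaching G prep (two e₀ e₁) fixed-hub Third third? unblocked
      guard : ∀ {P′} → State P′ → ∀ {f x y} → far f ≡ false → Joins (P′ f) x y → x ≢ y → x ∈ₜ tri f → y ∈ₜ tri f →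
              ¬ Attached P′ x → ¬ Attached P′ y → Third x → ¬ Third y
      guard {P′} st _ _ x≢y _ _ dx dy bx by = case bx , by of λ
        { (inj₂ refl , _) → dx att ; (inj₁ refl , inj₂ refl) → dy att ; (inj₁ refl , inj₁ refl) → x≢y refl }
        where
        att : Attached P′ c₁
        att = h , hub , edge-reach e₁ (Joins-sym (subst (λ p → Joins p h c₁) (sym (State.keeps st e₁ (two-snd e₀ e₁))) j₁))

    double-link : c₀ ≡ c₁ → Joins (P e₀) v q → Joins (P e₁) v q → Eulerian tri
    double-link refl j₀ j₁ = case attached-choice guard of λ (P′ , near , keeps) →
        finish-double near e₀ e₁ ne t₀ t₁ (subst (λ p → Joins p v q) (sym (keeps e₀ (two-fst e₀ e₁))) j₀)
                                          (subst (λ p → Joins p v q) (sym (keeps e₁ (two-snd e₀ e₁))) j₁)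
      where
      fixed-hub : ∀ e → two e₀ e₁ e ≡ true → Hub (proj₁ (P e)) ⊎ Hub (proj₂ (P e))
      fixed-hub e eq = case two-true {e₀} {e₁} {e} eq of λ { (inj₁ refl) → joins-hub (inj₁ refl) j₀ ; (inj₂ refl) → joins-hub (inj₁ refl) j₁ }
      open Attaching G prep (two e₀ e₁) fixed-hub Third third? unblocked
      guard : ∀ {P′} → State P′ → ∀ {f x y} → far f ≡ false → Joins (P′ f) x y → x ≢ y → x ∈ₜ tri f → y ∈ₜ tri f →
              ¬ Attached P′ x → ¬ Attached P′ y → Third x → ¬ Third y
      guard _ _ _ x≢y _ _ _ _ bx by = x≢y (trans ([ id , id ]′ bx) (sym ([ id , id ]′ by)))

  module Assemble (G : FarGraph) {D : Fin n → Set} (D? : ∀ x → Dec (D x)) (D-in : ∀ {x} → D x → In x)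
                  (own : Fin n → Fin m) (h r : Fin n → Fin n) (hub : ∀ {x} → D x → Hub (h x))
                  (shape : ∀ {x} → D x → Comprises (tri (own x)) x (h x) (r x))
                  (injective : ∀ {x y} → D x → D y → own x ≡ own y → x ≡ y) where

    open FarGraph G
    open Repair D? (proj₂ ∘ D-in) own h r hub shape injective public

    owned-near : ∀ {e} → Owned e → far e ≡ false
    owned-near {e} (x , d , refl) = hub⇒near e (hub d) (Comprises.∈₂ (shape d))

    record Base (P : Graph n m) : Set where
      field
        valid  : AllValid tri P
        agree  : ∀ e → far e ≡ true → P e ≡ Q e
        at-own : ∀ {x} → D x → P (own x) ≡ base x

    based : Base (assign base total)
    based = record
      { valid = assign-valid base total base-valid total-valid
      ; agree = λ e fe → trans (assign-free base total λ o → true≢false (trans (sym fe) (owned-near o))) (total-far e fe)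
      ; at-own = assign-own base total }

    -- Prescribing precedes the repair, which reads the degrees afterwards. The prescribed pair may
    -- therefore spoil any vertex of `D`.
    prescribe : ∀ {P e p} → Base P → ¬ Owned e → far e ≡ false → Valid (tri e) p → Base (P [ e ≔ p ])
    prescribe {P} {e} b ¬o ne val = record
      { valid = valid-≔ tri e (Base.valid b) val
      ; agree = λ i fi → trans (≔-other P λ { refl → true≢false (trans (sym fi) ne) }) (Base.agree b i fi)
      ; at-own = λ {x} d → trans (≔-other P λ eq → ¬o (x , d , eq)) (Base.at-own b d) }

    module _ {P : Graph n m} (b : Base P) where
      final : Graph n m
      final = R P (Base.at-own b)

      prepared : (∀ u → ¬ Hub u → ¬ D u → deg P u ≡ false) → Prepared G final
      prepared off = record
        { valid = assign-valid (repaired P) P (repaired-valid P) (Base.valid b)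
        ; agree = λ e fe → trans (assign-free (repaired P) P λ o → true≢false (trans (sym fe) (owned-near o))) (Base.agree b e fe)
        ; even = λ u ¬hub → case D? u of λ
            { (yes d) → even-D P (Base.at-own b) d
            ; (no ¬d) → trans (same-off-D P (Base.at-own b) ¬d ¬hub) (off u ¬hub ¬d) } }

      final-own : ∀ {x} → D x → final (own x) ≡ repaired P x
      final-own = assign-own (repaired P) P

      final-free : ∀ {e} → ¬ Owned e → final e ≡ P e
      final-free = assign-free (repaired P) P

-- Two triples sharing a pair

module SharedPair {n m} (tri : Fin m → Triple n) (cover : PairCovering tri) {e₀ e₁ : Fin m} (e₀≢e₁ : e₀ ≢ e₁)
                  {v q c₀ c₁ : Fin n} (t₀ : Comprises (tri e₀) v q c₀) (t₁ : Comprises (tri e₁) v q c₁) where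

  private
    module T₀ = Comprises t₀
    module T₁ = Comprises t₁

  open TwoHubs tri cover v q T₀.1≢2 (e₀ , T₀.∈₁) (e₀ , T₀.∈₂)

  in₀ : In c₀
  in₀ = (e₀ , T₀.∈₃) , λ { (inj₁ p) → T₀.1≢3 (sym p) ; (inj₂ p) → T₀.2≢3 (sym p) }

  in₁ : In c₁
  in₁ = (e₁ , T₁.∈₃) , λ { (inj₁ p) → T₁.1≢3 (sym p) ; (inj₂ p) → T₁.2≢3 (sym p) }

  third-only : ∀ {e c x} → Comprises (tri e) v q c → In x → x ∈ₜ tri e → x ≡ c
  third-only t i x∈ = case Comprises.only t x∈ of λ
    { (inj₁ p) → ⊥-elim (proj₂ i (inj₁ p)) ; (inj₂ (inj₁ p)) → ⊥-elim (proj₂ i (inj₂ p)) ; (inj₂ (inj₂ p)) → p }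

  -- The zero weight permits every exchange; in these cases the degrees in the far triples need no
  -- control.
  no-constraint : FarGraph
  no-constraint = Weighted.far-graph (λ _ → false)

  off-In : ∀ {P} → AllValid tri P → ∀ u → ¬ Hub u → ¬ In u → deg P u ≡ false
  off-In val u ¬hub ¬in = not-occurring-even val λ o → ¬in (o , ¬hub)

  -- Both triples have the third vertex c₀: one of them stays a link, the other is owned by c₀.
  equal-thirds : c₀ ≡ c₁ → Eulerian tri
  equal-thirds refl = case C.colours c₀ of λ (c , eq) → Given.result c eq no-constraint
   where
   module C = Choose e₀ in₀ in₀ e₀ e₀ e₀ T₀.∈₃ T₀.∈₁ T₀.∈₃ T₀.∈₂ T₀.∈₃ T₀.∈₁ T₀.∈₂
   module Given (colour : Colouring T₀.1≢2 C.A C.B C.A-∈ C.A-v C.B-∈) (c₀-true : Colouring.col colour c₀ ≡ true) (G : FarGraph) where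
    open C.Coloured colour
    open Assemble G in? id own hub-of rest hub-of-in shape injective
    own₀ : own c₀ ≡ e₀
    own₀ = trans own-c₀ (if-true c₀-true)
    free₁ : ¬ Owned e₁
    free₁ (x , i , eq) = e₀≢e₁ (trans (sym own₀) (trans (cong own (sym (third-only t₁ i (subst (λ e → x ∈ₜ tri e) eq (own-∈ i))))) eq))
    b : Base _
    b = prescribe based free₁ (near-∈ (inj₁ T₁.∈₁)) (T₁.∈₁ , T₁.∈₂ , T₁.1≢2)
    P : Graph _ _
    P = assign base (FarGraph.total G) [ e₁ ≔ (v , q) ]
    prep : Prepared G (final b)
    prep = prepared b (off-In (Base.valid b))
    at₁ : Joins (final b e₁) v q
    at₁ = inj₁ (trans (final-free b free₁) (≔-same (assign base (FarGraph.total G)) e₁))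
    shape₀ : Comprises (tri e₀) c₀ (hub-of c₀) (rest c₀)
    shape₀ = subst (λ e → Comprises (tri e) c₀ (hub-of c₀) (rest c₀)) own₀ (shape in₀)
    at₀ : final b e₀ ≡ repaired P c₀
    at₀ = trans (cong (final b) (sym own₀)) (final-own b in₀)
    result : Eulerian tri
    result = split (deg P c₀) refl
      where
      -- If `c₀` is odd, its repair turns `e₀` into a movable pair of `c₀` with a hub, beside the
      -- link at `e₁`. If it is even, `e₀` keeps its base pair and both triples carry vq.
      split : ∀ d → deg P c₀ ≡ d → Eulerian tri
      split true eq = link-and-pick G prep (e₀≢e₁ ∘ sym) t₁ t₀ at₁ (rest-hub t₀ shape₀) (inj₂ (trans at₀ (if-true eq)))
      split false eq = double-link G prep e₀≢e₁ t₀ t₁ refl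
            (subst (λ p → Joins p v q) (sym (trans at₀ (if-false eq))) (base-link t₀ shape₀ (hub-of-hub c₀))) at₁

  -- c₀ owns a second triple g through v, so e₀ can be chosen opposite to what c₁ makes of e₁.
  spare-triple : c₀ ≢ c₁ → ∀ {g} → g ≢ e₀ → c₀ ∈ₜ tri g → v ∈ₜ tri g → Eulerian tri
  spare-triple c₀≢c₁ {g} g≢e₀ c₀∈g v∈g = case C.colours c₀ of λ (c , eq) → Given.result c eq no-constraint
   where
   module C = Choose e₀ in₀ in₁ g e₀ e₁ c₀∈g v∈g T₀.∈₃ T₀.∈₂ T₁.∈₃ T₁.∈₁ T₁.∈₂
   module Given (colour : Colouring T₀.1≢2 C.A C.B C.A-∈ C.A-v C.B-∈) (c₀-true : Colouring.col colour c₀ ≡ true) (G : FarGraph) where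
    open C.Coloured colour
    open Assemble G in? id own hub-of rest hub-of-in shape injective
    own₀ : own c₀ ≡ g
    own₀ = trans own-c₀ (if-true c₀-true)
    own₁ : own c₁ ≡ e₁
    own₁ = own-c₁ (c₀≢c₁ ∘ sym)
    free₀ : ¬ Owned e₀
    free₀ (x , i , eq) = g≢e₀ (trans (sym own₀) (trans (cong own (sym (third-only t₀ i (subst (λ e → x ∈ₜ tri e) eq (own-∈ i))))) eq))
    near₀ : far e₀ ≡ false
    near₀ = near-∈ (inj₁ T₀.∈₁)
    B₀ P P′ : Graph _ _
    B₀ = assign base (FarGraph.total G)
    P = B₀ [ e₀ ≔ (v , q) ]
    P′ = B₀ [ e₀ ≔ (v , c₀) ]
    b : Base P
    b = prescribe based free₀ near₀ (T₀.∈₁ , T₀.∈₂ , T₀.1≢2)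
    b′ : Base P′
    b′ = prescribe based free₀ near₀ (T₀.∈₁ , T₀.∈₃ , T₀.1≢3)
    shape₁ : Comprises (tri e₁) c₁ (hub-of c₁) (rest c₁)
    shape₁ = subst (λ e → Comprises (tri e) c₁ (hub-of c₁) (rest c₁)) own₁ (shape in₁)
    at₁ : ∀ {P} (b : Base P) → final b e₁ ≡ repaired P c₁
    at₁ b = trans (cong (final b) (sym own₁)) (final-own b in₁)
    -- The pair at `e₀` is chosen according to the parity of `c₁`. There is no circularity, as
    -- neither of the two possible pairs contains `c₁`.
    same-c₁ : deg P′ c₁ ≡ deg P c₁
    same-c₁ = trans (deg-≔ B₀ e₀ (v , c₀) c₁) (trans (cong (λ b → deg B₀ c₁ xor (row (B₀ e₀) c₁ xor b))
      (trans (row-off (T₁.1≢3 ∘ sym) (c₀≢c₁ ∘ sym)) (sym (row-off (T₁.1≢3 ∘ sym) (T₁.2≢3 ∘ sym))))) (sym (deg-≔ B₀ e₀ (v , q) c₁)))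
    result : Eulerian tri
    result = split (deg P c₁) refl
      where
      split : ∀ d → deg P c₁ ≡ d → Eulerian tri
      split true eq = link-and-pick G (prepared b (off-In (Base.valid b))) e₀≢e₁ t₀ t₁
            (inj₁ (trans (final-free b free₀) (≔-same B₀ e₀))) (rest-hub t₁ shape₁) (inj₂ (trans (at₁ b) (if-true eq)))
      split false eq = link-and-pick G (prepared b′ (off-In (Base.valid b′))) (e₀≢e₁ ∘ sym) t₁ t₀
            (subst (λ p → Joins p v q) (sym (trans (at₁ b′) (if-false (trans same-c₁ eq)))) (base-link t₁ shape₁ (hub-of-hub c₁)))
            (inj₁ refl) (inj₁ (trans (final-free b′ free₀) (≔-same B₀ e₀)))

  -- e₀ and e₁ are the only triples joining c₀ and c₁ to the hubs; the far triples are chosen so that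
  -- exactly one of c₀ and c₁ has odd degree in them.
  isolated-thirds : c₀ ≢ c₁ → (∀ {g} → c₀ ∈ₜ tri g → far g ≡ false → g ≡ e₀) → (∀ {g} → c₁ ∈ₜ tri g → far g ≡ false → g ≡ e₁) → Eulerian tri
  isolated-thirds c₀≢c₁ only₀ only₁ = case cover (e₀ , T₀.∈₃) (e₁ , T₁.∈₃) c₀≢c₁ of λ
      (g , c₀∈g , c₁∈g) → case third (tri g) c₀∈g c₁∈g c₀≢c₁ of λ (x , t) → case odd-far-graph g (far-g c₀∈g c₁∈g)
        (Comprises.∈₁ t , Comprises.∈₃ t , Comprises.1≢3 t) (c₀∈g , c₁∈g , c₀≢c₁)
        (cong₂ _xor_ Y₀ (Y-off (Comprises.1≢3 t ∘ sym) (Comprises.2≢3 t ∘ sym))) (cong₂ _xor_ Y₀ Y₁) of λ (G , odd) → with-far G odd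
    where
    -- The indicator of the two thirds. A triple through both of them is far, and its pairs differ
    -- in weight: c₀c₁ has weight zero, and `c₀` with the remaining vertex has weight one. So the
    -- sum of the two far degrees can be made odd.
    Y : Fin _ → Bool
    Y x = x == c₀ xor x == c₁
    Y₀ : Y c₀ ≡ true
    Y₀ = row-fst c₀≢c₁
    Y₁ : Y c₁ ≡ true
    Y₁ = row-snd c₀≢c₁
    Y-off : ∀ {x} → x ≢ c₀ → x ≢ c₁ → Y x ≡ false
    Y-off = row-off
    open Weighted Y
    far-g : ∀ {g} → c₀ ∈ₜ tri g → c₁ ∈ₜ tri g → far g ≡ true
    far-g {g} c₀∈ c₁∈ = ≢false⇒≡true λ near → c₀≢c₁ (sym (third-only t₀ in₁ (subst (λ e → c₁ ∈ₜ tri e) (only₀ c₀∈ near) c₁∈)))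
    module C = Choose e₀ in₀ in₁ e₀ e₀ e₁ T₀.∈₃ T₀.∈₁ T₀.∈₃ T₀.∈₂ T₁.∈₃ T₁.∈₁ T₁.∈₂
    module Given (colour : Colouring T₀.1≢2 C.A C.B C.A-∈ C.A-v C.B-∈) (c₀-true : Colouring.col colour c₀ ≡ true)
                 (G : FarGraph) (odd : ⨁ (λ x → Y x ∧ deg (FarGraph.Q G) x) ≡ true) where
      open C.Coloured colour
      own₀ : own c₀ ≡ e₀
      own₀ = trans own-c₀ (if-true c₀-true)
      own₁ : own c₁ ≡ e₁
      own₁ = own-c₁ (c₀≢c₁ ∘ sym)
      shape₀ : Comprises (tri e₀) c₀ (hub-of c₀) (rest c₀)
      shape₀ = subst (λ e → Comprises (tri e) c₀ (hub-of c₀) (rest c₀)) own₀ (shape in₀)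
      shape₁ : Comprises (tri e₁) c₁ (hub-of c₁) (rest c₁)
      shape₁ = subst (λ e → Comprises (tri e) c₁ (hub-of c₁) (rest c₁)) own₁ (shape in₁)
      open FarGraph G using (Q)
      open Assemble G in? id own hub-of rest hub-of-in shape injective
      P : Graph _ _
      P = assign base (FarGraph.total G)
      b : Base P
      b = based
      prep : Prepared G (final b)
      prep = prepared b (off-In (Base.valid b))
      at₀ : final b e₀ ≡ repaired P c₀
      at₀ = trans (cong (final b) (sym own₀)) (final-own b in₀)
      at₁ : final b e₁ ≡ repaired P c₁
      at₁ = trans (cong (final b) (sym own₁)) (final-own b in₁)
      -- The only near triple at `c` is the one it owns, and the base pair there avoids `c`.
      far-degree : ∀ {c e h r} → (∀ {g} → c ∈ₜ tri g → far g ≡ false → g ≡ e) → Comprises (tri e) c h r → P e ≡ (h , r) → deg P c ≡ deg Q c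
      far-degree {c} {e} only s at = trans (FarGraph.deg-far G (Base.agree b) c)
        (trans (cong (deg Q c xor_) (⨁-false pointwise)) (xor-identityʳ _))
        where
        pointwise : ∀ i → not (far i) ∧ row (P i) c ≡ false
        pointwise i with far i in fi
        ... | true = refl
        ... | false = ≢true⇒≡false λ inc → case only (valid-row {T = tri i} (Base.valid b i) inc) fi of λ
                { refl → true≢false (trans (sym inc) (trans (cong (λ p → row p c) at) (row-off (Comprises.1≢2 s) (Comprises.1≢3 s)))) }
      sum : deg P c₀ xor deg P c₁ ≡ true
      sum = trans (cong₂ _xor_ (far-degree only₀ shape₀ (trans (cong P (sym own₀)) (Base.at-own b in₀)))
                               (far-degree only₁ shape₁ (trans (cong P (sym own₁)) (Base.at-own b in₁))))
        (trans (sym (trans (⨁-cong (λ x → ∧-comm-xor (x == c₀) (x == c₁) (deg Q x)))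
                      (trans (⨁-xor (λ x → deg Q x ∧ x == c₀) (λ x → deg Q x ∧ x == c₁)) (cong₂ _xor_ (⨁-select (deg Q) c₀) (⨁-select (deg Q) c₁))))) odd)
        where
        ∧-comm-xor : ∀ a b d → (a xor b) ∧ d ≡ (d ∧ a) xor (d ∧ b)
        ∧-comm-xor true true true = refl
        ∧-comm-xor true true false = refl
        ∧-comm-xor true false true = refl
        ∧-comm-xor true false false = refl
        ∧-comm-xor false true true = refl
        ∧-comm-xor false true false = refl
        ∧-comm-xor false false true = refl
        ∧-comm-xor false false false = refl
      result : Eulerian tri
      result = split (deg P c₀) (deg P c₁) refl refl
        where
        -- The even one of `c₀`, `c₁` leaves vq as the link in its triple; the odd one is repaired
        -- by a movable pair with a hub.
        split : ∀ a b → deg P c₀ ≡ a → deg P c₁ ≡ b → Eulerian tri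
        split true true d₀ d₁ = ⊥-elim (true≢false (sym (trans (sym (cong₂ _xor_ d₀ d₁)) sum)))
        split false false d₀ d₁ = ⊥-elim (true≢false (sym (trans (sym (cong₂ _xor_ d₀ d₁)) sum)))
        split true false d₀ d₁ = link-and-pick G prep (e₀≢e₁ ∘ sym) t₁ t₀
          (subst (λ p → Joins p v q) (sym (trans at₁ (if-false d₁))) (base-link t₁ shape₁ (hub-of-hub c₁)))
          (rest-hub t₀ shape₀) (inj₂ (trans at₀ (if-true d₀)))
        split false true d₀ d₁ = link-and-pick G prep e₀≢e₁ t₀ t₁
          (subst (λ p → Joins p v q) (sym (trans at₀ (if-false d₀))) (base-link t₀ shape₀ (hub-of-hub c₀)))
          (rest-hub t₁ shape₁) (inj₂ (trans at₁ (if-true d₁)))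
    with-far : ∀ G → ⨁ (λ x → Y x ∧ deg (FarGraph.Q G) x) ≡ true → Eulerian tri
    with-far G odd = case C.colours c₀ of λ (c , eq) → Given.result c eq G odd

-- Two triples share at most one vertex

module Linear {n m} (tri : Fin m → Triple n) (cover : PairCovering tri)
              (linear : ∀ {e e′ x y} → x ≢ y → x ∈ₜ tri e → y ∈ₜ tri e → x ∈ₜ tri e′ → y ∈ₜ tri e′ → e ≡ e′)
              (e₀ : Fin m) {v q c₀ : Fin n} (t₀ : Comprises (tri e₀) v q c₀)
              {y₀ : Fin n} (o₀ : Occurs tri y₀) (y₀∉ : ¬ y₀ ∈ₜ tri e₀) where

  private
    module T₀ = Comprises t₀

  open TwoHubs tri cover v q T₀.1≢2 (e₀ , T₀.∈₁) (e₀ , T₀.∈₂)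

  in₀ : In c₀
  in₀ = (e₀ , T₀.∈₃) , λ { (inj₁ p) → T₀.1≢3 (sym p) ; (inj₂ p) → T₀.2≢3 (sym p) }

  c₀-near : ∀ {g} → c₀ ∈ₜ tri g → far g ≡ false → g ≡ e₀
  c₀-near c₀∈ near = case near-cases near of λ
    { (inj₁ v∈) → linear T₀.1≢3 v∈ c₀∈ T₀.∈₁ T₀.∈₃ ; (inj₂ q∈) → linear T₀.2≢3 q∈ c₀∈ T₀.∈₂ T₀.∈₃ }

  outside-e₀ : ∀ {x} → x ≢ c₀ → x ∈ₜ tri e₀ → ¬ Hub x → ⊥
  outside-e₀ ne x∈ ¬hub = case T₀.only x∈ of λ { (inj₁ p) → ¬hub (inj₁ p) ; (inj₂ (inj₁ p)) → ¬hub (inj₂ p) ; (inj₂ (inj₂ p)) → ne p }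

  -- Making `c₀` odd in the far triples forces its repair to put a pair of `c₀` with a hub into
  -- `e₀`; this is the pair that is finally moved between the hubs.
  open Weighted (_== c₀)

  module C = Choose e₀ in₀ in₀ e₀ e₀ e₀ T₀.∈₃ T₀.∈₁ T₀.∈₃ T₀.∈₂ T₀.∈₃ T₀.∈₁ T₀.∈₂
  open C using (A; B; A-∈; A-v; B-∈; B-q)

  A-only : ∀ {x e} → In x → x ∈ₜ tri e → v ∈ₜ tri e → A x ≡ e
  A-only i x∈ v∈ = linear (λ { refl → proj₂ i (inj₁ refl) }) (A-∈ i) (A-v i) x∈ v∈

  B-only : ∀ {x e} → In x → x ∈ₜ tri e → q ∈ₜ tri e → B x ≡ e
  B-only i x∈ q∈ = linear (λ { refl → proj₂ i (inj₂ refl) }) (B-∈ i) (B-q i) x∈ q∈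

  module Given (G : FarGraph) (odd-sum : ⨁ (λ x → (x == c₀) ∧ deg (FarGraph.Q G) x) ≡ true) where
    open FarGraph G using (Q)

    odd₀ : deg Q c₀ ≡ true
    odd₀ = trans (sym (⨁-select (deg Q) c₀)) (trans (⨁-cong (λ x → ∧-swap (deg Q x) (x == c₀))) odd-sum)
      where
      ∧-swap : ∀ a b → a ∧ b ≡ b ∧ a
      ∧-swap true true = refl
      ∧-swap true false = refl
      ∧-swap false true = refl
      ∧-swap false false = refl

    odd-far : ∀ {x} → deg Q x ≡ true → In x
    odd-far {x} odd with e , inc ← ⨁-true _ odd = at (far e) refl
      where
      at : ∀ b → far e ≡ b → In x
      at false fe = ⊥-elim (true≢false (trans (sym inc) (trans (cong (λ p → row p x) (FarGraph.loop G e fe)) (row-loop v x))))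
      at true fe = (e , x∈) , λ hub → true≢false (trans (sym fe) (hub⇒near e hub x∈))
        where
        x∈ : x ∈ₜ tri e
        x∈ = valid-row {T = tri e} (FarGraph.valid G e fe) inc

    Boundary : Fin n → Fin n → Set
    Boundary x y = In x × x ≢ c₀ × In y × y ≢ c₀ × (∃ λ e → Comprises (tri e) x v y) × deg Q x ≡ false × deg Q y ≡ true

    -- By linearity, the triples through `v` other than `e₀` match the occurring non-hubs other than
    -- `c₀` in pairs, which form `Star`. Without a boundary, matched vertices have equal far parity,
    -- so the set `S` of odd vertices other than `c₀` has even size. But the number of all odd
    -- vertices is even and `c₀` is one of them, so `S` has odd size.
    module Counting (none : ∀ {x y} → ¬ Boundary x y) where
      S : Fin n → Bool
      S x = deg Q x xor (deg Q x ∧ x == c₀)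

      S-true : ∀ {x} → S x ≡ true → In x × x ≢ c₀
      S-true {x} eq with deg Q x in dx | x ≟ c₀
      ... | true | no ne = odd-far dx , ne
      ... | true | yes _ = ⊥-elim (true≢false (sym eq))
      ... | false | _ = ⊥-elim (true≢false (sym eq))

      S-other : ∀ {x} → x ≢ c₀ → S x ≡ deg Q x
      S-other {x} ne rewrite ==-≢ ne = at (deg Q x)
        where
        at : ∀ d → d xor (d ∧ false) ≡ d
        at true = refl
        at false = refl

      others : ∀ e → v ∈ₜ tri e → ∃₂ λ s t → Comprises (tri e) s v t
      others e v∈ with v ≟ Triple.v₁ (tri e)
      ... | no ne = _ , third (tri e) (inj₁ refl) v∈ (ne ∘ sym)
      ... | yes refl = _ , third (tri e) (inj₂ (inj₁ refl)) v∈ (Triple.≢₁₂ (tri e) ∘ sym)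

      star? : ∀ e → Dec (v ∈ₜ tri e × e ≢ e₀)
      star? e = (v ∈ₜ? tri e) ×-dec ¬? (e ≟ e₀)

      Star : Graph n m
      Star e with star? e
      ... | yes (v∈ , _) = proj₁ (others e v∈) , proj₁ (proj₂ (others e v∈))
      ... | no _ = v , v

      outside : ∀ {e x} → e ≢ e₀ → v ∈ₜ tri e → x ∈ₜ tri e → x ≢ v → In x × x ≢ c₀
      outside {e} ne v∈ x∈ x≢v = ((e , x∈) , λ
          { (inj₁ p) → x≢v p ; (inj₂ refl) → ne (linear T₀.1≢2 v∈ x∈ T₀.∈₁ T₀.∈₂) })
        , λ { refl → ne (linear T₀.1≢3 v∈ x∈ T₀.∈₁ T₀.∈₃) }

      balanced : ∀ {e s t} → e ≢ e₀ → Comprises (tri e) s v t → S s ≡ S t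
      balanced {e} {s} {t} ne c = trans (S-other (proj₂ s′)) (trans (same (deg Q s) (deg Q t) refl refl) (sym (S-other (proj₂ t′))))
        where
        open Comprises c
        s′ = outside ne ∈₂ ∈₁ 1≢2
        t′ = outside ne ∈₂ ∈₃ (2≢3 ∘ sym)
        same : ∀ a b → deg Q s ≡ a → deg Q t ≡ b → a ≡ b
        same true true _ _ = refl
        same false false _ _ = refl
        same false true p r = ⊥-elim (none (proj₁ s′ , proj₂ s′ , proj₁ t′ , proj₂ t′ , (e , c) , p , r))
        same true false p r = ⊥-elim (none (proj₁ t′ , proj₂ t′ , proj₁ s′ , proj₂ s′ ,
          (e , Comprises-213 (Comprises-132 (Comprises-213 c))) , r , p))

      closed : ∀ e → S (proj₁ (Star e)) xor S (proj₂ (Star e)) ≡ false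
      closed e with star? e
      ... | yes (v∈ , ne) = cancel (balanced {e} {proj₁ (others e v∈)} {proj₁ (proj₂ (others e v∈))} ne (proj₂ (proj₂ (others e v∈))))
        where
        cancel : ∀ {a b} → a ≡ b → a xor b ≡ false
        cancel {a} refl = xor-same a
      ... | no _ = xor-same (S v)

      deg-Star : ∀ {x} → In x → x ≢ c₀ → deg Star x ≡ true
      deg-Star {x} i x≢c₀ = trans (⨁-single _ (A x) off) on
        where
        off : ∀ e → e ≢ A x → row (Star e) x ≡ false
        off e ne with star? e
        ... | no _ = row-loop v x
        ... | yes (v∈ , _) = row-off (λ p → ne (sym (A-only i (subst (_∈ₜ tri e) (sym p) (Comprises.∈₁ c)) v∈))) (λ p → ne (sym (A-only i (subst (_∈ₜ tri e) (sym p) (Comprises.∈₃ c)) v∈)))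
          where c = proj₂ (proj₂ (others e v∈))
        on : row (Star (A x)) x ≡ true
        on with star? (A x)
        ... | no ¬s = ⊥-elim (¬s (A-v i , λ eq → outside-e₀ x≢c₀ (subst (λ e → x ∈ₜ tri e) eq (A-∈ i)) (proj₂ i)))
        ... | yes (v∈ , _) = case Comprises.only c (A-∈ i) of λ
            { (inj₁ p) → trans (cong (row _) p) (row-fst (Comprises.1≢3 c))
            ; (inj₂ (inj₁ p)) → ⊥-elim (proj₂ i (inj₁ p))
            ; (inj₂ (inj₂ p)) → trans (cong (row _) p) (row-snd (Comprises.1≢3 c)) }
          where c = proj₂ (proj₂ (others (A x) v∈))

      even-S : ⨁ S ≡ false
      even-S = trans (⨁-cong pointwise) (trans (deg-sum Star S) (⨁-false closed))
        where
        pointwise : ∀ x → S x ≡ S x ∧ deg Star x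
        pointwise x = at (S x) refl
          where
          at : ∀ b → S x ≡ b → b ≡ b ∧ deg Star x
          at false _ = refl
          at true eq = sym (deg-Star (proj₁ (S-true {x} eq)) (proj₂ (S-true {x} eq)))

      odd-S : ⨁ S ≡ true
      odd-S = trans (⨁-xor (deg Q) (λ x → deg Q x ∧ x == c₀))
        (cong₂ _xor_ (trans (deg-sum Q (λ _ → true)) (⨁-false {m} {λ _ → false} (λ _ → refl))) (trans (⨁-select (deg Q) c₀) odd₀))

      contradiction : ⊥
      contradiction = true≢false (trans (sym odd-S) even-S)

    boundary? : ∀ x y → Dec (Boundary x y)
    boundary? x y = in? x ×-dec ¬? (x ≟ c₀) ×-dec in? y ×-dec ¬? (y ≟ c₀) ×-dec any? complete? ×-dec (deg Q x ≟ᵇ false) ×-dec (deg Q y ≟ᵇ true)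
      where
      complete? : ∀ e → Dec (Comprises (tri e) x v y)
      complete? e with x ∈ₜ? tri e | v ∈ₜ? tri e | x ≟ v
      ... | no ¬a | _ | _ = no (¬a ∘ Comprises.∈₁)
      ... | yes _ | no ¬b | _ = no (¬b ∘ Comprises.∈₂)
      ... | yes _ | yes _ | yes eq = no λ c → Comprises.1≢2 c eq
      ... | yes a | yes b | no ne with third (tri e) a b ne
      ...   | w , c with w ≟ y
      ...     | yes refl = yes c
      ...     | no w≢y = no λ d → w≢y (Comprises-unique c d)

    boundary : ∃₂ Boundary
    boundary = case any? (λ x → any? (boundary? x)) of λ
      { (yes (x , y , b)) → x , y , b
      ; (no none) → ⊥-elim (Counting.contradiction λ b → none (_ , _ , b)) }

    -- The vertex z is joined to both hubs and so links them.  Its neighbour b through v, being odd, gets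
    -- its pair from the other triple that joins it to a hub.
    module AtBoundary {z b : Fin n} (in-z : In z) (z≢c₀ : z ≢ c₀) (in-b : In b) (b≢c₀ : b ≢ c₀)
                      {ev eq′ eb : Fin m} {a u : Fin n} (tv : Comprises (tri ev) z v b)
                      (tq : Comprises (tri eq′) z q a) (tb : Comprises (tri eb) b q u) (even-z : deg Q z ≡ false) (odd-b : deg Q b ≡ true)
                      (colour : Colouring T₀.1≢2 A B A-∈ A-v B-∈) (b-true : Colouring.col colour b ≡ true) where
      open C.Coloured colour
      module V = Comprises tv
      module W = Comprises tq
      module U = Comprises tb

      no-both : ∀ {e x} → In x → x ≢ c₀ → x ∈ₜ tri e → v ∈ₜ tri e → q ∈ₜ tri e → ⊥
      no-both i ne x∈ v∈ q∈ = outside-e₀ ne (subst (λ e → _ ∈ₜ tri e) (linear T₀.1≢2 v∈ q∈ T₀.∈₁ T₀.∈₂) x∈) (proj₂ i)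

      Az : A z ≡ ev
      Az = A-only in-z V.∈₁ V.∈₂
      Ab : A b ≡ ev
      Ab = A-only in-b V.∈₃ V.∈₂
      own-b : own b ≡ ev
      own-b = trans (if-true b-true) Ab
      z-false : col z ≡ false
      z-false = trans (≢⇒not (separateᴬ in-z in-b V.1≢3 (trans Az (sym Ab)))) (cong not b-true)
      own-z : own z ≡ eq′
      own-z = trans (if-false z-false) (B-only in-z W.∈₁ W.∈₂)
      z∈eq : z ∈ₜ tri eq′
      z∈eq = W.∈₁
      q∈eq : q ∈ₜ tri eq′
      q∈eq = W.∈₂
      ev≢eq : ev ≢ eq′
      ev≢eq eq = no-both in-z z≢c₀ V.∈₁ V.∈₂ (subst (λ e → q ∈ₜ tri e) (sym eq) q∈eq)
      b∉eq : ¬ b ∈ₜ tri eq′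
      b∉eq b∈ = ev≢eq (linear V.1≢3 V.∈₁ V.∈₃ z∈eq b∈)

      -- The triples `ev` and `eq′`, owned by `b` and `z`, are given up to carry the link, so `z`
      -- and `b` cannot be repaired and must come out even by themselves.
      D : Fin n → Set
      D x = In x × x ≢ z × x ≢ b
      D? : ∀ x → Dec (D x)
      D? x = in? x ×-dec ¬? (x ≟ z) ×-dec ¬? (x ≟ b)

      D-injective : ∀ {x y} → D x → D y → own x ≡ own y → x ≡ y
      D-injective d d′ = injective (proj₁ d) (proj₁ d′)

      open Assemble G D? proj₁ own hub-of rest (hub-of-in ∘ proj₁) (shape ∘ proj₁) D-injective

      free-v : ¬ Owned ev
      free-v (x , (i , _ , x≢b) , eq) = x≢b (injective i in-b (trans eq (sym own-b)))
      free-q : ¬ Owned eq′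
      free-q (x , (i , x≢z , _) , eq) = x≢z (injective i in-z (trans eq (sym own-z)))
      B₀ P₁ P : Graph n m
      B₀ = assign base (FarGraph.total G)
      P₁ = B₀ [ ev ≔ (v , z) ]
      P = P₁ [ eq′ ≔ (q , z) ]
      bs : Base P
      bs = prescribe (prescribe based free-v (near-∈ (inj₁ V.∈₂)) (V.∈₂ , V.∈₁ , V.1≢2 ∘ sym)) free-q (near-∈ (inj₂ q∈eq)) (q∈eq , z∈eq , W.1≢2 ∘ sym)
      P-q : P eq′ ≡ (q , z)
      P-q = ≔-same P₁ eq′
      P-v : P ev ≡ (v , z)
      P-v = trans (≔-other P₁ ev≢eq) (≔-same B₀ ev)

      near-sum : ∀ x (f : Fin m → Bool) → (∀ e → far e ≡ true → f e ≡ false) → (∀ e → far e ≡ false → row (P e) x ≡ f e) →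
                 deg P x ≡ deg Q x xor ⨁ f
      near-sum x f fF nF = trans (FarGraph.deg-far G (Base.agree bs) x) (cong (deg Q x xor_) (⨁-cong λ e → at e (far e) refl))
        where
        at : ∀ e d → far e ≡ d → not (far e) ∧ row (P e) x ≡ f e
        at e true fe rewrite fe = sym (fF e fe)
        at e false fe rewrite fe = nF e fe

      row-out : ∀ {x} e → ¬ x ∈ₜ tri e → row (P e) x ≡ false
      row-out e x∉ = ≢true⇒≡false λ inc → x∉ (valid-row {T = tri e} (Base.valid bs e) inc)

      single : (e : Fin m) → ⨁ (_== e) ≡ true
      single e = trans (⨁-single (_== e) e (λ _ → ==-≢)) (==-refl e)

      far-≢ : ∀ {e g} → far e ≡ true → far g ≡ false → e == g ≡ false
      far-≢ {e} {g} fe fg = ==-≢ {x = e} {g} λ { refl → true≢false (trans (sym fe) fg) }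

      near-v : far ev ≡ false
      near-v = near-∈ (inj₁ V.∈₂)
      near-q : far eq′ ≡ false
      near-q = near-∈ (inj₂ q∈eq)

      -- The only near triples at `z` are `ev` and `eq′`, and both prescribed pairs contain `z`;
      -- they leave its even far degree even.
      even-at-z : deg P z ≡ false
      even-at-z = trans (near-sum z (λ e → e == ev xor e == eq′)
          (λ e fe → cong₂ _xor_ (far-≢ fe near-v) (far-≢ fe near-q)) at)
        (cong₂ _xor_ even-z (trans (⨁-xor (_== ev) (_== eq′)) (cong₂ _xor_ (single ev) (single eq′))))
        where
        at : ∀ e → far e ≡ false → row (P e) z ≡ e == ev xor e == eq′
        at e ne = case e ≟ ev of λ
          { (yes refl) → trans (cong (λ p → row p z) P-v) (trans (row-snd (V.1≢2 ∘ sym)) (sym (cong₂ _xor_ (==-refl ev) (==-≢ ev≢eq))))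
          ; (no n₁) → case e ≟ eq′ of λ
            { (yes refl) → trans (cong (λ p → row p z) P-q) (trans (row-snd (W.1≢2 ∘ sym)) (sym (cong₂ _xor_ (==-≢ n₁) (==-refl eq′))))
            ; (no n₂) → trans (row-out e λ z∈ → case near-cases ne of λ
                { (inj₁ v∈) → n₁ (linear V.1≢2 z∈ v∈ V.∈₁ V.∈₂) ; (inj₂ q∈) → n₂ (linear W.1≢2 z∈ q∈ W.∈₁ W.∈₂) })
                (sym (cong₂ _xor_ (==-≢ n₁) (==-≢ n₂))) } }

      b∈eb : b ∈ₜ tri eb
      b∈eb = U.∈₁
      q∈eb : q ∈ₜ tri eb
      q∈eb = U.∈₂
      ev≢eb : ev ≢ eb
      ev≢eb eq = no-both in-b b≢c₀ V.∈₃ V.∈₂ (subst (λ e → q ∈ₜ tri e) (sym eq) q∈eb)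
      in-u : In u
      in-u = (eb , U.∈₃) , λ { (inj₁ p) → no-both in-b b≢c₀ b∈eb (subst (_∈ₜ tri eb) p U.∈₃) q∈eb ; (inj₂ p) → U.2≢3 (sym p) }
      -- The vertex `u` competes with `b` for `eb` and so has the other colour, which makes it the
      -- owner of `eb`. The base pair there is qb, the one near pair at `b`, and it evens out the
      -- odd far degree of `b`.
      D-u : D u
      D-u = in-u , (λ { refl → ev≢eb (linear V.1≢3 V.∈₁ V.∈₃ U.∈₃ b∈eb) }) , (U.1≢3 ∘ sym)
      Bu : B u ≡ eb
      Bu = B-only in-u U.∈₃ q∈eb
      u-false : col u ≡ false
      u-false = trans (≢⇒not (separateᴮ in-u in-b (U.1≢3 ∘ sym) (trans Bu (sym (B-only in-b b∈eb q∈eb))))) (cong not b-true)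
      own-u : own u ≡ eb
      own-u = trans (if-false u-false) Bu
      hub-u : hub-of u ≡ q
      hub-u = if-false u-false
      rest-u : rest u ≡ b
      rest-u = Comprises-unique (subst₂ (λ e h → Comprises (tri e) u h (rest u)) own-u hub-u (shape in-u))
                 (Comprises-213 (Comprises-132 (Comprises-213 tb)))
      P-b : P eb ≡ (q , b)
      P-b = trans (cong P (sym own-u)) (trans (Base.at-own bs D-u) (cong₂ _,_ hub-u rest-u))

      even-at-b : deg P b ≡ false
      even-at-b = trans (near-sum b (_== eb) (λ e fe → far-≢ fe (near-∈ (inj₂ q∈eb))) at) (cong₂ _xor_ odd-b (single eb))
        where
        at : ∀ e → far e ≡ false → row (P e) b ≡ e == eb
        at e ne = case e ≟ eb of λ
          { (yes refl) → trans (cong (λ p → row p b) P-b) (trans (row-snd (U.1≢2 ∘ sym)) (sym (==-refl eb)))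
          ; (no n₁) → trans (case e ≟ ev of λ
            { (yes refl) → trans (cong (λ p → row p b) P-v) (row-off (V.2≢3 ∘ sym) (V.1≢3 ∘ sym))
            ; (no n₂) → row-out e λ b∈ → case near-cases ne of λ
                { (inj₁ v∈) → n₂ (linear V.2≢3 v∈ b∈ V.∈₂ V.∈₃) ; (inj₂ q∈) → n₁ (linear U.1≢2 b∈ q∈ U.∈₁ U.∈₂) } }) (sym (==-≢ n₁)) }

      off-D : ∀ x → ¬ Hub x → ¬ D x → deg P x ≡ false
      off-D x ¬hub ¬d = case x ≟ z of λ
        { (yes refl) → even-at-z
        ; (no x≢z) → case x ≟ b of λ
          { (yes refl) → even-at-b
          ; (no x≢b) → not-occurring-even (Base.valid bs) λ o → ¬d ((o , ¬hub) , x≢z , x≢b) } }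

      prep : Prepared G (final bs)
      prep = prepared bs off-D

      D-c₀ : D c₀
      D-c₀ = in₀ , (z≢c₀ ∘ sym) , (b≢c₀ ∘ sym)
      own₀ : own c₀ ≡ e₀
      own₀ = trans own-c₀ (same (col c₀))
        where
        same : ∀ b → (if b then e₀ else e₀) ≡ e₀
        same true = refl
        same false = refl
      shape₀ : Comprises (tri e₀) c₀ (hub-of c₀) (rest c₀)
      shape₀ = subst (λ e → Comprises (tri e) c₀ (hub-of c₀) (rest c₀)) own₀ (shape in₀)
      odd-c₀ : deg P c₀ ≡ true
      odd-c₀ = trans (near-sum c₀ (λ _ → false) (λ _ _ → refl) at) (trans (cong₂ _xor_ odd₀ (⨁-false {f = λ (_ : Fin m) → false} (λ _ → refl))) refl)
        where
        at : ∀ e → far e ≡ false → row (P e) c₀ ≡ false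
        at e ne = ≢true⇒≡false λ inc → case c₀-near (valid-row {T = tri e} (Base.valid bs e) inc) ne of λ
          { refl → true≢false (trans (sym inc) (trans (cong (λ p → row p c₀) (trans (cong P (sym own₀)) (Base.at-own bs D-c₀)))
                     (row-off (Comprises.1≢2 shape₀) (Comprises.1≢3 shape₀)))) }
      F : Graph n m
      F = final bs
      F₀ : Joins (F e₀) (rest c₀) c₀
      F₀ = inj₂ (trans (cong F (sym own₀)) (trans (final-own bs D-c₀) (if-true odd-c₀)))
      hub₀ : Hub (rest c₀)
      hub₀ = rest-hub t₀ shape₀
      F-v : F ev ≡ (v , z)
      F-v = trans (final-free bs free-v) P-v
      F-q : F eq′ ≡ (q , z)
      F-q = trans (final-free bs free-q) P-q

      fixed : Fin m → Bool
      fixed e = e == e₀ ∨ two ev eq′ e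

      fixed-cases : ∀ e → fixed e ≡ true → e ≡ e₀ ⊎ e ≡ ev ⊎ e ≡ eq′
      fixed-cases e eq with e ≟ e₀
      ... | yes p = inj₁ p
      ... | no _ = inj₂ (two-true {ev} {eq′} {e} eq)

      fixed-false : ∀ {e} → e ≢ e₀ → e ≢ ev → e ≢ eq′ → fixed e ≡ false
      fixed-false {e} n₀ n₁ n₂ rewrite ==-≢ n₀ = two-false {ev} {eq′} {e} n₁ n₂

      fixed₀ : fixed e₀ ≡ true
      fixed₀ rewrite ==-refl e₀ = refl
      ∨-right : ∀ x {y} → y ≡ true → x ∨ y ≡ true
      ∨-right true  _  = refl
      ∨-right false eq = eq
      fixed-v : fixed ev ≡ true
      fixed-v = ∨-right (ev == e₀) (two-fst ev eq′)
      fixed-q : fixed eq′ ≡ true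
      fixed-q = ∨-right (eq′ == e₀) (two-snd ev eq′)

      -- The fixed pairs attach `c₀` and `z`, so only `a` and `b` can be both blocked and detached.
      -- By linearity no near triple contains these two, as `not-ab` shows.
      Blocked : Fin n → Set
      Blocked x = x ≡ c₀ ⊎ x ≡ z ⊎ x ≡ a ⊎ x ≡ b

      unblocked : ∀ {y g} → ¬ Hub y → ¬ Blocked y → y ∈ₜ tri g → fixed g ≡ false
      unblocked {y} {g} ¬hub ¬b y∈ = fixed-false {g}
        (λ { refl → outside-e₀ (¬b ∘ inj₁) y∈ ¬hub })
        (λ { refl → case V.only y∈ of λ { (inj₁ p) → ¬b (inj₂ (inj₁ p)) ; (inj₂ (inj₁ p)) → ¬hub (inj₁ p) ; (inj₂ (inj₂ p)) → ¬b (inj₂ (inj₂ (inj₂ p))) } })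
        (λ { refl → case W.only y∈ of λ { (inj₁ p) → ¬b (inj₂ (inj₁ p)) ; (inj₂ (inj₁ p)) → ¬hub (inj₂ p) ; (inj₂ (inj₂ p)) → ¬b (inj₂ (inj₂ (inj₁ p))) } })

      in-a : In a
      in-a = (eq′ , W.∈₃) , λ { (inj₁ p) → no-both in-z z≢c₀ z∈eq (subst (_∈ₜ tri eq′) p W.∈₃) q∈eq ; (inj₂ p) → W.2≢3 (sym p) }

      not-ab : ∀ {f} → far f ≡ false → a ∈ₜ tri f → b ∈ₜ tri f → ⊥
      not-ab nf a∈ b∈ = case near-cases nf of λ
        { (inj₁ v∈) → case V.only (subst (λ e → a ∈ₜ tri e) (linear V.2≢3 v∈ b∈ V.∈₂ V.∈₃) a∈) of λ
            { (inj₁ p) → W.1≢3 (sym p) ; (inj₂ (inj₁ p)) → proj₂ in-a (inj₁ p) ; (inj₂ (inj₂ p)) → b∉eq (subst (_∈ₜ tri eq′) p W.∈₃) }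
        ; (inj₂ q∈) → b∉eq (subst (λ e → b ∈ₜ tri e) (linear W.2≢3 q∈ a∈ W.∈₂ W.∈₃) b∈) }

      fixed-hub : ∀ e → fixed e ≡ true → Hub (proj₁ (F e)) ⊎ Hub (proj₂ (F e))
      fixed-hub e eq = case fixed-cases e eq of λ
        { (inj₁ refl) → joins-hub hub₀ F₀
        ; (inj₂ (inj₁ refl)) → inj₁ (inj₁ (cong proj₁ F-v))
        ; (inj₂ (inj₂ refl)) → inj₁ (inj₂ (cong proj₁ F-q)) }

      blocked? : ∀ x → Dec (Blocked x)
      blocked? x = (x ≟ c₀) ⊎-dec (x ≟ z) ⊎-dec (x ≟ a) ⊎-dec (x ≟ b)

      open Attaching G prep fixed fixed-hub Blocked blocked? unblocked

      guard : ∀ {P′} → State P′ → ∀ {f x y} → far f ≡ false → Joins (P′ f) x y → x ≢ y → x ∈ₜ tri f → y ∈ₜ tri f →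
              ¬ Attached P′ x → ¬ Attached P′ y → Blocked x → ¬ Blocked y
      guard {P′} st nf _ x≢y x∈ y∈ dx dy bx by = case which bx dx , which by dy of λ
          { (inj₁ refl , inj₁ refl) → x≢y refl ; (inj₁ refl , inj₂ refl) → not-ab nf x∈ y∈
          ; (inj₂ refl , inj₁ refl) → not-ab nf y∈ x∈ ; (inj₂ refl , inj₂ refl) → x≢y refl }
        where
        att₀ : Attached P′ c₀
        att₀ = rest c₀ , hub₀ , edge-reach e₀ (Joins-sym (subst (λ p → Joins p (rest c₀) c₀) (sym (State.keeps st e₀ fixed₀)) F₀))
        attz : Attached P′ z
        attz = v , inj₁ refl , edge-reach ev (inj₂ (trans (State.keeps st ev fixed-v) F-v))
        which : ∀ {x} → Blocked x → ¬ Attached P′ x → x ≡ a ⊎ x ≡ b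
        which (inj₁ refl) d = ⊥-elim (d att₀)
        which (inj₂ (inj₁ refl)) d = ⊥-elim (d attz)
        which (inj₂ (inj₂ r)) _ = r

      result : Eulerian tri
      result = case attached-choice guard of λ (P′ , near , keeps) →
        finish-swap near e₀ t₀ hub₀ (subst (λ p → Joins p (rest c₀) c₀) (sym (keeps e₀ fixed₀)) F₀) λ P″ same →
          step ev (inj₁ (trans (same ev≢e₀) (trans (keeps ev fixed-v) F-v)))
            (edge-reach eq′ (inj₂ (trans (same eq≢e₀) (trans (keeps eq′ fixed-q) F-q))))
        where
        ev≢e₀ : ev ≢ e₀
        ev≢e₀ refl = outside-e₀ z≢c₀ V.∈₁ (proj₂ in-z)
        eq≢e₀ : eq′ ≢ e₀
        eq≢e₀ eq = outside-e₀ z≢c₀ (subst (λ e → z ∈ₜ tri e) eq z∈eq) (proj₂ in-z)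

    eulerian : Eulerian tri
    eulerian = case boundary of λ (z , b , in-z , z≢c₀ , in-b , b≢c₀ , (ev , tv) , even-z , odd-b) →
      case third (tri (B z)) (B-∈ in-z) (B-q in-z) (λ { refl → proj₂ in-z (inj₂ refl) }) of λ (a , tq) →
      case third (tri (B b)) (B-∈ in-b) (B-q in-b) (λ { refl → proj₂ in-b (inj₂ refl) }) of λ (u , tb) →
      case C.colours b of λ (c , b-true) → AtBoundary.result in-z z≢c₀ in-b b≢c₀ tv tq tb even-z odd-b c b-true

  -- The only near triple at `c₀` is `e₀`, so a triple through `c₀` and the outside vertex `y₀` is
  -- far. Its pairs with and without `c₀` differ in weight, which allows the far degree of `c₀` to
  -- be made odd.
  linear-eulerian : Eulerian tri
  linear-eulerian = case cover (e₀ , T₀.∈₃) o₀ (λ { refl → y₀∉ T₀.∈₃ }) of λ (g , c₀∈g , y₀∈g) →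
    case third (tri g) c₀∈g y₀∈g (λ { refl → y₀∉ T₀.∈₃ }) of λ (w , t) →
      case odd-far-graph g (≢false⇒≡true λ near → y₀∉ (subst (λ e → y₀ ∈ₜ tri e) (c₀-near c₀∈g near) y₀∈g))
             (c₀∈g , y₀∈g , Comprises.1≢2 t) (y₀∈g , Comprises.∈₃ t , Comprises.2≢3 t)
             (cong₂ _xor_ (==-refl c₀) (==-≢ (Comprises.1≢2 t ∘ sym)))
             (cong₂ _xor_ (==-≢ (Comprises.1≢2 t ∘ sym)) (==-≢ (Comprises.1≢3 t ∘ sym)))
      of λ (G , odd) → Given.eulerian G odd

module _ {n m} (tri : Fin m → Triple n) (cover : PairCovering tri) where

  -- A spare triple may join either third vertex to either hub; exchanging the hubs or the two
  -- triples reduces these four cases to one. If none occurs, both third vertices are isolated from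
  -- other near triples.
  shared-eulerian : ∀ {e₀ e₁ v q c₀ c₁} → e₀ ≢ e₁ → Comprises (tri e₀) v q c₀ → Comprises (tri e₁) v q c₁ → Eulerian tri
  shared-eulerian {e₀} {e₁} {v} {q} {c₀} {c₁} ne t₀ t₁ = case c₀ ≟ c₁ of λ
    { (yes eq) → SharedPair.equal-thirds tri cover ne t₀ t₁ eq
    ; (no c≢) → case any? (spare? e₀ c₀ v) of λ
      { (yes (g , g≢ , c∈ , v∈)) → SharedPair.spare-triple tri cover ne t₀ t₁ c≢ g≢ c∈ v∈
      ; (no none₁) → case any? (spare? e₀ c₀ q) of λ
        { (yes (g , g≢ , c∈ , q∈)) → SharedPair.spare-triple tri cover ne (Comprises-213 t₀) (Comprises-213 t₁) c≢ g≢ c∈ q∈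
        ; (no none₂) → case any? (spare? e₁ c₁ v) of λ
          { (yes (g , g≢ , c∈ , v∈)) → SharedPair.spare-triple tri cover (ne ∘ sym) t₁ t₀ (c≢ ∘ sym) g≢ c∈ v∈
          ; (no none₃) → case any? (spare? e₁ c₁ q) of λ
            { (yes (g , g≢ , c∈ , q∈)) → SharedPair.spare-triple tri cover (ne ∘ sym) (Comprises-213 t₁) (Comprises-213 t₀) (c≢ ∘ sym) g≢ c∈ q∈
            ; (no none₄) → SharedPair.isolated-thirds tri cover ne t₀ t₁ c≢ (only none₁ none₂) (only none₃ none₄) } } } } }
    where
    Spare : Fin m → Fin n → Fin n → Fin m → Set
    Spare e c h g = g ≢ e × c ∈ₜ tri g × h ∈ₜ tri g
    spare? : ∀ e c h g → Dec (Spare e c h g)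
    spare? e c h g = ¬? (g ≟ e) ×-dec (c ∈ₜ? tri g) ×-dec (h ∈ₜ? tri g)
    only : ∀ {e c} → ¬ ∃ (Spare e c v) → ¬ ∃ (Spare e c q) → ∀ {g} → c ∈ₜ tri g → Hubs.far tri v q g ≡ false → g ≡ e
    only {e} nv nq {g} c∈ near = case g ≟ e of λ
      { (yes eq) → eq
      ; (no g≢) → ⊥-elim (case Hubs.near⇒hub tri v q g near of λ
          { (_ , inj₁ refl , v∈) → nv (g , g≢ , c∈ , v∈) ; (_ , inj₂ refl , q∈) → nq (g , g≢ , c∈ , q∈) }) }

  covering-eulerian : ∀ {e₀ e₁} → e₀ ≢ e₁ → Eulerian tri
  covering-eulerian {e₀} {e₁} e₀≢e₁ = case any? (λ e → any? λ e′ → any? λ x → any? λ y → shared? e e′ x y) of λ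
    { (yes (e , e′ , x , y , ne , x≢y , x∈ , y∈ , x∈′ , y∈′)) →
        case third (tri e) x∈ y∈ x≢y of λ (_ , t) → case third (tri e′) x∈′ y∈′ x≢y of λ (_ , t′) → shared-eulerian ne t t′
    ; (no none) → linear-case λ {e} {e′} {x} {y} x≢y x∈ y∈ x∈′ y∈′ → case e ≟ e′ of λ
        { (yes eq) → eq ; (no ne) → ⊥-elim (none (e , e′ , x , y , ne , x≢y , x∈ , y∈ , x∈′ , y∈′)) } }
    where
    shared? : ∀ e e′ x y → Dec (e ≢ e′ × x ≢ y × x ∈ₜ tri e × y ∈ₜ tri e × x ∈ₜ tri e′ × y ∈ₜ tri e′)
    shared? e e′ x y = ¬? (e ≟ e′) ×-dec ¬? (x ≟ y) ×-dec (x ∈ₜ? tri e) ×-dec (y ∈ₜ? tri e) ×-dec (x ∈ₜ? tri e′) ×-dec (y ∈ₜ? tri e′)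
    linear-case : (∀ {e e′ x y} → x ≢ y → x ∈ₜ tri e → y ∈ₜ tri e → x ∈ₜ tri e′ → y ∈ₜ tri e′ → e ≡ e′) → Eulerian tri
    linear-case linear = case third (tri e₀) (inj₁ refl) (inj₂ (inj₁ refl)) (Triple.≢₁₂ (tri e₀)) of λ (_ , t) →
      -- Some vertex of `e₁` lies outside `e₀`: two common vertices would make the triples equal.
      case Triple.v₁ (tri e₁) ∈ₜ? tri e₀ of λ
        { (no ∉) → Linear.linear-eulerian tri cover linear e₀ t (e₁ , inj₁ refl) ∉
        ; (yes ∈₁) → case Triple.v₂ (tri e₁) ∈ₜ? tri e₀ of λ
          { (no ∉) → Linear.linear-eulerian tri cover linear e₀ t (e₁ , inj₂ (inj₁ refl)) ∉
          ; (yes ∈₂) → ⊥-elim (e₀≢e₁ (linear (Triple.≢₁₂ (tri e₁)) ∈₁ ∈₂ (inj₁ refl) (inj₂ (inj₁ refl)))) } }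

open EulerCircuits
open import Data.Fin.Subset using (Subset; inside; outside; _∈_; _∉_; _⊆_; _∩_; _∪_; ∁; ⁅_⁆; ∣_∣) renaming (⊥ to ∅)
open import Data.Fin.Subset.Properties
  using ( ∣p∣≤n; p⊆q⇒∣p∣≤∣q∣; ∣p∩q∣≤∣q∣; x∈p∩q⁺; x∈p∩q⁻; x∈p∪q⁺; x∈p∪q⁻; x∈⁅x⁆; x∈⁅y⁆⇒x≡y; x∈∁p⇒x∉p; ∪-identityʳ
        ; drop-there; ∣⊥∣≡0 )
open import Data.Vec using ([]; _∷_; here; there)

-- Reduction to triples

∣p∩q∣+∣p∩∁q∣ : (p q : Subset n) → ∣ p ∩ q ∣ + ∣ p ∩ ∁ q ∣ ≡ ∣ p ∣
∣p∩q∣+∣p∩∁q∣ [] [] = refl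
∣p∩q∣+∣p∩∁q∣ (outside ∷ p) (_ ∷ q) = ∣p∩q∣+∣p∩∁q∣ p q
∣p∩q∣+∣p∩∁q∣ (inside ∷ p) (inside ∷ q) = cong suc (∣p∩q∣+∣p∩∁q∣ p q)
∣p∩q∣+∣p∩∁q∣ (inside ∷ p) (outside ∷ q) = trans (ℕₚ.+-suc ∣ p ∩ q ∣ ∣ p ∩ ∁ q ∣) (cong suc (∣p∩q∣+∣p∩∁q∣ p q))

∣p∪⁅x⁆∣ : (p : Subset n) {x : Fin n} → x ∉ p → ∣ p ∪ ⁅ x ⁆ ∣ ≡ suc ∣ p ∣
∣p∪⁅x⁆∣ (inside ∷ p) {zero} x∉ = ⊥-elim (x∉ here)
∣p∪⁅x⁆∣ (outside ∷ p) {zero} x∉ = cong (suc ∘ ∣_∣) (∪-identityʳ p)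
∣p∪⁅x⁆∣ (inside ∷ p) {suc x} x∉ = cong suc (∣p∪⁅x⁆∣ p (x∉ ∘ there))
∣p∪⁅x⁆∣ (outside ∷ p) {suc x} x∉ = ∣p∪⁅x⁆∣ p (x∉ ∘ there)

of-size : ∀ {j n} → j ≤ n → ∃ λ (p : Subset n) → ∣ p ∣ ≡ j
of-size {n = n} z≤n = ∅ , ∣⊥∣≡0 n
of-size (s≤s le) with p , eq ← of-size le = inside ∷ p , cong suc eq

uncons : (p : Subset n) {j : ℕ} → ∣ p ∣ ≡ suc j → ∃₂ λ x r → x ∈ p × x ∉ r × r ⊆ p × ∣ r ∣ ≡ j × (∀ {y} → y ∈ p → y ≡ x ⊎ y ∈ r)
uncons (inside ∷ p) eq = zero , outside ∷ p , here , (λ ()) , (λ { (there i) → there i }) , ℕₚ.suc-injective eq ,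
  λ { here → inj₁ refl ; (there i) → inj₂ (there i) }
uncons (outside ∷ p) eq with x , r , x∈ , x∉ , r⊆ , size , split ← uncons p eq =
  suc x , outside ∷ r , there x∈ , x∉ ∘ drop-there , (λ { (there i) → there (r⊆ i) }) , size ,
  λ { (there i) → case split i of λ { (inj₁ eq) → inj₁ (cong suc eq) ; (inj₂ i′) → inj₂ (there i′) } }

three-elements : (p : Subset n) → 3 ≤ ∣ p ∣ → ∃ λ (T : Triple n) → (∀ {x} → x ∈ₜ T → x ∈ p) × (∣ p ∣ ≡ 3 → ∀ {x} → x ∈ p → x ∈ₜ T)
three-elements p le with j , eq ← ℕₚ.m≤n⇒∃[o]m+o≡n le
  with a , p₁ , a∈ , a∉ , p₁⊆ , s₁ , c₁ ← uncons p (sym eq)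
  with b , p₂ , b∈ , b∉ , p₂⊆ , s₂ , c₂ ← uncons p₁ s₁
  with c , p₃ , c∈ , c∉ , p₃⊆ , s₃ , c₃ ← uncons p₂ s₂ =
  triple a b c (λ { refl → a∉ b∈ }) (λ { refl → a∉ (p₂⊆ c∈) }) (λ { refl → b∉ c∈ }) ,
  (λ { (inj₁ refl) → a∈ ; (inj₂ (inj₁ refl)) → p₁⊆ b∈ ; (inj₂ (inj₂ refl)) → p₁⊆ (p₂⊆ c∈) }) ,
  λ size x∈ → case c₁ x∈ of λ
    { (inj₁ eq) → inj₁ eq
    ; (inj₂ x∈) → case c₂ x∈ of λ
      { (inj₁ eq) → inj₂ (inj₁ eq)
      ; (inj₂ x∈) → case c₃ x∈ of λ
        { (inj₁ eq) → inj₂ (inj₂ eq)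
        ; (inj₂ x∈) → ⊥-elim (empty p₃ (trans s₃ (ℕₚ.+-cancelˡ-≡ 3 j 0 (trans eq size))) x∈) } } }
  where
  empty : ∀ {n} (p : Subset n) → ∣ p ∣ ≡ 0 → ∀ {x} → x ∉ p
  empty (outside ∷ p) eq (there i) = empty p eq i

-- Fixing a set D of k − 3 vertices and shrinking every edge to three of its vertices outside D turns a
-- covering k-hypergraph into a triple system covering the pairs outside D.
module Shrink (j : ℕ) (H : Hypergraph) (cov : Covering (3 + j) H) (e₀ : Edge H) where

  uniform : Uniform (3 + j) H
  uniform = proj₁ cov

  removed : ∃ λ (D : Subset (nV H)) → ∣ D ∣ ≡ j
  removed = of-size (ℕₚ.≤-trans (ℕₚ.m≤n+m j 3) (subst (_≤ nV H) (uniform e₀) (∣p∣≤n (edge H e₀))))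

  D : Subset (nV H)
  D = proj₁ removed

  sizes : ∀ e → ∣ edge H e ∩ D ∣ + ∣ edge H e ∩ ∁ D ∣ ≡ 3 + j
  sizes e = trans (∣p∩q∣+∣p∩∁q∣ (edge H e) D) (uniform e)

  large : ∀ e → 3 ≤ ∣ edge H e ∩ ∁ D ∣
  large e = ℕₚ.+-cancelˡ-≤ j 3 _ (ℕₚ.≤-trans (ℕₚ.≤-reflexive (trans (ℕₚ.+-comm j 3) (sym (sizes e))))
    (ℕₚ.+-monoˡ-≤ ∣ edge H e ∩ ∁ D ∣ (ℕₚ.≤-trans (∣p∩q∣≤∣q∣ (edge H e) D) (ℕₚ.≤-reflexive (proj₂ removed)))))

  exact : ∀ e → D ⊆ edge H e → ∣ edge H e ∩ ∁ D ∣ ≡ 3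
  exact e D⊆ = ℕₚ.+-cancelˡ-≡ j _ 3 (trans (cong (_+ ∣ edge H e ∩ ∁ D ∣) (sym meets)) (trans (sizes e) (ℕₚ.+-comm 3 j)))
    where
    meets : ∣ edge H e ∩ D ∣ ≡ j
    meets = trans (ℕₚ.≤-antisym (∣p∩q∣≤∣q∣ (edge H e) D) (p⊆q⇒∣p∣≤∣q∣ {p = D} λ i → x∈p∩q⁺ (D⊆ i , i))) (proj₂ removed)

  tri : Edge H → Triple (nV H)
  tri e = proj₁ (three-elements (edge H e ∩ ∁ D) (large e))

  tri-∩ : ∀ e {x} → x ∈ₜ tri e → x ∈ edge H e × x ∈ ∁ D
  tri-∩ e x∈ = x∈p∩q⁻ (edge H e) (∁ D) (proj₁ (proj₂ (three-elements (edge H e ∩ ∁ D) (large e))) x∈)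

  -- Together with `x` and `y` the set `D` has k - 1 vertices, hence lies in an edge `f`. As `f`
  -- contains `D`, exactly three of its vertices lie outside, so shrinking `f` involves no choice
  -- and keeps `x` and `y`.
  covers : PairCovering tri
  covers {x} {y} (e , x∈) (e′ , y∈) x≢y = f , member (f⊇ (x∈p∪q⁺ (inj₁ (x∈p∪q⁺ (inj₂ (x∈⁅x⁆ x)))))) (proj₂ (tri-∩ e x∈)) ,
                                             member (f⊇ (x∈p∪q⁺ (inj₂ (x∈⁅x⁆ y)))) (proj₂ (tri-∩ e′ y∈))
    where
    S : Subset (nV H)
    S = (D ∪ ⁅ x ⁆) ∪ ⁅ y ⁆
    x∉D : x ∉ D
    x∉D = x∈∁p⇒x∉p (proj₂ (tri-∩ e x∈))
    y∉Dx : y ∉ D ∪ ⁅ x ⁆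
    y∉Dx i = case x∈p∪q⁻ D ⁅ x ⁆ i of λ
      { (inj₁ y∈D) → x∈∁p⇒x∉p (proj₂ (tri-∩ e′ y∈)) y∈D ; (inj₂ y∈x) → x≢y (sym (x∈⁅y⁆⇒x≡y x y∈x)) }
    size-S : ∣ S ∣ ≡ 2 + j
    size-S = trans (∣p∪⁅x⁆∣ (D ∪ ⁅ x ⁆) y∉Dx) (cong suc (trans (∣p∪⁅x⁆∣ D x∉D) (cong suc (proj₂ removed))))
    containing : ∃ λ f → S ⊆ edge H f
    containing = proj₂ (proj₂ cov) S size-S
    f : Edge H
    f = proj₁ containing
    f⊇ : S ⊆ edge H f
    f⊇ = proj₂ containing
    member : ∀ {z} → z ∈ edge H f → z ∈ ∁ D → z ∈ₜ tri f
    member z∈ z∉D = proj₂ (proj₂ (three-elements (edge H f ∩ ∁ D) (large f)))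
      (exact f (λ i → f⊇ (x∈p∪q⁺ (inj₁ (x∈p∪q⁺ (inj₁ i)))))) (x∈p∩q⁺ (z∈ , z∉D))

-- The pair chosen from an edge gives the two vertices by which the tour enters and leaves it. The
-- length is at least two because distinct edges occupy distinct positions.
euler-tour : (H : Hypergraph) (tri : Edge H → Triple (nV H)) → (∀ e {x} → x ∈ₜ tri e → x ∈ edge H e) →
             2 ≤ nE H → Edge H → Eulerian tri → HasEulerTour H
euler-tour H tri sub two≤ e₀ eul = EC.len , walk , ((ℕₚ.≤-trans two≤ (injective⇒≤ preimage-injective) , EC.closed) , EC.injective ,
    λ e → proj₁ (EC.surjective e) , λ { refl → proj₂ (EC.surjective e) })
  where
  open Eulerian eul
  module EC = EulerCircuit (eulerCircuit graph even (λ e → proj₂ (proj₂ (valid e))) connected e₀)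
  ends : ∀ i → Valid (tri (EC.edg i)) (EC.vert (inject₁ i) , EC.vert (suc i))
  ends i = Valid-Joins {T = tri (EC.edg i)} (valid (EC.edg i)) (EC.joins i)
  walk : Walk H EC.len
  walk = record
    { vert = EC.vert ; edg = EC.edg
    ; inEdgeˡ = λ i → sub (EC.edg i) (proj₁ (ends i))
    ; inEdgeʳ = λ i → sub (EC.edg i) (proj₁ (proj₂ (ends i)))
    ; distinct = λ i → proj₂ (proj₂ (ends i)) }
  preimage-injective : ∀ {e e′} → proj₁ (EC.surjective e) ≡ proj₁ (EC.surjective e′) → e ≡ e′
  preimage-injective {e} {e′} eq = trans (sym (proj₂ (EC.surjective e))) (trans (cong EC.edg eq) (proj₂ (EC.surjective e′)))

two-edges : 2 ≤ m → ∃₂ λ (e e′ : Fin m) → e ≢ e′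
two-edges (s≤s (s≤s _)) = zero , suc zero , λ ()

theorem1p1 : (k : ℕ) → 3 ≤ k → (H : Hypergraph) → Covering k H →
    (HasEulerTour H ⇔ (2 ≤ nE H))
theorem1p1 .(3 + _) (s≤s (s≤s (s≤s (z≤n {j})))) H cov = mk⇔
  -- A closed trail has at least two steps, and they use distinct edges.
  (λ (_ , _ , (two≤ , _) , trail , _) → ℕₚ.≤-trans two≤ (injective⇒≤ trail))
  λ two≤ → case two-edges two≤ of λ (e , e′ , ne) →
    let open Shrink j H cov e in
    euler-tour H tri (λ e x∈ → proj₁ (tri-∩ e x∈)) two≤ e (covering-eulerian tri covers ne)
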